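{- For every integer $k>1$, let $h_k=\frac{3}{2}k^2-\frac{3}{2}k$ and $n_k=\frac{9}{2}k^2+\frac{3}{2}k-2$. There exists a polyiamond $A$ (the "spiral" polyiamond $Spir_k$) with $|A|=n_k$ and $h(A)=h_k$ such that: the dual graph of $A$ is a tree; the outer perimeter of $A$ equals $p_{min}(n_k+h_k)$, i.e. it coincides with that of a polyiamond of minimum perimeter with $|A|+h(A)$ tiles; and every hole of $A$ has area $1$.
   Context: A polyiamond is a planar shape formed as a finite union of closed congruent equilateral triangles (tiles) of the regular triangular lattice, glued along edges, such that any two tiles meeting do so along an entire edge and the interior of the union is connected. $|A|$ is the number of tiles; $h(A)$ is the number of holes, i.e. bounded connected components of $\mathbb{R}^2\setminus A$; the area of a hole is the number of tiles needed to fill it. The dual graph of $A$ has a vertex for each tile and an edge between two tiles sharing an edge. The perimeter $p(A)$ is the number of lattice edges on the topological boundary of $A$; the outer perimeter $p_{out}(A)$ is the number of those boundary edges which do not bound a hole. $p_{min}(n)$ is the minimum perimeter of a polyiamond with $n$ tiles. -}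

module Defs where

open import Data.Nat using (ℕ; zero; suc; _+_; _*_; _∸_; _≤_; _<_)
open import Data.Nat.DivMod using (_/_)
open import Data.Integer as ℤ using (ℤ)
open import Data.Bool using (Bool; true; false)
import Data.Bool.Properties as BoolP
import Data.Integer.Properties as ℤP
open import Data.Product using (Σ; ∃; _×_; _,_; proj₁)
open import Data.Product.Properties using (≡-dec)
open import Data.List using (List; []; _∷_; length; map; filter; head; last)
open import Data.Nat.ListAction using (sum)
open import Data.Bool using (T?)
open import Data.List.Membership.Propositional using (_∈_; _∉_)
open import Data.List.Relation.Unary.All using (All)
open import Data.List.Relation.Unary.Any using (Any)
open import Data.List.Relation.Unary.Unique.Propositional using (Unique)
open import Data.List.Relation.Unary.AllPairs using (AllPairs)
open import Data.List.Relation.Unary.Linked using (Linked)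
open import Data.List.Membership.DecPropositional using ()
open import Data.Maybe using (just)
open import Relation.Binary.PropositionalEquality using (_≡_; _≢_)
open import Relation.Binary using (DecidableEquality)
open import Relation.Nullary using (¬_; Dec; yes; no)
open import Function.Bundles using (_⇔_)

-- Tiles of the regular triangular lattice.
-- Lattice points are a·e₁ + b·e₂ (e₁, e₂ unit vectors at 60°), (a,b) ∈ ℤ².
-- (x , y , true)  = "up"   triangle with vertices (x,y), (x+1,y), (x,y+1)
-- (x , y , false) = "down" triangle with vertices (x+1,y), (x,y+1), (x+1,y+1)

Tile : Set
Tile = ℤ × ℤ × Bool

_≟T_ : DecidableEquality Tile
_≟T_ = ≡-dec ℤP._≟_ (≡-dec ℤP._≟_ BoolP._≟_)

neighbours : Tile → List Tile
neighbours (x , y , true)  =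
  (x , y , false) ∷ (x ℤ.- ℤ.1ℤ , y , false) ∷ (x , y ℤ.- ℤ.1ℤ , false) ∷ []
neighbours (x , y , false) =
  (x , y , true) ∷ (x ℤ.+ ℤ.1ℤ , y , true) ∷ (x , y ℤ.+ ℤ.1ℤ , true) ∷ []

Adj : Tile → Tile → Set
Adj a b = b ∈ neighbours a

data Path (P : Tile → Set) : Tile → Tile → Set where
  here : ∀ {a} → P a → Path P a a
  step : ∀ {a b c} → P a → Adj a b → Path P b c → Path P a c

-- Polyiamonds: a nonempty finite set of tiles (duplicate-free list)
-- whose dual graph is connected (⇔ interior of the union connected).

record Polyiamond : Set where
  field
    tiles     : List Tile
    distinct  : Unique tiles
    nonempty  : tiles ≢ []
    connected : ∀ a b → a ∈ tiles → b ∈ tiles → Path (_∈ tiles) a b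
open Polyiamond public

size : Polyiamond → ℕ
size A = length (tiles A)

_∈?A_ : (t : Tile) (A : Polyiamond) → Dec (t ∈ tiles A)
t ∈?A A = Data.List.Membership.DecPropositional._∈?_ _≟T_ t (tiles A)

notIn : Polyiamond → Tile → Bool
notIn A t with t ∈?A A
... | yes _ = false
... | no  _ = true

perimeter : Polyiamond → ℕ
perimeter A = sum (map (λ a → length (filter (λ b → T? (notIn A b)) (neighbours a))) (tiles A))

-- Complement and holes.  The components of ℝ² ∖ A correspond to the
-- components of the edge-adjacency graph on tiles not in A; a component
-- is bounded iff it consists of finitely many tiles.

ComplPath : Polyiamond → Tile → Tile → Set
ComplPath A = Path (λ t → t ∉ tiles A)

InHole : Polyiamond → Tile → Set
InHole A t = t ∉ tiles A × Σ (List Tile) (λ L → ∀ u → ComplPath A t u → u ∈ L)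

-- H is (the duplicate-free list of tiles of) a hole of A;
-- its area is length H.
IsHole : Polyiamond → List Tile → Set
IsHole A H = Σ Tile λ t → InHole A t × Unique H × (∀ u → (u ∈ H) ⇔ ComplPath A t u)

Disjoint : List Tile → List Tile → Set
Disjoint H H' = ∀ t → t ∈ H → t ∉ H'

-- Hs is the list of all holes of A, each listed once; h(A) = length Hs.
HoleList : Polyiamond → List (List Tile) → Set
HoleList A Hs = All (IsHole A) Hs × AllPairs Disjoint Hs
              × (∀ t → InHole A t → Any (t ∈_) Hs)

OuterBoundaryEdge : Polyiamond → Tile × Tile → Set
OuterBoundaryEdge A (a , b) = a ∈ tiles A × Adj a b × b ∉ tiles A × ¬ InHole A b

HasOuterPerimeter : Polyiamond → ℕ → Set
HasOuterPerimeter A p = Σ (List (Tile × Tile)) λ E →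
  Unique E × (∀ e → (e ∈ E) ⇔ OuterBoundaryEdge A e) × length E ≡ p

IsPmin : ℕ → ℕ → Set
IsPmin n p = (Σ Polyiamond λ B → size B ≡ n × perimeter B ≡ p)
           × (∀ B → size B ≡ n → p ≤ perimeter B)

-- Dual graph of A is a tree: connected (built into Polyiamond) and
-- without cycles.  A cycle: ≥ 3 distinct tiles of A, consecutive ones
-- adjacent, and the last adjacent to the first.

IsCycle : Polyiamond → List Tile → Set
IsCycle A c = 3 ≤ length c × Unique c × All (_∈ tiles A) c × Linked Adj c
            × Σ Tile λ f → Σ Tile λ l → head c ≡ just f × last c ≡ just l × Adj l f

DualTree : Polyiamond → Set
DualTree A = ¬ Σ (List Tile) (IsCycle A)

hk : ℕ → ℕ
hk k = (3 * k * k ∸ 3 * k) / 2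

nk : ℕ → ℕ
nk k = (9 * k * k + 3 * k) / 2 ∸ 2

{-# OPTIONS --safe #-}
module Submission where

open import Defs
open import Data.Nat using (ℕ; _<_; _+_)
open import Data.Product using (Σ; _×_)
open import Data.List using (List; length)
open import Data.List.Relation.Unary.All using (All)
open import Relation.Binary.PropositionalEquality using (_≡_)

open import Data.Bool as Bool using (Bool; true; false; not; _∧_; _∨_; _xor_; if_then_else_; T; T?)
open import Data.Empty using (⊥; ⊥-elim)
open import Data.Fin using (Fin; zero; suc)
open import Data.Fin.Patterns
open import Data.Integer as ℤ using (ℤ; +_; -[1+_]; 0ℤ; 1ℤ; -1ℤ; ∣_∣)
import Data.Integer.Properties as ℤP
open import Data.Integer.Tactic.RingSolver using (solve-∀)
open import Data.List using ([]; _∷_; _++_; last; map; filter; upTo; cartesianProduct; concatMap)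
open import Data.List.Membership.Propositional using (_∈_; _∉_; find)
open import Data.List.Membership.Propositional.Properties
open import Data.List.Properties using (length-map; length-++; length-upTo)
open import Data.List.Relation.Unary.All as All using ([]; _∷_)
import Data.List.Relation.Unary.All.Properties as AllP
open import Data.List.Relation.Unary.AllPairs using (AllPairs; []; _∷_)
open import Data.List.Relation.Unary.Any as Any using (here; there)
import Data.List.Relation.Unary.Any.Properties as AnyP
open import Data.List.Relation.Unary.Linked using (Linked; _∷_)
open import Data.List.Relation.Unary.Unique.Propositional using (Unique)
import Data.List.Relation.Unary.Unique.Propositional.Properties as Uniq
open import Data.Maybe as Maybe using (Maybe; just; nothing; fromMaybe; maybe; is-nothing)
open import Data.Maybe.Properties using (just-injective)
open import Data.Maybe.Relation.Unary.All as MaybeAll using (just; nothing)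
open import Data.Nat as ℕ using (zero; suc; s≤s; z≤n)
import Data.Nat.Divisibility as ℕD
open import Data.Nat.DivMod using (m*n/n≡m)
open import Data.Nat.ListAction using (sum)
import Data.Nat.Properties as ℕP
import Data.Nat.Tactic.RingSolver as ℕSolver
open import Data.Product using (_,_; proj₁; proj₂)
open import Data.Sum using (_⊎_; inj₁; inj₂)
open import Data.Unit using (tt)
open import Data.Vec using (Vec; []; _∷_; lookup)
open import Function using (_∘_; case_of_)
open import Function.Bundles using (mk⇔)
open import Relation.Binary.PropositionalEquality
open import Relation.Nullary using (¬_; Dec; yes; no; does)
open import Relation.Nullary.Decidable using (¬?; _×-dec_; _⊎-dec_; from-yes)
open import Relation.Unary using (Decidable)

-- Give a tile coordinates (w , x , y) with sum 1 (up) or 0 (down). The tiles with all coordinates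
-- in [1 - k, k] form a hexagon with sides alternately k + 1 and k - 1, area 6k² - 2 and perimeter
-- 6k. It is filled by the concentric hexagons of parameters d = 1, …, k around a triangle of four
-- tiles. Place a hole outwards on every second of the 6d boundary edges of the d-th hexagon,
-- d < k: these 3(1 + … + (k - 1)) holes are pairwise apart, and what remains is a tree, since each
-- piece of the ring around the d-th hexagon is joined to the inside by exactly one of the
-- remaining edges. The pattern is invariant under the rotation w → x → y → w.
--
-- The minimality of 6k is the isoperimetric inequality 6n ≤ p² + 3. If a, b, c are the numbers of
-- strips of the three directions met by a polyiamond, then p ≥ a + b + c, because each strip has
-- two ends and each boundary edge ends two strips. The bounds of the x- and y-strips limit the
-- lengths of the w-strips to two arithmetic progressions, which gives 2n ≤ 2c(a + b) - c² + 1;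
-- finally 6c(a + b) - 3c² ≤ (a + b + c)².

-- Linear integer arithmetic with parities: Fourier–Motzkin elimination

-- One parent map settles both halves of the tree claim. Following parents lowers `rank` and ends at
-- `origin`, which gives connectedness; every edge between two tiles of the spiral joins a tile to
-- its parent, which excludes cycles. So no edges or pieces of rings are counted.
--
-- Holes, parents and the rank are given by conditions on the signs and parities of coordinates that
-- do not mention k. Each local claim is then a statement of linear arithmetic with parities in a
-- few integer variables, and evaluating a checker proved sound below decides it.
--
-- The inequality 6n ≤ p² + 3 is not sharp, but it is sharp enough: for n = 6k² - 2 a perimeter of
-- at most 6k - 1 would give 36k² - 12 ≤ (6k - 1)² + 3, that is 12k ≤ 16. This is where k > 1
-- enters.

private variable
  n : ℕ
  A B : Set

bit : Bool → ℤ
bit false = 0ℤ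
bit true  = 1ℤ

record HasParity (b : Bool) (z : ℤ) : Set where
  constructor halved
  field half    : ℤ
        equation : z ≡ bit b ℤ.+ + 2 ℤ.* half

1≢2* : ∀ h → ¬ (1ℤ ≡ + 2 ℤ.* h)
1≢2* h eq = case ℕD.∣1⇒≡1 2∣1 of λ ()
  where
  2∣1 : 2 ℕD.∣ 1
  2∣1 = subst (2 ℕD.∣_) (sym (trans (cong ∣_∣ eq) (ℤP.abs-* (+ 2) h))) (ℕD.m∣m*n ∣ h ∣)

parity-unique : ∀ {b c z} → HasParity b z → HasParity c z → b ≡ c
parity-unique {false} {false} _ _ = refl
parity-unique {true} {true} _ _ = refl
parity-unique {false} {true} (halved h p) (halved h′ q) =
  ⊥-elim (1≢2* (h ℤ.- h′) (trans (lem h′)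
    (trans (cong (ℤ._- (+ 2 ℤ.* h′)) (trans (sym q) p)) (lem′ h h′))))
  where
  lem : ∀ a → 1ℤ ≡ (1ℤ ℤ.+ + 2 ℤ.* a) ℤ.- + 2 ℤ.* a
  lem = solve-∀
  lem′ : ∀ a b → (0ℤ ℤ.+ + 2 ℤ.* a) ℤ.- + 2 ℤ.* b ≡ + 2 ℤ.* (a ℤ.- b)
  lem′ = solve-∀
parity-unique {true} {false} p q = sym (parity-unique q p)

parity-+ : ∀ {b c x y} → HasParity b x → HasParity c y → HasParity (b xor c) (x ℤ.+ y)
parity-+ {false} {c}     (halved h refl) (halved i refl) = halved (h ℤ.+ i) (lem (bit c) h i)
  where lem : ∀ e a b → (0ℤ ℤ.+ + 2 ℤ.* a) ℤ.+ (e ℤ.+ + 2 ℤ.* b) ≡ e ℤ.+ + 2 ℤ.* (a ℤ.+ b)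
        lem = solve-∀
parity-+ {true}  {false} (halved h refl) (halved i refl) = halved (h ℤ.+ i) (lem h i)
  where lem : ∀ a b → (1ℤ ℤ.+ + 2 ℤ.* a) ℤ.+ (0ℤ ℤ.+ + 2 ℤ.* b) ≡ 1ℤ ℤ.+ + 2 ℤ.* (a ℤ.+ b)
        lem = solve-∀
parity-+ {true}  {true}  (halved h refl) (halved i refl) = halved (h ℤ.+ i ℤ.+ 1ℤ) (lem h i)
  where lem : ∀ a b → (1ℤ ℤ.+ + 2 ℤ.* a) ℤ.+ (1ℤ ℤ.+ + 2 ℤ.* b) ≡ 0ℤ ℤ.+ + 2 ℤ.* (a ℤ.+ b ℤ.+ 1ℤ)
        lem = solve-∀

parity-* : ∀ {b c x y} → HasParity b x → HasParity c y → HasParity (b ∧ c) (x ℤ.* y)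
parity-* {false} {c}     (halved h refl) (halved i refl) = halved (h ℤ.* (bit c ℤ.+ + 2 ℤ.* i)) (lem h (bit c ℤ.+ + 2 ℤ.* i))
  where lem : ∀ a y → (0ℤ ℤ.+ + 2 ℤ.* a) ℤ.* y ≡ 0ℤ ℤ.+ + 2 ℤ.* (a ℤ.* y)
        lem = solve-∀
parity-* {true}  {c} (halved h refl) (halved i refl) = halved (i ℤ.+ h ℤ.* (bit c ℤ.+ + 2 ℤ.* i)) (lem (bit c) h i)
  where lem : ∀ e a b → (1ℤ ℤ.+ + 2 ℤ.* a) ℤ.* (e ℤ.+ + 2 ℤ.* b) ≡ e ℤ.+ + 2 ℤ.* (b ℤ.+ a ℤ.* (e ℤ.+ + 2 ℤ.* b))
        lem = solve-∀

parity-neg : ∀ {b x} → HasParity b x → HasParity b (ℤ.- x)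
parity-neg {b} (halved h refl) = halved (ℤ.- h ℤ.- bit b) (lem (bit b) h)
  where lem : ∀ e a → ℤ.- (e ℤ.+ + 2 ℤ.* a) ≡ e ℤ.+ + 2 ℤ.* (ℤ.- a ℤ.- e)
        lem = solve-∀

oddℕ : ℕ → Bool
oddℕ zero    = false
oddℕ (suc n) = not (oddℕ n)

odd : ℤ → Bool
odd (+ n)    = oddℕ n
odd -[1+ n ] = oddℕ (suc n)

parity-ℕ : ∀ n → HasParity (oddℕ n) (+ n)
parity-ℕ zero    = halved 0ℤ refl
parity-ℕ (suc n) = parity-+ {true} {oddℕ n} (halved 0ℤ refl) (parity-ℕ n)

parity-odd : ∀ z → HasParity (odd z) z
parity-odd (+ n)    = parity-ℕ n
parity-odd -[1+ n ] = parity-neg {x = + suc n} (parity-ℕ (suc n))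

hasParity? : ∀ b z → Dec (HasParity b z)
hasParity? b z with odd z Bool.≟ b
... | yes refl = yes (parity-odd z)
... | no  b≢   = no λ p → b≢ (parity-unique (parity-odd z) p)

infixl 7 _⊛_
infixl 6 _⊕_ _⊖_
infix  5 _⊑_
infixr 4 _⊓_
infixr 3 _⊔_

data Term (n : ℕ) : Set where
  var         : Fin n → Term n
  con         : ℤ → Term n
  _⊕_ _⊖_     : Term n → Term n → Term n
  _⊛_         : ℤ → Term n → Term n

data Form (n : ℕ) : Set where
  _⊑_     : Term n → Term n → Form n
  parity  : Bool → Term n → Form n
  _⊓_ _⊔_ : Form n → Form n → Form n
  ff      : Form n

value : Term n → Vec ℤ n → ℤ
value (var i) ρ = lookup ρ i
value (con c) ρ = c
value (s ⊕ t) ρ = value s ρ ℤ.+ value t ρ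
value (s ⊖ t) ρ = value s ρ ℤ.- value t ρ
value (a ⊛ t) ρ = a ℤ.* value t ρ

⟦_⟧ : Form n → Vec ℤ n → Set
⟦ s ⊑ t ⟧      ρ = value s ρ ℤ.≤ value t ρ
⟦ parity b t ⟧ ρ = HasParity b (value t ρ)
⟦ φ ⊓ ψ ⟧      ρ = ⟦ φ ⟧ ρ × ⟦ ψ ⟧ ρ
⟦ φ ⊔ ψ ⟧      ρ = ⟦ φ ⟧ ρ ⊎ ⟦ ψ ⟧ ρ
⟦ ff ⟧         ρ = ⊥

dec : ∀ (φ : Form n) ρ → Dec (⟦ φ ⟧ ρ)
dec (s ⊑ t)      ρ = value s ρ ℤ.≤? value t ρ
dec (parity b t) ρ = hasParity? b (value t ρ)
dec (φ ⊓ ψ)      ρ = dec φ ρ ×-dec dec ψ ρ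
dec (φ ⊔ ψ)      ρ = dec φ ρ ⊎-dec dec ψ ρ
dec ff           ρ = no λ ()

-- Over the integers the negation of an atom is again an atom, so forms need no negation connective
-- and the checker meets positive occurrences only.
neg : Form n → Form n
neg (s ⊑ t)      = t ⊕ con 1ℤ ⊑ s
neg (parity b t) = parity (not b) t
neg (φ ⊓ ψ)      = neg φ ⊔ neg ψ
neg (φ ⊔ ψ)      = neg φ ⊓ neg ψ
neg ff           = con 0ℤ ⊑ con 0ℤ

neg-complete : ∀ (φ : Form n) ρ → ¬ ⟦ φ ⟧ ρ → ⟦ neg φ ⟧ ρ
neg-complete (s ⊑ t) ρ ¬p =
  subst (ℤ._≤ value s ρ) (ℤP.+-comm 1ℤ (value t ρ)) (ℤP.i<j⇒suc[i]≤j (ℤP.≰⇒> ¬p))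
neg-complete (parity b t) ρ ¬p with odd (value t ρ) | parity-odd (value t ρ)
neg-complete (parity false t) ρ ¬p | false | p = ⊥-elim (¬p p)
neg-complete (parity false t) ρ ¬p | true  | p = p
neg-complete (parity true t)  ρ ¬p | false | p = p
neg-complete (parity true t)  ρ ¬p | true  | p = ⊥-elim (¬p p)
neg-complete (φ ⊓ ψ) ρ ¬p with dec φ ρ
... | yes p = inj₂ (neg-complete ψ ρ (¬p ∘ (p ,_)))
... | no  q = inj₁ (neg-complete φ ρ q)
neg-complete (φ ⊔ ψ) ρ ¬p = neg-complete φ ρ (¬p ∘ inj₁) , neg-complete ψ ρ (¬p ∘ inj₂)
neg-complete ff ρ ¬p = ℤP.≤-refl

neg-sound : ∀ (φ : Form n) ρ → ⟦ neg φ ⟧ ρ → ¬ ⟦ φ ⟧ ρ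
neg-sound (s ⊑ t) ρ p q =
  ℤP.<-irrefl refl (ℤP.<-≤-trans (ℤP.suc[i]≤j⇒i<j (subst (ℤ._≤ value s ρ) (ℤP.+-comm (value t ρ) 1ℤ) p)) q)
neg-sound (parity b t) ρ p q with parity-unique p q
neg-sound (parity false t) ρ p q | ()
neg-sound (parity true t)  ρ p q | ()
neg-sound (φ ⊓ ψ) ρ (inj₁ p) (q , _) = neg-sound φ ρ p q
neg-sound (φ ⊓ ψ) ρ (inj₂ p) (_ , q) = neg-sound ψ ρ p q
neg-sound (φ ⊔ ψ) ρ (p , _) (inj₁ q) = neg-sound φ ρ p q
neg-sound (φ ⊔ ψ) ρ (_ , p) (inj₂ q) = neg-sound ψ ρ p q
neg-sound ff ρ p ()

data Lin : ℕ → Set where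
  cst : ℤ → Lin 0
  _∷_ : ℤ → Lin n → Lin (suc n)

eval : Lin n → Vec ℤ n → ℤ
eval (cst c) []      = c
eval (a ∷ l) (v ∷ ρ) = a ℤ.* v ℤ.+ eval l ρ

constant : ℤ → Lin n
constant {zero}  c = cst c
constant {suc n} c = 0ℤ ∷ constant c

unit : Fin n → Lin n
unit zero    = 1ℤ ∷ constant 0ℤ
unit (suc i) = 0ℤ ∷ unit i

combine : ℤ → Lin n → ℤ → Lin n → Lin n
combine a (cst c) b (cst d) = cst (a ℤ.* c ℤ.+ b ℤ.* d)
combine a (c ∷ l) b (d ∷ m) = (a ℤ.* c ℤ.+ b ℤ.* d) ∷ combine a l b m

eval-constant : ∀ c (ρ : Vec ℤ n) → eval (constant c) ρ ≡ c
eval-constant c []      = refl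
eval-constant c (v ∷ ρ) = trans (ℤP.+-identityˡ _) (eval-constant c ρ)

eval-unit : ∀ i (ρ : Vec ℤ n) → eval (unit i) ρ ≡ lookup ρ i
eval-unit zero (v ∷ ρ) = trans (cong (ℤ._+_ (1ℤ ℤ.* v)) (eval-constant 0ℤ ρ)) (lem v)
  where lem : ∀ v → 1ℤ ℤ.* v ℤ.+ 0ℤ ≡ v
        lem = solve-∀
eval-unit (suc i) (v ∷ ρ) = trans (ℤP.+-identityˡ _) (eval-unit i ρ)

eval-combine : ∀ a (l : Lin n) b m ρ →
  eval (combine a l b m) ρ ≡ a ℤ.* eval l ρ ℤ.+ b ℤ.* eval m ρ
eval-combine a (cst c) b (cst d) [] = refl
eval-combine a (c ∷ l) b (d ∷ m) (v ∷ ρ) =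
  trans (cong (ℤ._+_ ((a ℤ.* c ℤ.+ b ℤ.* d) ℤ.* v)) (eval-combine a l b m ρ))
        (lem a b c d v (eval l ρ) (eval m ρ))
  where
  lem : ∀ a b c d v x y → (a ℤ.* c ℤ.+ b ℤ.* d) ℤ.* v ℤ.+ (a ℤ.* x ℤ.+ b ℤ.* y)
                        ≡ a ℤ.* (c ℤ.* v ℤ.+ x) ℤ.+ b ℤ.* (d ℤ.* v ℤ.+ y)
  lem = solve-∀

linearise : Term n → Lin n
linearise (var i) = unit i
linearise (con c) = constant c
linearise (s ⊕ t) = combine 1ℤ (linearise s) 1ℤ (linearise t)
linearise (s ⊖ t) = combine 1ℤ (linearise s) (ℤ.- 1ℤ) (linearise t)
linearise (a ⊛ t) = combine a (linearise t) 0ℤ (constant 0ℤ)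

eval-linearise : ∀ (t : Term n) ρ → eval (linearise t) ρ ≡ value t ρ
eval-linearise (var i) ρ = eval-unit i ρ
eval-linearise (con c) ρ = eval-constant c ρ
eval-linearise (s ⊕ t) ρ
  rewrite eval-combine 1ℤ (linearise s) 1ℤ (linearise t) ρ
        | eval-linearise s ρ | eval-linearise t ρ = lem (value s ρ) (value t ρ)
  where lem : ∀ x y → 1ℤ ℤ.* x ℤ.+ 1ℤ ℤ.* y ≡ x ℤ.+ y
        lem = solve-∀
eval-linearise (s ⊖ t) ρ
  rewrite eval-combine 1ℤ (linearise s) (ℤ.- 1ℤ) (linearise t) ρ
        | eval-linearise s ρ | eval-linearise t ρ = lem (value s ρ) (value t ρ)
  where lem : ∀ x y → 1ℤ ℤ.* x ℤ.+ (ℤ.- 1ℤ) ℤ.* y ≡ x ℤ.- y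
        lem = solve-∀
eval-linearise (a ⊛ t) ρ
  rewrite eval-combine a (linearise t) 0ℤ (constant 0ℤ) ρ
        | eval-linearise t ρ = ℤP.+-identityʳ _

oddLin : Lin n → Vec Bool n → Bool
oddLin (cst c) []       = odd c
oddLin (a ∷ l) (b ∷ bs) = (odd a ∧ b) xor oddLin l bs

data Parities : Vec Bool n → Vec ℤ n → Set where
  []  : Parities [] []
  _∷_ : ∀ {b bs v} {ρ : Vec ℤ n} → HasParity b v → Parities bs ρ → Parities (b ∷ bs) (v ∷ ρ)

parity-oddLin : ∀ (l : Lin n) {bs ρ} → Parities bs ρ → HasParity (oddLin l bs) (eval l ρ)
parity-oddLin (cst c) []       = parity-odd c
parity-oddLin (a ∷ l) (p ∷ ps) = parity-+ (parity-* (parity-odd a) p) (parity-oddLin l ps)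

Nonneg : Vec ℤ n → Lin n → Set
Nonneg ρ l = 0ℤ ℤ.≤ eval l ρ

-- An odd nonnegative value is at least 1. This rounding is the only place where the elimination,
-- otherwise valid over the rationals, uses integrality.
tighten : Vec Bool n → Lin n → Lin n
tighten bs l = if oddLin l bs then combine 1ℤ l 1ℤ (constant (ℤ.- 1ℤ)) else l

tighten-sound : ∀ {bs} {ρ : Vec ℤ n} → Parities bs ρ → ∀ l → Nonneg ρ l → Nonneg ρ (tighten bs l)
tighten-sound {bs = bs} {ρ} ps l p with oddLin l bs | parity-oddLin l ps
... | false | _ = p
... | true  | q rewrite eval-combine 1ℤ l 1ℤ (constant (ℤ.- 1ℤ)) ρ | eval-constant (ℤ.- 1ℤ) ρ =
  pred≥0 (eval l ρ) q p
  where
  pred≥0 : ∀ z → HasParity true z → 0ℤ ℤ.≤ z → 0ℤ ℤ.≤ 1ℤ ℤ.* z ℤ.+ (ℤ.- 1ℤ)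
  pred≥0 (+ zero)  q _ = case parity-unique {false} (halved 0ℤ refl) q of λ ()
  pred≥0 (+ suc m) _ _ = ℤ.+≤+ ℕ.z≤n

data Comparison : Set where
  different tighter looser : Comparison

sameℤ : ℤ → ℤ → Bool
sameℤ (+ a)    (+ b)    = a ℕ.≡ᵇ b
sameℤ -[1+ a ] -[1+ b ] = a ℕ.≡ᵇ b
sameℤ _        _        = false

-- Constraints say that a linear form is nonnegative, so among forms with equal coefficients the one
-- with the smaller constant is the stronger.
compareLin : Lin n → Lin n → Comparison
compareLin (cst c) (cst d) = if c ℤ.≤ᵇ d then tighter else looser
compareLin (a ∷ l) (b ∷ m) = if sameℤ a b then compareLin l m else different

-- nothing if the new constraint is implied by a single one already present
insert : Lin n → List (Lin n) → Maybe (List (Lin n))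
insert l []      = just (l ∷ [])
insert l (m ∷ Γ) with compareLin l m
... | different = Maybe.map (m ∷_) (insert l Γ)
... | tighter   = just (l ∷ Γ)
... | looser    = nothing

insert-sound : ∀ {ρ : Vec ℤ n} {l} → Nonneg ρ l → ∀ Γ → All (Nonneg ρ) Γ → MaybeAll.All (All (Nonneg ρ)) (insert l Γ)
insert-sound p []      []       = just (p ∷ [])
insert-sound {l = l} p (m ∷ Γ) (q ∷ qs) with compareLin l m
... | tighter   = just (p ∷ qs)
... | looser    = nothing
... | different with insert l Γ | insert-sound {l = l} p Γ qs
...   | nothing | _       = nothing
...   | just _  | just rs = just (q ∷ rs)

-- The lower and upper bounds on the leading variable (with the positive absolute value of
-- its coefficient), and the constraints not involving it.
record Bounds (n : ℕ) : Set where
  constructor bounds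
  field lower upper : List (ℕ × Lin n)
        free        : List (Lin n)

classify : Lin (suc n) → Bounds n → Bounds n
classify (+ zero ∷ l)   (bounds lo up fr) = bounds lo up (l ∷ fr)
classify (+ suc a ∷ l)  (bounds lo up fr) = bounds ((suc a , l) ∷ lo) up fr
classify (-[1+ a ] ∷ l) (bounds lo up fr) = bounds lo ((suc a , l) ∷ up) fr

collect : List (Lin (suc n)) → Bounds n
collect []      = bounds [] [] []
collect (l ∷ Γ) = classify l (collect Γ)

strengthen : Lin n → List (Lin n) → List (Lin n)
strengthen l Γ = fromMaybe Γ (insert l Γ)

-- The Fourier-Motzkin step: from a·v + l ≥ 0 and -b·v + m ≥ 0 the variable v cancels in b·l + a·m ≥
-- 0.
resolve : Vec Bool n → ℕ × Lin n → List (ℕ × Lin n) → List (Lin n) → List (Lin n)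
resolve bs (a , l) []             Γ = Γ
resolve bs (a , l) ((b , m) ∷ up) Γ = strengthen (tighten bs (combine (+ b) l (+ a) m)) (resolve bs (a , l) up Γ)

resolveAll : Vec Bool n → List (ℕ × Lin n) → List (ℕ × Lin n) → List (Lin n) → List (Lin n)
resolveAll bs []       up Γ = Γ
resolveAll bs (l ∷ lo) up Γ = resolve bs l up (resolveAll bs lo up Γ)

eliminate : Vec Bool n → List (Lin (suc n)) → List (Lin n)
eliminate bs Γ = eliminateBounds (collect Γ)
  where
  eliminateBounds : Bounds _ → List (Lin _)
  eliminateBounds (bounds lo up fr) = resolveAll bs lo up fr

-- The answer `true` exhibits a negative constant claimed to be nonnegative; the answer `false`
-- asserts nothing. Only soundness is proved.
unsat : Vec Bool n → List (Lin n) → Bool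
unsat [] []                    = false
unsat [] (cst (+ _) ∷ Γ)       = unsat [] Γ
unsat [] (cst -[1+ _ ] ∷ Γ)    = true
unsat (b ∷ bs) Γ               = unsat bs (eliminate bs Γ)

Lower Upper : ℤ → Vec ℤ n → ℕ × Lin n → Set
Lower v ρ (a , l) = 0ℤ ℤ.≤ + a ℤ.* v ℤ.+ eval l ρ
Upper v ρ (a , l) = 0ℤ ℤ.≤ ℤ.- (+ a) ℤ.* v ℤ.+ eval l ρ

record BoundsHold (v : ℤ) (ρ : Vec ℤ n) (B : Bounds n) : Set where
  constructor hold
  field lowers : All (Lower v ρ) (Bounds.lower B)
        uppers : All (Upper v ρ) (Bounds.upper B)
        frees  : All (Nonneg ρ) (Bounds.free B)

collect-sound : ∀ {v} {ρ : Vec ℤ n} Γ → All (Nonneg (v ∷ ρ)) Γ → BoundsHold v ρ (collect Γ)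
collect-sound [] [] = hold [] [] []
collect-sound ((+ zero ∷ l) ∷ Γ) (p ∷ ps) with hold x y z ← collect-sound Γ ps =
  hold x y (subst (0ℤ ℤ.≤_) (ℤP.+-identityˡ _) p ∷ z)
collect-sound ((+ suc a ∷ l) ∷ Γ) (p ∷ ps) with hold x y z ← collect-sound Γ ps = hold (p ∷ x) y z
collect-sound ((-[1+ a ] ∷ l) ∷ Γ) (p ∷ ps) with hold x y z ← collect-sound Γ ps = hold x (p ∷ y) z

0≤-combine : ∀ a b v x y → 0ℤ ℤ.≤ + a ℤ.* v ℤ.+ x → 0ℤ ℤ.≤ ℤ.- (+ b) ℤ.* v ℤ.+ y →
             0ℤ ℤ.≤ + b ℤ.* x ℤ.+ + a ℤ.* y
0≤-combine a b v x y p q =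
  subst (0ℤ ℤ.≤_) (lem (+ a) (+ b) v x y) (ℤP.+-mono-≤ (scale b p) (scale a q))
  where
  scale : ∀ c {z} → 0ℤ ℤ.≤ z → 0ℤ ℤ.≤ + c ℤ.* z
  scale c {z} r = subst (ℤ._≤ + c ℤ.* z) (ℤP.*-zeroʳ (+ c)) (ℤP.*-monoˡ-≤-nonNeg (+ c) r)
  lem : ∀ a b v x y → b ℤ.* (a ℤ.* v ℤ.+ x) ℤ.+ a ℤ.* (ℤ.- b ℤ.* v ℤ.+ y) ≡ b ℤ.* x ℤ.+ a ℤ.* y
  lem = solve-∀

module _ {bs} {v : ℤ} {ρ : Vec ℤ n} (ps : Parities bs ρ) where

  resolve-sound : ∀ {l up Γ} → Lower v ρ l → All (Upper v ρ) up → All (Nonneg ρ) Γ →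
                  All (Nonneg ρ) (resolve bs l up Γ)
  resolve-sound p []       r = r
  resolve-sound {a , l} {(b , m) ∷ up} {Γ} p (q ∷ qs) r
    with insert (tighten bs (combine (+ b) l (+ a) m)) (resolve bs (a , l) up Γ)
       | insert-sound {l = tighten bs (combine (+ b) l (+ a) m)}
           (tighten-sound ps (combine (+ b) l (+ a) m)
             (subst (0ℤ ℤ.≤_) (sym (eval-combine (+ b) l (+ a) m ρ)) (0≤-combine a b v _ _ p q)))
           (resolve bs (a , l) up Γ) (resolve-sound {a , l} p qs r)
  ... | nothing | _       = resolve-sound {a , l} p qs r
  ... | just _  | just r′ = r′

  resolveAll-sound : ∀ {lo up Γ} → All (Lower v ρ) lo → All (Upper v ρ) up → All (Nonneg ρ) Γ →
                     All (Nonneg ρ) (resolveAll bs lo up Γ)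
  resolveAll-sound []       q r = r
  resolveAll-sound (p ∷ ps) q r = resolve-sound p q (resolveAll-sound ps q r)

unsat-sound : ∀ {bs} {ρ : Vec ℤ n} → Parities bs ρ → ∀ Γ → unsat bs Γ ≡ true → ¬ All (Nonneg ρ) Γ
unsat-sound [] (cst (+ _) ∷ Γ) eq (_ ∷ ps) = unsat-sound [] Γ eq ps
unsat-sound [] (cst -[1+ _ ] ∷ Γ) eq (() ∷ _)
unsat-sound {bs = b ∷ bs} (_ ∷ ps) Γ eq Γ≥0 =
  let hold x y z = collect-sound Γ Γ≥0 in
  unsat-sound ps (eliminate bs Γ) eq (resolveAll-sound ps x y z)

eqBool : Bool → Bool → Bool
eqBool true  b = b
eqBool false b = not b

-- A cheap heuristic that needs no correctness proof: skipping a disjunction merely leaves the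
-- refutation with fewer constraints.
implied : Vec Bool n → List (Lin n) → Form n → Bool
implied bs Γ (s ⊑ t)      = is-nothing (insert (tighten bs (linearise (t ⊖ s))) Γ)
implied bs Γ (parity b t) = eqBool b (oddLin (linearise t) bs)
implied bs Γ (φ ⊓ ψ)      = implied bs Γ φ ∧ implied bs Γ ψ
implied bs Γ (φ ⊔ ψ)      = implied bs Γ φ ∨ implied bs Γ ψ
implied bs Γ ff           = false

-- Skipping the disjunctions that are already implied avoids most of the branching.
refute : Vec Bool n → Form n → (List (Lin n) → Bool) → List (Lin n) → Bool
refute bs (s ⊑ t)      κ Γ =
  maybe (λ Δ → unsat bs Δ ∨ κ Δ) (κ Γ) (insert (tighten bs (linearise (t ⊖ s))) Γ)
refute bs (parity b t) κ Γ = if eqBool b (oddLin (linearise t) bs) then κ Γ else true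
refute bs (φ ⊓ ψ)      κ Γ = refute bs φ (refute bs ψ κ) Γ
refute bs (φ ⊔ ψ)      κ Γ =
  if implied bs Γ (φ ⊔ ψ) then κ Γ else (refute bs φ κ Γ ∧ refute bs ψ κ Γ)
refute bs ff           κ Γ = true

eqBool-then : ∀ {b c x} → b ≡ c → (if eqBool b c then x else true) ≡ true → x ≡ true
eqBool-then {true}  refl eq = eq
eqBool-then {false} refl eq = eq

∧-true : ∀ {a b} → a ∧ b ≡ true → a ≡ true × b ≡ true
∧-true {true} eq = refl , eq

∨-true : ∀ {a b} → a ∨ b ≡ true → a ≡ true ⊎ b ≡ true
∨-true {true}  eq = inj₁ refl
∨-true {false} eq = inj₂ eq

Refutes : Vec ℤ n → (List (Lin n) → Bool) → Set
Refutes ρ κ = ∀ Γ → κ Γ ≡ true → ¬ All (Nonneg ρ) Γ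

-- The continuation has to be sound only under `φ`. Hence the induction can start from the
-- continuation that always answers `false`, which is vacuously sound.
refute-sound : ∀ {bs} {ρ : Vec ℤ n} → Parities bs ρ → ∀ φ {κ} →
               (⟦ φ ⟧ ρ → Refutes ρ κ) → ⟦ φ ⟧ ρ → Refutes ρ (refute bs φ κ)
refute-sound {bs = bs} {ρ} ps (s ⊑ t) {κ} h p Γ eq Γ≥0 =
  extend (insert (tighten bs (linearise (t ⊖ s))) Γ)
    (insert-sound (tighten-sound ps (linearise (t ⊖ s))
      (subst (0ℤ ℤ.≤_) (sym (eval-linearise (t ⊖ s) ρ)) (ℤP.i≤j⇒0≤j-i p))) Γ Γ≥0) eq
  where
  extend : ∀ mΔ → MaybeAll.All (All (Nonneg ρ)) mΔ →
           maybe (λ Δ → unsat bs Δ ∨ κ Δ) (κ Γ) mΔ ≡ true → ⊥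
  extend nothing  _          eq = h p Γ eq Γ≥0
  extend (just Δ) (just Δ≥0) eq with ∨-true eq
  ... | inj₁ u = unsat-sound ps Δ u Δ≥0
  ... | inj₂ u = h p Δ u Δ≥0
refute-sound {bs = bs} {ρ} ps (parity b t) h p Γ eq = h p Γ (eqBool-then
  (parity-unique p (subst (HasParity _) (eval-linearise t ρ) (parity-oddLin (linearise t) ps))) eq)
refute-sound ps (φ ⊓ ψ) h (p , q) = refute-sound ps φ (λ _ → refute-sound ps ψ (λ _ → h (p , q)) q) p
refute-sound {bs = bs} {ρ} ps (φ ⊔ ψ) {κ} h p Γ eq Γ≥0 = branch (implied bs Γ (φ ⊔ ψ)) p eq
  where
  branch : ∀ b → ⟦ φ ⊔ ψ ⟧ ρ → (if b then κ Γ else (refute bs φ κ Γ ∧ refute bs ψ κ Γ)) ≡ true → ⊥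
  branch true  p        eq = h p Γ eq Γ≥0
  branch false (inj₁ p) eq = refute-sound ps φ (h ∘ inj₁) p Γ (proj₁ (∧-true eq)) Γ≥0
  branch false (inj₂ p) eq = refute-sound ps ψ (h ∘ inj₂) p Γ (proj₂ (∧-true eq)) Γ≥0

allBits : ∀ n → (Vec Bool n → Bool) → Bool
allBits zero    f = f []
allBits (suc n) f = allBits n (f ∘ (true ∷_)) ∧ allBits n (f ∘ (false ∷_))

allBits-sound : ∀ n f → allBits n f ≡ true → ∀ bs → f bs ≡ true
allBits-sound zero    f eq []           = eq
allBits-sound (suc n) f eq (true ∷ bs)  = allBits-sound n (f ∘ (true ∷_)) (proj₁ (∧-true eq)) bs
allBits-sound (suc n) f eq (false ∷ bs) = allBits-sound n (f ∘ (false ∷_)) (proj₂ (∧-true eq)) bs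

parities : ∀ (ρ : Vec ℤ n) → Σ (Vec Bool n) λ bs → Parities bs ρ
parities []      = [] , []
parities (v ∷ ρ) = let bs , ps = parities ρ in odd v ∷ bs , parity-odd v ∷ ps

split : List (Form n) → Form n
split []       = con 0ℤ ⊑ con 0ℤ
split (φ ∷ φs) = (φ ⊔ neg φ) ⊓ split φs

split-valid : ∀ (φs : List (Form n)) ρ → ⟦ split φs ⟧ ρ
split-valid []       ρ = ℤP.≤-refl
split-valid (φ ∷ φs) ρ with dec φ ρ
... | yes p = inj₁ p , split-valid φs ρ
... | no ¬p = inj₂ (neg-complete φ ρ ¬p) , split-valid φs ρ

-- Trying all parity vectors turns the parity atoms into Booleans and tells `tighten` the parity of
-- every linear form.
entailed : List (Form n) → Form n → Form n → Bool
entailed {n} φs φ ψ = allBits n λ bs → refute bs (split φs ⊓ φ ⊓ neg ψ) (λ _ → false) []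

-- The case distinctions φs only direct the search.
entails : ∀ (φs : List (Form n)) φ ψ → entailed φs φ ψ ≡ true → ∀ ρ → ⟦ φ ⟧ ρ → ⟦ ψ ⟧ ρ
entails {n} φs φ ψ eq ρ p with dec ψ ρ
... | yes q = q
... | no ¬q = let bs , ps = parities ρ in
  ⊥-elim (refute-sound ps (split φs ⊓ φ ⊓ neg ψ) (λ _ Γ ())
    (split-valid φs ρ , p , neg-complete ψ ρ ¬q) [] (allBits-sound n _ eq bs) [])

-- The coordinates of a tile, the holes and the parent of a tile

-- A tile is described by three coordinates (w , x , y) with sum 1 (up) or 0 (down). The neighbours
-- of an up tile decrease one of them by one, those of a down tile increase one of them by one.
data Dir : Set where
  W X Y : Dir

next : Dir → Dir
next W = X
next X = Y
next Y = W

-- A symbolic tile. The orientation stays concrete because the third coordinate and the neighbours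
-- depend on it; once it is fixed, everything is linear.
record TileTerm (n : ℕ) : Set where
  constructor ⟨_,_,_⟩
  field abscissa ordinate : Term n
        up : Bool

coordT : Dir → TileTerm n → Term n
coordT X ⟨ x , y , _ ⟩     = x
coordT Y ⟨ x , y , _ ⟩     = y
coordT W ⟨ x , y , true ⟩  = con 1ℤ ⊖ x ⊖ y
coordT W ⟨ x , y , false ⟩ = con 0ℤ ⊖ x ⊖ y

nbrT : Dir → TileTerm n → TileTerm n
nbrT W ⟨ x , y , true ⟩  = ⟨ x , y , false ⟩
nbrT X ⟨ x , y , true ⟩  = ⟨ x ⊖ con 1ℤ , y , false ⟩
nbrT Y ⟨ x , y , true ⟩  = ⟨ x , y ⊖ con 1ℤ , false ⟩
nbrT W ⟨ x , y , false ⟩ = ⟨ x , y , true ⟩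
nbrT X ⟨ x , y , false ⟩ = ⟨ x ⊕ con 1ℤ , y , true ⟩
nbrT Y ⟨ x , y , false ⟩ = ⟨ x , y ⊕ con 1ℤ , true ⟩

someDir everyDir : (Dir → Form n) → Form n
someDir  F = F W ⊔ F X ⊔ F Y
everyDir F = F W ⊓ F X ⊓ F Y

negative nonneg : Term n → Form n
negative t = t ⊑ con (ℤ.- 1ℤ)
nonneg   t = con 0ℤ ⊑ t

insideF : Term n → TileTerm n → Form n
insideF k T = everyDir λ d → con 1ℤ ⊖ k ⊑ coordT d T ⊓ coordT d T ⊑ k

-- On each of the concentric hexagons insideF d, every second boundary edge is the base of a hole
-- pointing outwards.
holeF : TileTerm n → Form n
holeF T@(⟨ _ , _ , true ⟩)  = someDir λ d → let p = coordT d T; q = coordT (next d) T in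
  negative p ⊓ negative q ⊓ parity false p
holeF T@(⟨ _ , _ , false ⟩) = someDir λ d → let p = coordT d T; q = coordT (next d) T; r = coordT (next (next d)) T in
  nonneg p ⊓ negative q ⊓ nonneg r ⊓ parity false p

-- The holes cut the ring between two consecutive hexagons into pieces. The parent of a tile leads
-- along its piece to the only edge where the piece touches the inner hexagon, and there inwards.
parentF : Dir → TileTerm n → Form n
parentF d T@(⟨ _ , _ , true ⟩)  = let p = coordT d T; q = coordT (next d) T; r = coordT (next (next d)) T in
    -- The coordinates (1, 0, 0) of a central tile lead to the root, and two negative coordinates
    -- lead straight inwards. In the last two disjuncts the parity selects the neighbour within the
    -- ring that is not a hole.
    con 1ℤ ⊑ p ⊓ nonneg q ⊓ nonneg r
  ⊔ negative q ⊓ negative r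
  ⊔ nonneg p ⊓ negative q ⊓ nonneg r ⊓ parity false p
  ⊔ nonneg p ⊓ nonneg q ⊓ negative r ⊓ parity true q
parentF d T@(⟨ _ , _ , false ⟩) = let p = coordT d T; q = coordT (next d) T; r = coordT (next (next d)) T in
    negative p ⊓ nonneg q ⊓ nonneg r
  ⊔ negative p ⊓ negative q ⊓ parity false p
  ⊔ negative p ⊓ negative r ⊓ parity true r

rootF : TileTerm n → Form n
rootF ⟨ _ , _ , true ⟩ = ff
rootF ⟨ x , y , false ⟩ = x ⊑ con 0ℤ ⊓ con 0ℤ ⊑ x ⊓ y ⊑ con 0ℤ ⊓ con 0ℤ ⊑ y

data Ite (n : ℕ) : Set where
  leaf : Term n → Ite n
  ite  : Form n → Ite n → Ite n → Ite n

valueI : Ite n → Vec ℤ n → ℤ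
valueI (leaf t) ρ = value t ρ
valueI (ite φ i j) ρ = if does (dec φ ρ) then valueI i ρ else valueI j ρ

infixr 2 _⇒_
_⇒_ : Form n → Form n → Form n
φ ⇒ ψ = neg φ ⊔ ψ

modus-ponens : ∀ (φ ψ : Form n) ρ → ⟦ φ ⇒ ψ ⟧ ρ → ⟦ φ ⟧ ρ → ⟦ ψ ⟧ ρ
modus-ponens φ ψ ρ (inj₁ ¬p) p = ⊥-elim (neg-sound φ ρ ¬p p)
modus-ponens φ ψ ρ (inj₂ q)  p = q

-- The rank is piecewise linear. Unfolding both sides turns a strict comparison into guarded linear
-- inequalities, which the checker accepts.
ltI : Ite n → Ite n → Form n
ltI (leaf s)      (leaf t)    = s ⊕ con 1ℤ ⊑ t
ltI (leaf s)      (ite φ i j) = (φ ⇒ ltI (leaf s) i) ⊓ (neg φ ⇒ ltI (leaf s) j)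
ltI (ite φ i j)   k           = (φ ⇒ ltI i k) ⊓ (neg φ ⇒ ltI j k)

ltI-sound : ∀ (i j : Ite n) ρ → ⟦ ltI i j ⟧ ρ → valueI i ρ ℤ.+ 1ℤ ℤ.≤ valueI j ρ
ltI-sound (leaf s) (leaf t) ρ p = p
ltI-sound (leaf s) (ite φ i j) ρ (p , q) with dec φ ρ
... | yes r = ltI-sound (leaf s) i ρ (modus-ponens φ _ ρ p r)
... | no ¬r = ltI-sound (leaf s) j ρ (modus-ponens (neg φ) _ ρ q (neg-complete φ ρ ¬r))
ltI-sound (ite φ i j) k ρ (p , q) with dec φ ρ
... | yes r = ltI-sound i k ρ (modus-ponens φ _ ρ p r)
... | no ¬r = ltI-sound j k ρ (modus-ponens (neg φ) _ ρ q (neg-complete φ ρ ¬r))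

entails-< : ∀ (φs : List (Form n)) φ i j → entailed φs φ (ltI i j) ≡ true →
            ∀ ρ → ⟦ φ ⟧ ρ → valueI i ρ ℤ.+ 1ℤ ℤ.≤ valueI j ρ
entails-< φs φ i j eq ρ p = ltI-sound i j ρ (entails φs φ (ltI i j) eq ρ p)

-- Three times the ℓ¹-norm of (w, x, y), corrected so that it decreases along parentF also
-- at the corners, where the parent has the larger norm.
rankI : TileTerm n → Ite n
rankI T@(⟨ _ , _ , true ⟩) = one W (one X (one Y (two W (two X (two Y (leaf (con (+ 3))))))))
  where
  one two : Dir → Ite _ → Ite _
  one d i = let p = coordT d T; q = coordT (next d) T; r = coordT (next (next d)) T; m = con (+ 3) ⊖ + 6 ⊛ q in
    ite (nonneg p ⊓ negative q ⊓ nonneg r)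
      -- At these corner tiles the parent has two negative coordinates and rank 6 - 6q, above the
      -- usual 3 - 6q. Adding 4 gives 7 - 6q, which is still below the rank 8 - 6q of a child in the
      -- next ring.
      (ite (p ⊑ con 0ℤ ⊔ r ⊑ con 0ℤ ⊓ parity true p) (leaf (m ⊕ con (+ 4))) (leaf m)) i
  two d i = let p = coordT d T; q = coordT (next d) T; r = coordT (next (next d)) T in
    ite (negative q ⊓ negative r) (leaf (+ 6 ⊛ p ⊖ con (+ 3))) i
rankI T@(⟨ _ , _ , false ⟩) = one W (one X (one Y (two W (two X (two Y (leaf (con 0ℤ)))))))
  where
  one two : Dir → Ite _ → Ite _
  one d i = let p = coordT d T; q = coordT (next d) T; r = coordT (next (next d)) T in
    ite (nonneg p ⊓ negative q ⊓ nonneg r) (leaf (con (+ 2) ⊖ + 6 ⊛ q)) i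
  two d i = let p = coordT d T; q = coordT (next d) T; r = coordT (next (next d)) T in
    ite (negative q ⊓ negative r) (leaf (+ 6 ⊛ p)) i

generic : Bool → TileTerm (suc (suc n))
generic b = ⟨ var 0F , var 1F , b ⟩

signs : TileTerm n → List (Form n)
signs T = nonneg (coordT W T) ∷ nonneg (coordT X T) ∷ nonneg (coordT Y T) ∷ []

coord : Dir → Tile → ℤ
coord d (x , y , b) = value (coordT d (generic b)) (x ∷ y ∷ [])

Inside : ℤ → Tile → Set
Inside k (x , y , b) = ⟦ insideF (var 2F) (generic b) ⟧ (x ∷ y ∷ k ∷ [])

Outside : ℤ → Tile → Set
Outside k (x , y , b) = ⟦ neg (insideF (var 2F) (generic b)) ⟧ (x ∷ y ∷ k ∷ [])

Hole NotHole : Tile → Set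
Hole    (x , y , b) = ⟦ holeF (generic b) ⟧ (x ∷ y ∷ [])
NotHole (x , y , b) = ⟦ neg (holeF (generic b)) ⟧ (x ∷ y ∷ [])

ParentDir : Dir → Tile → Set
ParentDir d (x , y , b) = ⟦ parentF d (generic b) ⟧ (x ∷ y ∷ [])

rank : Tile → ℤ
rank (x , y , b) = valueI (rankI (generic b)) (x ∷ y ∷ [])

inside? : ∀ k t → Dec (Inside k t)
inside? k (x , y , b) = dec (insideF (var 2F) (generic b)) (x ∷ y ∷ k ∷ [])

hole? : ∀ t → Dec (Hole t)
hole? (x , y , b) = dec (holeF (generic b)) (x ∷ y ∷ [])

¬inside⇒outside : ∀ {k} t → ¬ Inside k t → Outside k t
¬inside⇒outside {k} (x , y , b) = neg-complete (insideF (var 2F) (generic b)) (x ∷ y ∷ k ∷ [])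

¬hole⇒notHole : ∀ t → ¬ Hole t → NotHole t
¬hole⇒notHole (x , y , b) = neg-complete (holeF (generic b)) (x ∷ y ∷ [])

notHole⇒¬hole : ∀ t → NotHole t → ¬ Hole t
notHole⇒¬hole (x , y , b) = neg-sound (holeF (generic b)) (x ∷ y ∷ [])

-- Written so that the value of `nbrT d (generic b)` is this tile definitionally; checks on symbolic
-- tiles then apply to tiles without conversion.
nbr : Dir → Tile → Tile
nbr W (x , y , true)  = x , y , false
nbr X (x , y , true)  = x ℤ.- 1ℤ , y , false
nbr Y (x , y , true)  = x , y ℤ.- 1ℤ , false
nbr W (x , y , false) = x , y , true
nbr X (x , y , false) = x ℤ.+ 1ℤ , y , true
nbr Y (x , y , false) = x , y ℤ.+ 1ℤ , true

origin : Tile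
origin = 0ℤ , 0ℤ , false

-- The equation is proved by `refl`, which runs the checker for one direction and one orientation,
-- so a local claim takes six runs. The signs of the coordinates are split in advance since they
-- select the clauses of the forms.
entailsOn : ∀ {n} (Φ Ψ : Dir → TileTerm (2 ℕ.+ n) → Form (2 ℕ.+ n)) d b →
            entailed (signs (generic b)) (Φ d (generic b)) (Ψ d (generic b)) ≡ true → ∀ x y (ρ : Vec ℤ n) →
            ⟦ Φ d (generic b) ⟧ (x ∷ y ∷ ρ) → ⟦ Ψ d (generic b) ⟧ (x ∷ y ∷ ρ)
entailsOn Φ Ψ d b eq x y ρ = entails (signs (generic b)) (Φ d (generic b)) (Ψ d (generic b)) eq (x ∷ y ∷ ρ)

entailsOn-< : ∀ {n} (Φ : Dir → TileTerm (2 ℕ.+ n) → Form (2 ℕ.+ n)) (i j : Dir → TileTerm (2 ℕ.+ n) → Ite (2 ℕ.+ n)) d b →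
              entailed (signs (generic b)) (Φ d (generic b)) (ltI (i d (generic b)) (j d (generic b))) ≡ true →
              ∀ x y (ρ : Vec ℤ n) → ⟦ Φ d (generic b) ⟧ (x ∷ y ∷ ρ) →
              valueI (i d (generic b)) (x ∷ y ∷ ρ) ℤ.+ 1ℤ ℤ.≤ valueI (j d (generic b)) (x ∷ y ∷ ρ)
entailsOn-< Φ i j d b eq x y ρ =
  entails-< (signs (generic b)) (Φ d (generic b)) (i d (generic b)) (j d (generic b)) eq (x ∷ y ∷ ρ)

hole-nbr-inside : ∀ {k} d t → Inside k t × Hole t → Inside k (nbr d t)
hole-nbr-inside {k} = λ where
    W (x , y , true)  → lia W true refl x y (k ∷ [])
    W (x , y , false) → lia W false refl x y (k ∷ [])
    X (x , y , true)  → lia X true refl x y (k ∷ [])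
    X (x , y , false) → lia X false refl x y (k ∷ [])
    Y (x , y , true)  → lia Y true refl x y (k ∷ [])
    Y (x , y , false) → lia Y false refl x y (k ∷ [])
  where lia = entailsOn {1} (λ _ T → insideF (var 2F) T ⊓ holeF T) (λ d T → insideF (var 2F) (nbrT d T))

-- With `hole-nbr-inside` this surrounds every hole by three tiles of the spiral, whence area 1.
hole-nbr-notHole : ∀ d t → Hole t → NotHole (nbr d t)
hole-nbr-notHole = λ where
    W (x , y , true)  → lia W true refl x y []
    W (x , y , false) → lia W false refl x y []
    X (x , y , true)  → lia X true refl x y []
    X (x , y , false) → lia X false refl x y []
    Y (x , y , true)  → lia Y true refl x y []
    Y (x , y , false) → lia Y false refl x y []
  where lia = entailsOn {0} (λ _ T → holeF T) (λ d T → neg (holeF (nbrT d T)))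

parent-inside : ∀ {k} d t → ParentDir d t × Inside k t → Inside k (nbr d t)
parent-inside {k} = λ where
    W (x , y , true)  → lia W true refl x y (k ∷ [])
    W (x , y , false) → lia W false refl x y (k ∷ [])
    X (x , y , true)  → lia X true refl x y (k ∷ [])
    X (x , y , false) → lia X false refl x y (k ∷ [])
    Y (x , y , true)  → lia Y true refl x y (k ∷ [])
    Y (x , y , false) → lia Y false refl x y (k ∷ [])
  where lia = entailsOn {1} (λ d T → parentF d T ⊓ insideF (var 2F) T) (λ d T → insideF (var 2F) (nbrT d T))

parent-notHole : ∀ d t → ParentDir d t × NotHole t → NotHole (nbr d t)
parent-notHole = λ where
    W (x , y , true)  → lia W true refl x y []
    W (x , y , false) → lia W false refl x y []
    X (x , y , true)  → lia X true refl x y []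
    X (x , y , false) → lia X false refl x y []
    Y (x , y , true)  → lia Y true refl x y []
    Y (x , y , false) → lia Y false refl x y []
  where lia = entailsOn {0} (λ d T → parentF d T ⊓ neg (holeF T)) (λ d T → neg (holeF (nbrT d T)))

parent-rank : ∀ d t → ParentDir d t × NotHole t → rank (nbr d t) ℤ.+ 1ℤ ℤ.≤ rank t
parent-rank = λ where
    W (x , y , true)  → lia W true refl x y []
    W (x , y , false) → lia W false refl x y []
    X (x , y , true)  → lia X true refl x y []
    X (x , y , false) → lia X false refl x y []
    Y (x , y , true)  → lia Y true refl x y []
    Y (x , y , false) → lia Y false refl x y []
  where lia = entailsOn-< {0} (λ d T → parentF d T ⊓ neg (holeF T)) (λ d T → rankI (nbrT d T)) (λ _ → rankI)

-- Connectedness needs only that parents exist. Acyclicity rests on this converse: the dual graph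
-- has no edges besides those of the parent map.
oriented-dir : ∀ d t → NotHole t × NotHole (nbr d t) → ParentDir d t ⊎ ParentDir d (nbr d t)
oriented-dir = λ where
    W (x , y , true)  → lia W true refl x y []
    W (x , y , false) → lia W false refl x y []
    X (x , y , true)  → lia X true refl x y []
    X (x , y , false) → lia X false refl x y []
    Y (x , y , true)  → lia Y true refl x y []
    Y (x , y , false) → lia Y false refl x y []
  where lia = entailsOn {0} (λ d T → neg (holeF T) ⊓ neg (holeF (nbrT d T))) (λ d T → parentF d T ⊔ parentF d (nbrT d T))

-- Any two distinct directions are `d` and `next d` in one of the two orders, so all pairs are
-- covered.
parent-unique-next : ∀ d t → ParentDir d t × ParentDir (next d) t → ⊥
parent-unique-next = λ where
    W (x , y , true)  → lia W true refl x y []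
    W (x , y , false) → lia W false refl x y []
    X (x , y , true)  → lia X true refl x y []
    X (x , y , false) → lia X false refl x y []
    Y (x , y , true)  → lia Y true refl x y []
    Y (x , y , false) → lia Y false refl x y []
  where lia = entailsOn {0} (λ d T → parentF d T ⊓ parentF (next d) T) (λ _ _ → ff)

someDir-Σ : ∀ {P : Dir → Set} → P W ⊎ P X ⊎ P Y → Σ Dir P
someDir-Σ (inj₁ p)        = W , p
someDir-Σ (inj₂ (inj₁ p)) = X , p
someDir-Σ (inj₂ (inj₂ p)) = Y , p

parent-exists : ∀ t → NotHole t → t ≡ origin ⊎ Σ Dir λ d → ParentDir d t
parent-exists (x , y , true) p = inj₂ (someDir-Σ
  (entails (signs (generic true)) (neg (holeF (generic true))) (someDir λ d → parentF d (generic true)) refl (x ∷ y ∷ []) p))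
parent-exists (x , y , false) p
  with entails (signs (generic false)) (neg (holeF (generic false)))
         (rootF (generic false) ⊔ someDir λ d → parentF d (generic false)) refl (x ∷ y ∷ []) p
... | inj₁ (x≤0 , 0≤x , y≤0 , 0≤y) = inj₁ (cong₂ (λ x y → x , y , false) (ℤP.≤-antisym x≤0 0≤x) (ℤP.≤-antisym y≤0 0≤y))
... | inj₂ q                       = inj₂ (someDir-Σ q)

rank-nonneg : ∀ t → 0ℤ ℤ.≤ rank t
rank-nonneg (x , y , true)  = entails-< [] (con 0ℤ ⊑ con 0ℤ)
  (leaf (con (ℤ.- 1ℤ))) (rankI (generic true)) refl (x ∷ y ∷ []) ℤP.≤-refl
rank-nonneg (x , y , false) = entails-< [] (con 0ℤ ⊑ con 0ℤ)
  (leaf (con (ℤ.- 1ℤ))) (rankI (generic false)) refl (x ∷ y ∷ []) ℤP.≤-refl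

-- Adjacency, paths and the absence of cycles

adj⇒nbr : ∀ t {u} → Adj t u → Σ Dir λ d → u ≡ nbr d t
adj⇒nbr (x , y , true)  (here eq)                 = W , eq
adj⇒nbr (x , y , true)  (there (here eq))         = X , eq
adj⇒nbr (x , y , true)  (there (there (here eq))) = Y , eq
adj⇒nbr (x , y , false) (here eq)                 = W , eq
adj⇒nbr (x , y , false) (there (here eq))         = X , eq
adj⇒nbr (x , y , false) (there (there (here eq))) = Y , eq

nbr-adj : ∀ d t → Adj t (nbr d t)
nbr-adj W (x , y , true)  = here refl
nbr-adj X (x , y , true)  = there (here refl)
nbr-adj Y (x , y , true)  = there (there (here refl))
nbr-adj W (x , y , false) = here refl
nbr-adj X (x , y , false) = there (here refl)
nbr-adj Y (x , y , false) = there (there (here refl))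

adj-elim : ∀ {P : Tile → Set} {t u} → (∀ d → P (nbr d t)) → Adj t u → P u
adj-elim {P} {t} p a = let d , u≡ = adj⇒nbr t a in subst P (sym u≡) (p d)

x-1+1 : ∀ x → x ℤ.- 1ℤ ℤ.+ 1ℤ ≡ x
x-1+1 x = trans (ℤP.+-assoc x _ _) (ℤP.+-identityʳ x)

x+1-1 : ∀ x → x ℤ.+ 1ℤ ℤ.- 1ℤ ≡ x
x+1-1 x = trans (ℤP.+-assoc x _ _) (ℤP.+-identityʳ x)

nbr-involutive : ∀ d t → nbr d (nbr d t) ≡ t
nbr-involutive W (x , y , true)  = refl
nbr-involutive X (x , y , true)  = cong (_, y , true) (x-1+1 x)
nbr-involutive Y (x , y , true)  = cong (λ y → x , y , true) (x-1+1 y)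
nbr-involutive W (x , y , false) = refl
nbr-involutive X (x , y , false) = cong (_, y , false) (x+1-1 x)
nbr-involutive Y (x , y , false) = cong (λ y → x , y , false) (x+1-1 y)

adj-sym : ∀ t {u} → Adj t u → Adj u t
adj-sym t a with d , refl ← adj⇒nbr t a = subst (Adj (nbr d t)) (nbr-involutive d t) (nbr-adj d (nbr d t))

module _ {P : Tile → Set} where

  path-++ : ∀ {a b c} → Path P a b → Path P b c → Path P a c
  path-++ (here _)     q = q
  path-++ (step p a r) q = step p a (path-++ r q)

  path-start : ∀ {a b} → Path P a b → P a
  path-start (here p)     = p
  path-start (step p _ _) = p

  path-end : ∀ {a b} → Path P a b → P b
  path-end (here p)     = p
  path-end (step _ _ r) = path-end r

  path-reverse : ∀ {a b} → Path P a b → Path P b a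
  path-reverse (here p)     = here p
  path-reverse (step {a} p e r) = path-++ (path-reverse r) (step (path-start r) (adj-sym a e) (here p))

path-map : ∀ {P Q : Tile → Set} → (∀ {t} → P t → Q t) → ∀ {a b} → Path P a b → Path Q a b
path-map f (here p)     = here (f p)
path-map f (step p e r) = step (f p) e (path-map f r)

end : Tile → List Tile → Tile
end t []       = t
end t (u ∷ us) = end u us

last-end : ∀ t us → last (t ∷ us) ≡ just (end t us)
last-end t []       = refl
last-end t (u ∷ us) = last-end u us

end-∈ : ∀ t us → end t us ∈ t ∷ us
end-∈ t []       = here refl
end-∈ t (u ∷ us) = there (end-∈ u us)

unique-head : ∀ {t : Tile} {us} → Unique (t ∷ us) → t ∉ us
unique-head (t≢ ∷ _) t∈us = All.lookup t≢ t∈us refl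

-- In a graph in which every edge joins a vertex to its parent, a path that once descends to a
-- child descends ever after; so no path can close up to a cycle.
module Forest
  (P : Tile → Set) (Parent : Tile → Tile → Set) (rk : Tile → ℤ)
  (functional : ∀ {t u v} → Parent t u → Parent t v → u ≡ v)
  (decreasing : ∀ {t u} → P t → Parent t u → rk u ℤ.< rk t)
  (oriented   : ∀ {t u} → P t → P u → Adj t u → Parent t u ⊎ Parent u t)
  where

  -- The path cannot turn back up at `u`, whose only parent `t` has already been visited. The second
  -- component locates the parent of the last tile on the path, which is what conflicts with a
  -- closing edge.
  descend : ∀ t u us → All P (t ∷ u ∷ us) → Linked Adj (t ∷ u ∷ us) → Unique (t ∷ u ∷ us) → Parent u t →
            rk t ℤ.< rk (end u us) × Σ Tile λ v → Parent (end u us) v × ((us ≡ [] × v ≡ t) ⊎ v ∈ u ∷ us)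
  descend t u [] (_ ∷ Pu ∷ _) _ _ ut = decreasing Pu ut , t , ut , inj₁ (refl , refl)
  descend t u (v ∷ vs) (_ ∷ Pu ∷ Pv ∷ Pvs) (_ ∷ uv ∷ l) (t≢ ∷ un) ut with oriented Pu Pv uv
  ... | inj₁ p = ⊥-elim (All.lookup t≢ (there (here refl)) (functional ut p))
  ... | inj₂ p with descend u v vs (Pu ∷ Pv ∷ Pvs) (uv ∷ l) un p
  ...   | lt , z , q , inj₁ (_ , z≡u) = ℤP.<-trans (decreasing Pu ut) lt , z , q , inj₂ (here z≡u)
  ...   | lt , z , q , inj₂ z∈        = ℤP.<-trans (decreasing Pu ut) lt , z , q , inj₂ (there z∈)

  -- A path that descends anywhere ends at a child of one of its own tiles, by `descend`. If the
  -- parent of the last tile is off the path, every step therefore goes up.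
  ascend : ∀ t us → All P (t ∷ us) → Linked Adj (t ∷ us) → Unique (t ∷ us) →
           (∀ v → Parent (end t us) v → v ∉ t ∷ us) → rk (end t us) ℤ.≤ rk t
  ascend t [] _ _ _ _ = ℤP.≤-refl
  ascend t (u ∷ us) (Pt ∷ Pu ∷ Pus) (tu ∷ l) (t≢ ∷ un) v∉ with oriented Pt Pu tu
  ... | inj₁ p = ℤP.≤-trans (ascend u us (Pu ∷ Pus) l un λ v q v∈ → v∉ v q (there v∈)) (ℤP.<⇒≤ (decreasing Pt p))
  ... | inj₂ p with descend t u us (Pt ∷ Pu ∷ Pus) (tu ∷ l) (t≢ ∷ un) p
  ...   | _ , z , q , inj₁ (_ , z≡t) = ⊥-elim (v∉ z q (here z≡t))
  ...   | _ , z , q , inj₂ z∈        = ⊥-elim (v∉ z q (there z∈))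

  -- The two edges of the cycle at `t` can be oriented in four ways. If both lead to a parent of
  -- `t`, its two neighbours coincide; if both lead to a child, `descend` places the parent `t` of
  -- the last tile elsewhere on the path. In the mixed cases the ranks around the cycle contradict
  -- each other.
  acyclic : ∀ t u v vs → All P (t ∷ u ∷ v ∷ vs) → Linked Adj (t ∷ u ∷ v ∷ vs) → Unique (t ∷ u ∷ v ∷ vs) →
            ¬ Adj (end v vs) t
  acyclic t u v vs (Pt ∷ Pu ∷ Pvs) (tu ∷ l) (t≢ ∷ un) closing
    with oriented Pt Pu tu | oriented (All.lookup Pvs (end-∈ v vs)) Pt closing
  ... | inj₁ t→u | inj₂ t→e = unique-head un (subst (_∈ v ∷ vs) (functional t→e t→u) (end-∈ v vs))
  ... | inj₂ u→t | inj₂ t→e =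
    ℤP.<-asym (proj₁ (descend t u (v ∷ vs) (Pt ∷ Pu ∷ Pvs) (tu ∷ l) (t≢ ∷ un) u→t)) (decreasing Pt t→e)
  ... | inj₁ t→u | inj₁ e→t = ℤP.<-irrefl refl
    (ℤP.<-≤-trans (ℤP.<-trans (decreasing Pt t→u) (decreasing (All.lookup Pvs (end-∈ v vs)) e→t))
      (ascend u (v ∷ vs) (Pu ∷ Pvs) l un λ w e→w w∈ →
        unique-head (t≢ ∷ un) (subst (_∈ _) (functional e→w e→t) w∈)))
  ... | inj₂ u→t | inj₁ e→t with descend t u (v ∷ vs) (Pt ∷ Pu ∷ Pvs) (tu ∷ l) (t≢ ∷ un) u→t
  ...   | _ , w , e→w , inj₂ w∈ = unique-head (t≢ ∷ un) (subst (_∈ _) (functional e→w e→t) w∈)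

  no-cycle : ∀ {A} → (∀ {t} → t ∈ tiles A → P t) → DualTree A
  no-cycle A⊆P ([] , () , _)
  no-cycle A⊆P (_ ∷ [] , s≤s () , _)
  no-cycle A⊆P (_ ∷ _ ∷ [] , s≤s (s≤s ()) , _)
  no-cycle A⊆P (t ∷ u ∷ v ∷ vs , _ , un , inA , l , f , e , eqf , eqe , closing) =
    acyclic t u v vs (All.map A⊆P inA) l un
      (subst₂ Adj (just-injective (trans (sym eqe) (last-end v vs))) (sym (just-injective eqf)) closing)

Cell : ℤ → Tile → Set
Cell k t = Inside k t × NotHole t

ParentOf : Tile → Tile → Set
ParentOf t u = Σ Dir λ d → ParentDir d t × u ≡ nbr d t

parent-functional : ∀ {t u v} → ParentOf t u → ParentOf t v → u ≡ v
parent-functional {t} (d , p , refl) (e , q , refl) = cong (λ d → nbr d t) (same d e p q)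
  where
  same : ∀ d e → ParentDir d t → ParentDir e t → d ≡ e
  same W W p q = refl
  same X X p q = refl
  same Y Y p q = refl
  same W X p q = ⊥-elim (parent-unique-next W t (p , q))
  same X Y p q = ⊥-elim (parent-unique-next X t (p , q))
  same Y W p q = ⊥-elim (parent-unique-next Y t (p , q))
  same X W p q = ⊥-elim (parent-unique-next W t (q , p))
  same Y X p q = ⊥-elim (parent-unique-next X t (q , p))
  same W Y p q = ⊥-elim (parent-unique-next Y t (q , p))

parent-decreasing : ∀ {k t u} → Cell k t → ParentOf t u → rank u ℤ.< rank t
parent-decreasing {t = t} (_ , nh) (d , p , refl) =
  ℤP.suc[i]≤j⇒i<j (subst (ℤ._≤ rank t) (ℤP.+-comm (rank (nbr d t)) 1ℤ) (parent-rank d t (p , nh)))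

parent-oriented : ∀ {k t u} → Cell k t → Cell k u → Adj t u → ParentOf t u ⊎ ParentOf u t
parent-oriented {t = t} (_ , nht) (_ , nhu) a with adj⇒nbr t a
... | d , refl with oriented-dir d t (nht , nhu)
...   | inj₁ p = inj₁ (d , p , refl)
...   | inj₂ p = inj₂ (d , p , sym (nbr-involutive d t))

-- The bound `n` is fuel for the recursion: ranks are nonnegative and drop at every parent.
path-to-origin : ∀ {k} n t → Cell k t → rank t ℤ.≤ + n → Path (Cell k) t origin
path-to-origin n t c r≤n with parent-exists t (proj₂ c)
... | inj₁ refl = here c
path-to-origin {k} n t c@(i , nh) r≤n | inj₂ (d , p) = step c (nbr-adj d t) (go n r≤n)
  where
  c′ : Cell k (nbr d t)
  c′ = parent-inside d t (p , i) , parent-notHole d t (p , nh)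
  go : ∀ n → rank t ℤ.≤ + n → Path (Cell k) (nbr d t) origin
  go zero    r≤ = ⊥-elim (ℤP.<-irrefl refl (ℤP.≤-<-trans (rank-nonneg (nbr d t))
                    (ℤP.<-≤-trans (parent-decreasing {k} c (d , p , refl)) r≤)))
  go (suc n) r≤ = path-to-origin n (nbr d t) c′
                    (ℤP.i<j⇒i≤pred[j] (ℤP.<-≤-trans (parent-decreasing {k} c (d , p , refl)) r≤))

-- The tiles of the hexagon

length-mono-⊆ : ∀ {xs ys : List A} → Unique xs → (∀ {x} → x ∈ xs → x ∈ ys) → length xs ℕ.≤ length ys
length-mono-⊆ [] _ = z≤n
length-mono-⊆ {xs = x ∷ xs} (x≢ ∷ u) xs⊆ys with ∈-∃++ (xs⊆ys (here refl))
... | as , bs , refl = subst (suc (length xs) ℕ.≤_)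
  (sym (trans (length-++ as) (trans (ℕP.+-suc _ _) (cong suc (sym (length-++ as))))))
  (s≤s (length-mono-⊆ u xs⊆))
  where
  xs⊆ : ∀ {y} → y ∈ xs → y ∈ as ++ bs
  xs⊆ y∈ with ∈-++⁻ as (xs⊆ys (there y∈))
  ... | inj₁ y∈as         = ∈-++⁺ˡ y∈as
  ... | inj₂ (here refl)  = ⊥-elim (All.lookup x≢ y∈ refl)
  ... | inj₂ (there y∈bs) = ∈-++⁺ʳ as y∈bs

length-cartesianProduct : ∀ (xs : List A) (ys : List B) → length (cartesianProduct xs ys) ≡ length xs ℕ.* length ys
length-cartesianProduct []       ys = refl
length-cartesianProduct (x ∷ xs) ys =
  trans (length-++ (map (x ,_) ys)) (cong₂ ℕ._+_ (length-map (x ,_) ys) (length-cartesianProduct xs ys))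

module _ {P : A → Set} (P? : Decidable P) where

  length-filter-¬ : ∀ xs → length (filter P? xs) ℕ.+ length (filter (¬? ∘ P?) xs) ≡ length xs
  length-filter-¬ [] = refl
  length-filter-¬ (x ∷ xs) with does (P? x)
  ... | true  = cong suc (length-filter-¬ xs)
  ... | false = trans (ℕP.+-suc _ _) (cong suc (length-filter-¬ xs))

-- The inverse of taking the coordinates `d` and `next d`; the sum determines the third one. It
-- allows one formula for all three rotated copies.
atT : Dir → Term n → Term n → Bool → TileTerm n
atT X p q b = ⟨ p , q , b ⟩
atT Y p q b = ⟨ con (bit b) ⊖ p ⊖ q , p , b ⟩
atT W p q b = ⟨ q , con (bit b) ⊖ p ⊖ q , b ⟩

at : Dir → ℤ → ℤ → Bool → Tile
at X p q b = p , q , b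
at Y p q b = bit b ℤ.- p ℤ.- q , p , b
at W p q b = q , bit b ℤ.- p ℤ.- q , b

isUp : Tile → Bool
isUp (_ , _ , b) = b

third-coordinate : ∀ s p q → s ℤ.- q ℤ.- (s ℤ.- p ℤ.- q) ≡ p
third-coordinate = solve-∀

third-coordinate′ : ∀ s p q → s ℤ.- (s ℤ.- p ℤ.- q) ℤ.- p ≡ q
third-coordinate′ = solve-∀

coord-at : ∀ d p q b → coord d (at d p q b) ≡ p
coord-at X p q b = refl
coord-at Y p q b = refl
coord-at W p q true  = third-coordinate 1ℤ p q
coord-at W p q false = third-coordinate 0ℤ p q

coord-next-at : ∀ d p q b → coord (next d) (at d p q b) ≡ q
coord-next-at W p q b = refl
coord-next-at X p q b = refl
coord-next-at Y p q true  = third-coordinate′ 1ℤ p q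
coord-next-at Y p q false = third-coordinate′ 0ℤ p q

isUp-at : ∀ d p q b → isUp (at d p q b) ≡ b
isUp-at W p q b = refl
isUp-at X p q b = refl
isUp-at Y p q b = refl

at-coord : ∀ d t → at d (coord d t) (coord (next d) t) (isUp t) ≡ t
at-coord X (x , y , b) = refl
at-coord Y (x , y , true)  = cong (_, y , true) (third-coordinate 1ℤ x y)
at-coord Y (x , y , false) = cong (_, y , false) (third-coordinate 0ℤ x y)
at-coord W (x , y , true)  = cong (λ y → x , y , true) (third-coordinate′ 1ℤ x y)
at-coord W (x , y , false) = cong (λ y → x , y , false) (third-coordinate′ 0ℤ x y)

-- The hexagon without its four central tiles is the union of three parallelograms, which
-- the rotation of order three permutes.
Third : Dir → Tile → Set
Third d t = coord d t ℤ.≤ -1ℤ × 0ℤ ℤ.≤ coord (next d) t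

thirdT : Dir → TileTerm n → Form n
thirdT d T = negative (coordT d T) ⊓ nonneg (coordT (next d) T)

¬neg∧nonneg : ∀ {z} → z ℤ.≤ -1ℤ → ¬ 0ℤ ℤ.≤ z
¬neg∧nonneg p q = case ℤP.≤-trans q p of λ ()

third-unique : ∀ {d e} t → Third d t → Third e t → d ≡ e
third-unique {W} {W} t p q = refl
third-unique {X} {X} t p q = refl
third-unique {Y} {Y} t p q = refl
third-unique {W} {X} t p q = ⊥-elim (¬neg∧nonneg (proj₁ q) (proj₂ p))
third-unique {X} {Y} t p q = ⊥-elim (¬neg∧nonneg (proj₁ q) (proj₂ p))
third-unique {Y} {W} t p q = ⊥-elim (¬neg∧nonneg (proj₁ q) (proj₂ p))
third-unique {X} {W} t p q = ⊥-elim (¬neg∧nonneg (proj₁ p) (proj₂ q))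
third-unique {Y} {X} t p q = ⊥-elim (¬neg∧nonneg (proj₁ p) (proj₂ q))
third-unique {W} {Y} t p q = ⊥-elim (¬neg∧nonneg (proj₁ p) (proj₂ q))

-- A finite index set for the three parallelograms. With k = m + 1, the coordinate `d` takes the m
-- values -1, ..., -m and `next d` the m + 2 values 0, ..., m + 1, in both orientations.
Code : Set
Code = Dir × Bool × ℕ × ℕ

toTile : Code → Tile
toTile (d , b , j , i) = at d (-1ℤ ℤ.- + j) (+ i) b

toTile-third : ∀ d b j i → Third d (toTile (d , b , j , i))
toTile-third d b j i rewrite coord-at d (-1ℤ ℤ.- + j) (+ i) b | coord-next-at d (-1ℤ ℤ.- + j) (+ i) b =
  ℤP.i-j≤i -1ℤ (+ j) , ℤ.+≤+ z≤n

toTile-injective : ∀ {c c′} → toTile c ≡ toTile c′ → c ≡ c′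
toTile-injective {d , b , j , i} {d′ , b′ , j′ , i′} eq
  with third-unique {d} {d′} (toTile (d , b , j , i)) (toTile-third d b j i)
         (subst (Third d′) (sym eq) (toTile-third d′ b′ j′ i′))
... | refl = cong (d ,_) (cong₂ _,_ beq (cong₂ _,_ jeq ieq))
  where
  transfer : ∀ {C : Set} (f : Tile → C) {x y} → f (toTile (d , b , j , i)) ≡ x → f (toTile (d , b′ , j′ , i′)) ≡ y → x ≡ y
  transfer f p q = trans (sym p) (trans (cong f eq) q)
  beq : b ≡ b′
  beq = transfer isUp (isUp-at d _ _ b) (isUp-at d _ _ b′)
  jeq : j ≡ j′
  jeq = ℤP.+-injective (trans (sym (reflect (+ j))) (trans (cong (ℤ._-_ -1ℤ)
          (transfer (coord d) (coord-at d _ _ b) (coord-at d _ _ b′))) (reflect (+ j′))))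
    where
    reflect : ∀ z → -1ℤ ℤ.- (-1ℤ ℤ.- z) ≡ z
    reflect = solve-∀
  ieq : i ≡ i′
  ieq = ℤP.+-injective (transfer (coord (next d)) (coord-next-at d _ _ b) (coord-next-at d _ _ b′))

dirs : List Dir
dirs = W ∷ X ∷ Y ∷ []

bools : List Bool
bools = true ∷ false ∷ []

codes : ℕ → List Code
codes m = cartesianProduct dirs (cartesianProduct bools (cartesianProduct (upTo m) (upTo (2 ℕ.+ m))))

centre : List Tile
centre = origin ∷ (0ℤ , 0ℤ , true) ∷ (1ℤ , 0ℤ , true) ∷ (0ℤ , 1ℤ , true) ∷ []

-- The argument is k - 1, which makes the side counts k - 1 and k + 1 the subtraction-free `m` and
-- `2 + m`.
hexagon : ℕ → List Tile
hexagon m = centre ++ map toTile (codes m)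

∈-dirs : ∀ d → d ∈ dirs
∈-dirs W = here refl
∈-dirs X = there (here refl)
∈-dirs Y = there (there (here refl))

∈-bools : ∀ b → b ∈ bools
∈-bools true  = here refl
∈-bools false = there (here refl)

unique-dirs : Unique dirs
unique-dirs = ((λ ()) ∷ (λ ()) ∷ []) ∷ ((λ ()) ∷ []) ∷ [] ∷ []

unique-bools : Unique bools
unique-bools = ((λ ()) ∷ []) ∷ [] ∷ []

∈-codes : ∀ {m} d b {j i} → j ℕ.< m → i ℕ.< 2 ℕ.+ m → (d , b , j , i) ∈ codes m
∈-codes d b j<m i<m = ∈-cartesianProduct⁺ (∈-dirs d) (∈-cartesianProduct⁺ (∈-bools b)
  (∈-cartesianProduct⁺ (∈-upTo⁺ j<m) (∈-upTo⁺ i<m)))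

∈-codes⁻ : ∀ {m d b j i} → (d , b , j , i) ∈ codes m → j ℕ.< m × i ℕ.< 2 ℕ.+ m
∈-codes⁻ {m} c∈ =
  let _ , c∈  = ∈-cartesianProduct⁻ dirs (cartesianProduct bools (cartesianProduct (upTo m) (upTo (2 ℕ.+ m)))) c∈
      _ , c∈  = ∈-cartesianProduct⁻ bools (cartesianProduct (upTo m) (upTo (2 ℕ.+ m))) c∈
      j∈ , i∈ = ∈-cartesianProduct⁻ (upTo m) (upTo (2 ℕ.+ m)) c∈
  in ∈-upTo⁻ j∈ , ∈-upTo⁻ i∈

length-hexagon : ∀ m → length (hexagon m) ≡ 4 ℕ.+ 3 ℕ.* (2 ℕ.* (m ℕ.* (2 ℕ.+ m)))
length-hexagon m = cong (4 ℕ.+_) (trans (length-map toTile (codes m))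
  (trans (length-cartesianProduct dirs (cartesianProduct bools (cartesianProduct (upTo m) (upTo (2 ℕ.+ m)))))
    (cong (3 ℕ.*_) (trans (length-cartesianProduct bools (cartesianProduct (upTo m) (upTo (2 ℕ.+ m))))
      (cong (2 ℕ.*_) (trans (length-cartesianProduct (upTo m) (upTo (2 ℕ.+ m)))
        (cong₂ ℕ._*_ (length-upTo m) (length-upTo (2 ℕ.+ m)))))))))

centre-nonneg : ∀ {t} → t ∈ centre → ∀ d → 0ℤ ℤ.≤ coord d t
centre-nonneg {t} t∈ d = All.lookup (All.lookup
  (from-yes (All.all? (λ t → All.all? (λ d → 0ℤ ℤ.≤? coord d t) dirs) centre)) t∈) (∈-dirs d)

unique-hexagon : ∀ m → Unique (hexagon m)
unique-hexagon m = Uniq.++⁺ unique-centre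
  (Uniq.map⁺ toTile-injective (Uniq.cartesianProduct⁺ unique-dirs (Uniq.cartesianProduct⁺ unique-bools
    (Uniq.cartesianProduct⁺ (Uniq.upTo⁺ m) (Uniq.upTo⁺ (2 ℕ.+ m))))))
  λ (t∈centre , t∈map) → case ∈-map⁻ toTile t∈map of λ where
    ((d , b , j , i) , _ , refl) → ¬neg∧nonneg (proj₁ (toTile-third d b j i)) (centre-nonneg t∈centre d)
  where
  unique-centre : Unique centre
  unique-centre = ((λ ()) ∷ (λ ()) ∷ (λ ()) ∷ []) ∷ ((λ ()) ∷ (λ ()) ∷ []) ∷ ((λ ()) ∷ []) ∷ [] ∷ []

inside-coord : ∀ {k} t → Inside k t → ∀ d → 1ℤ ℤ.- k ℤ.≤ coord d t × coord d t ℤ.≤ k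
inside-coord (x , y , true)  (w , _ , _) W = w
inside-coord (x , y , true)  (_ , x∈ , _) X = x∈
inside-coord (x , y , true)  (_ , _ , y∈) Y = y∈
inside-coord (x , y , false) (w , _ , _) W = w
inside-coord (x , y , false) (_ , x∈ , _) X = x∈
inside-coord (x , y , false) (_ , _ , y∈) Y = y∈

Position : ℤ → ℤ → ℤ → Set
Position k p q = p ℤ.≤ -1ℤ × 1ℤ ℤ.- k ℤ.≤ p × 0ℤ ℤ.≤ q × q ℤ.≤ k

-- The third coordinate b - p - q needs no bound of its own: -p lies in [1, k - 1] and q in [0, k],
-- which forces it into [1 - k, k]. So each third is a full parallelogram.
at-inside : ∀ {k} d b {p q} → Position k p q → Inside k (at d p q b)
at-inside {k} d b {p} {q} = go d b
  where
  position : Form 3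
  position = negative (var 0F) ⊓ con 1ℤ ⊖ var 2F ⊑ var 0F ⊓ nonneg (var 1F) ⊓ var 1F ⊑ var 2F
  ρ : Vec ℤ 3
  ρ = p ∷ q ∷ k ∷ []
  goal : Dir → Bool → Form 3
  goal d b = insideF (var 2F) (atT d (var 0F) (var 1F) b)
  go : ∀ d b → Position k p q → Inside k (at d p q b)
  go W true  = entails [] position (goal W true) refl ρ
  go X true  = entails [] position (goal X true) refl ρ
  go Y true  = entails [] position (goal Y true) refl ρ
  go W false = entails [] position (goal W false) refl ρ
  go X false = entails [] position (goal X false) refl ρ
  go Y false = entails [] position (goal Y false) refl ρ

_≈T_ : Term n → Term n → Form n
s ≈T t = s ⊑ t ⊓ t ⊑ s

-- The sum 0 or 1 excludes three negative coordinates. If the signs are mixed, somewhere in the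
-- cyclic order a negative coordinate is followed by a nonnegative one; if none is negative, the
-- tile is central.
centre-or-third : ∀ t → t ∈ centre ⊎ Σ Dir λ d → Third d t
centre-or-third (x , y , true)
  with entails (signs (generic true)) (con 0ℤ ⊑ con 0ℤ)
         ((x′ ≈T con 0ℤ ⊓ y′ ≈T con 0ℤ ⊔ x′ ≈T con 1ℤ ⊓ y′ ≈T con 0ℤ ⊔ x′ ≈T con 0ℤ ⊓ y′ ≈T con 1ℤ)
          ⊔ someDir λ d → thirdT d (generic true)) refl (x ∷ y ∷ []) ℤP.≤-refl
  where x′ y′ : Term 2
        x′ = var 0F
        y′ = var 1F
... | inj₁ (inj₁ ((a , b) , c , d)) rewrite ℤP.≤-antisym a b | ℤP.≤-antisym c d = inj₁ (there (here refl))
... | inj₁ (inj₂ (inj₁ ((a , b) , c , d))) rewrite ℤP.≤-antisym a b | ℤP.≤-antisym c d = inj₁ (there (there (here refl)))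
... | inj₁ (inj₂ (inj₂ ((a , b) , c , d))) rewrite ℤP.≤-antisym a b | ℤP.≤-antisym c d = inj₁ (there (there (there (here refl))))
... | inj₂ p = inj₂ (someDir-Σ p)
centre-or-third (x , y , false)
  with entails (signs (generic false)) (con 0ℤ ⊑ con 0ℤ)
         (var 0F ≈T con 0ℤ ⊓ var 1F ≈T con 0ℤ ⊔ someDir λ d → thirdT d (generic false)) refl (x ∷ y ∷ []) ℤP.≤-refl
... | inj₁ ((a , b) , c , d) rewrite ℤP.≤-antisym a b | ℤP.≤-antisym c d = inj₁ (here refl)
... | inj₂ p = inj₂ (someDir-Σ p)

negative-form : ∀ {p} → p ℤ.≤ -1ℤ → Σ ℕ λ j → p ≡ -1ℤ ℤ.- + j
negative-form { -[1+ zero ]}  _ = 0 , refl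
negative-form { -[1+ suc j ]} _ = suc j , refl
negative-form {+ _} ()

nonneg-form : ∀ {q} → 0ℤ ℤ.≤ q → Σ ℕ λ i → q ≡ + i
nonneg-form {+ i} _ = i , refl

third-code : ∀ {d t} → Third d t → Σ ℕ λ j → Σ ℕ λ i → t ≡ toTile (d , isUp t , j , i)
third-code {d} {t} (p , q) =
  let j , jeq = negative-form p
      i , ieq = nonneg-form q
  in j , i , trans (sym (at-coord d t)) (cong₂ (λ p q → at d p q (isUp t)) jeq ieq)

code-bound : ∀ m j → 1ℤ ℤ.- + suc m ℤ.≤ -1ℤ ℤ.- + j → j ℕ.< m
code-bound m j p = ℤP.drop‿+≤+ (entails [] (con 1ℤ ⊖ (con 1ℤ ⊕ var 0F) ⊑ con -1ℤ ⊖ var 1F)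
  (con 1ℤ ⊕ var 1F ⊑ var 0F) refl (+ m ∷ + j ∷ []) p)

inside-toTile : ∀ m d b j i → Inside (+ suc m) (toTile (d , b , j , i)) → j ℕ.< m × i ℕ.< 2 ℕ.+ m
inside-toTile m d b j i ins =
  let lower , _ = inside-coord (toTile (d , b , j , i)) ins d
      _ , upper = inside-coord (toTile (d , b , j , i)) ins (next d)
  in code-bound m j (subst (1ℤ ℤ.- + suc m ℤ.≤_) (coord-at d _ _ b) lower) ,
     s≤s (ℤP.drop‿+≤+ (subst (ℤ._≤ + suc m) (coord-next-at d (-1ℤ ℤ.- + j) _ b) upper))

toTile-inside : ∀ {m} d b {j i} → j ℕ.< m → i ℕ.< 2 ℕ.+ m → Inside (+ suc m) (toTile (d , b , j , i))
toTile-inside {m} d b {j} {i} j<m (s≤s i≤m) = at-inside d b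
  ( ℤP.i-j≤i -1ℤ (+ j)
  , entails [] (con 1ℤ ⊕ var 1F ⊑ var 0F) (con 1ℤ ⊖ (con 1ℤ ⊕ var 0F) ⊑ con -1ℤ ⊖ var 1F) refl (+ m ∷ + j ∷ []) (ℤ.+≤+ j<m)
  , ℤ.+≤+ z≤n , ℤ.+≤+ i≤m)

inside⇒∈ : ∀ {m t} → Inside (+ suc m) t → t ∈ hexagon m
inside⇒∈ {m} {t} ins with centre-or-third t
... | inj₁ t∈ = ∈-++⁺ˡ t∈
... | inj₂ (d , th) with third-code th
...   | j , i , eq =
  let j<m , i<m = inside-toTile m d (isUp t) j i (subst (Inside (+ suc m)) eq ins)
  in subst (_∈ hexagon m) (sym eq) (∈-++⁺ʳ centre (∈-map⁺ toTile (∈-codes d (isUp t) j<m i<m)))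

centre-inside : ∀ m {t} → t ∈ centre → Inside (+ suc m) t
centre-inside m t∈ = All.lookup {P = Inside (+ suc m)} (i₀ ∷ i₁ ∷ i₂ ∷ i₃ ∷ []) t∈
  where
  hexF : ∀ (T : TileTerm 1) → entailed [] (nonneg (var 0F)) (insideF (con 1ℤ ⊕ var 0F) T) ≡ true →
         ⟦ insideF (con 1ℤ ⊕ var 0F) T ⟧ (+ m ∷ [])
  hexF T eq = entails [] (nonneg (var 0F)) (insideF (con 1ℤ ⊕ var 0F) T) eq (+ m ∷ []) (ℤ.+≤+ z≤n)
  i₀ = hexF ⟨ con 0ℤ , con 0ℤ , false ⟩ refl
  i₁ = hexF ⟨ con 0ℤ , con 0ℤ , true ⟩ refl
  i₂ = hexF ⟨ con 1ℤ , con 0ℤ , true ⟩ refl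
  i₃ = hexF ⟨ con 0ℤ , con 1ℤ , true ⟩ refl

∈⇒inside : ∀ {m t} → t ∈ hexagon m → Inside (+ suc m) t
∈⇒inside {m} t∈ with ∈-++⁻ centre t∈
... | inj₁ t∈centre = centre-inside m t∈centre
... | inj₂ t∈map with ∈-map⁻ toTile t∈map
...   | (d , b , j , i) , c∈ , refl = let j<m , i<m = ∈-codes⁻ c∈ in toTile-inside d b j<m i<m

-- Counting the holes

centre-notHole : ∀ {t} → t ∈ centre → ¬ Hole t
centre-notHole t∈ = All.lookup (from-yes (All.all? (λ t → ¬? (hole? t)) centre)) t∈

edge : ℕ → ℕ × ℕ
edge r = 0 , r

shift : ℕ × ℕ → ℕ × ℕ
shift (c , r) = suc c , r

triangle : ℕ → List (ℕ × ℕ)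
triangle zero    = []
triangle (suc m) = map edge (upTo (suc m)) ++ map shift (triangle m)

∈-triangle : ∀ m {c r} → c ℕ.+ r ℕ.< m → (c , r) ∈ triangle m
∈-triangle (suc m) {zero}  r<m       = ∈-++⁺ˡ (∈-map⁺ edge (∈-upTo⁺ r<m))
∈-triangle (suc m) {suc c} (s≤s c<m) = ∈-++⁺ʳ (map edge (upTo (suc m))) (∈-map⁺ shift (∈-triangle m c<m))

∈-triangle⁻ : ∀ m {c r} → (c , r) ∈ triangle m → c ℕ.+ r ℕ.< m
∈-triangle⁻ (suc m) c∈ with ∈-++⁻ (map edge (upTo (suc m))) c∈
... | inj₁ c∈₁ with ∈-map⁻ edge c∈₁
...   | _ , r∈ , refl = ∈-upTo⁻ r∈
∈-triangle⁻ (suc m) c∈ | inj₂ c∈₂ with ∈-map⁻ shift c∈₂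
...   | _ , cr∈ , refl = s≤s (∈-triangle⁻ m cr∈)

unique-triangle : ∀ m → Unique (triangle m)
unique-triangle zero    = []
unique-triangle (suc m) = Uniq.++⁺ (Uniq.map⁺ (λ { refl → refl }) (Uniq.upTo⁺ (suc m)))
  (Uniq.map⁺ (λ { refl → refl }) (unique-triangle m))
  λ (p , q) → case ∈-map⁻ edge p , ∈-map⁻ shift q of λ { ((_ , _ , refl) , _ , _ , ()) }

length-triangle : ∀ m → 2 ℕ.* length (triangle m) ≡ m ℕ.* suc m
length-triangle zero    = refl
length-triangle (suc m) = begin
  2 ℕ.* length (triangle (suc m))
    ≡⟨ cong (2 ℕ.*_) (trans (length-++ (map edge (upTo (suc m))))
         (cong₂ ℕ._+_ (trans (length-map edge (upTo (suc m))) (length-upTo (suc m))) (length-map shift (triangle m)))) ⟩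
  2 ℕ.* (suc m ℕ.+ length (triangle m))
    ≡⟨ ℕP.*-distribˡ-+ 2 (suc m) (length (triangle m)) ⟩
  2 ℕ.* suc m ℕ.+ 2 ℕ.* length (triangle m)
    ≡⟨ cong (2 ℕ.* suc m ℕ.+_) (length-triangle m) ⟩
  2 ℕ.* suc m ℕ.+ m ℕ.* suc m
    ≡⟨ lem m ⟩
  suc m ℕ.* suc (suc m) ∎
  where
  open ≡-Reasoning
  lem : ∀ m → 2 ℕ.* suc m ℕ.+ m ℕ.* suc m ≡ suc m ℕ.* suc (suc m)
  lem = ℕSolver.solve-∀

-- A third has n holes on the n-th concentric hexagon, at the values 0, 2, -2, 4, -4, … of the
-- coordinate next (next d); (c , r) stands for the c-th of them on the hexagon with n = 1 + c + r.
holeCode : Dir × ℕ × ℕ → Code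
holeCode (d , zero , r)    = d , false , r , suc r
holeCode (d , suc c , r) =
  if oddℕ (suc c) then (d , false , suc c ℕ.+ r , r) else (d , true , r , 2 ℕ.+ (suc c ℕ.+ r))

-- A left inverse of `holeCode`. Truncated subtraction and the minimum cover both kinds of down
-- holes at once: i = j + 1 yields c = 0.
holeIndex : Code → Dir × ℕ × ℕ
holeIndex (d , false , j , i) = d , j ℕ.∸ i , j ℕ.⊓ i
holeIndex (d , true , j , i)  = d , i ℕ.∸ 2 ℕ.∸ j , j

holeIndex-holeCode : ∀ x → holeIndex (holeCode x) ≡ x
holeIndex-holeCode (d , zero , r) = cong (d ,_) (cong₂ _,_ (ℕP.m≤n⇒m∸n≡0 (ℕP.n≤1+n r)) (ℕP.m≤n⇒m⊓n≡m (ℕP.n≤1+n r)))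
holeIndex-holeCode (d , suc c , r) with oddℕ (suc c)
... | true  = cong (d ,_) (cong₂ _,_ (ℕP.m+n∸n≡m (suc c) r) (ℕP.m≥n⇒m⊓n≡n (ℕP.m≤n+m r (suc c))))
... | false = cong (d ,_) (cong (_, r) (ℕP.m+n∸n≡m (suc c) r))

holeCode-injective : ∀ {x y} → holeCode x ≡ holeCode y → x ≡ y
holeCode-injective {x} {y} eq =
  trans (sym (holeIndex-holeCode x)) (trans (cong holeIndex eq) (holeIndex-holeCode y))

parity-of : ∀ {b} c → oddℕ c ≡ b → HasParity b (+ c)
parity-of c refl = parity-ℕ c

holeCode-hole : ∀ x → Hole (toTile (holeCode x))
holeCode-hole (d , zero , r) = go d
  where
  go : ∀ d → Hole (toTile (d , false , r , suc r))
  go W = entails [] (nonneg (var 0F)) (holeF (atT W (con -1ℤ ⊖ var 0F) (con 1ℤ ⊕ var 0F) false)) refl (+ r ∷ []) (ℤ.+≤+ z≤n)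
  go X = entails [] (nonneg (var 0F)) (holeF (atT X (con -1ℤ ⊖ var 0F) (con 1ℤ ⊕ var 0F) false)) refl (+ r ∷ []) (ℤ.+≤+ z≤n)
  go Y = entails [] (nonneg (var 0F)) (holeF (atT Y (con -1ℤ ⊖ var 0F) (con 1ℤ ⊕ var 0F) false)) refl (+ r ∷ []) (ℤ.+≤+ z≤n)
holeCode-hole (d , suc c , r) with oddℕ (suc c) in eq
... | true = go d
  where
  hyp : Form 2
  hyp = parity true (var 0F) ⊓ con 1ℤ ⊑ var 0F ⊓ nonneg (var 1F)
  hyp-holds : ⟦ hyp ⟧ (+ suc c ∷ + r ∷ [])
  hyp-holds = parity-of (suc c) eq , ℤ.+≤+ (s≤s z≤n) , ℤ.+≤+ z≤n
  goal : Dir → Form 2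
  goal d = holeF (atT d (con -1ℤ ⊖ (var 0F ⊕ var 1F)) (var 1F) false)
  go : ∀ d → Hole (toTile (d , false , suc c ℕ.+ r , r))
  go W = entails [] hyp (goal W) refl (+ suc c ∷ + r ∷ []) hyp-holds
  go X = entails [] hyp (goal X) refl (+ suc c ∷ + r ∷ []) hyp-holds
  go Y = entails [] hyp (goal Y) refl (+ suc c ∷ + r ∷ []) hyp-holds
... | false = go d
  where
  hyp : Form 2
  hyp = parity false (var 0F) ⊓ con 1ℤ ⊑ var 0F ⊓ nonneg (var 1F)
  hyp-holds : ⟦ hyp ⟧ (+ suc c ∷ + r ∷ [])
  hyp-holds = parity-of (suc c) eq , ℤ.+≤+ (s≤s z≤n) , ℤ.+≤+ z≤n
  goal : Dir → Form 2
  goal d = holeF (atT d (con -1ℤ ⊖ var 1F) (con (+ 2) ⊕ (var 0F ⊕ var 1F)) true)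
  go : ∀ d → Hole (toTile (d , true , r , 2 ℕ.+ (suc c ℕ.+ r)))
  go W = entails [] hyp (goal W) refl (+ suc c ∷ + r ∷ []) hyp-holds
  go X = entails [] hyp (goal X) refl (+ suc c ∷ + r ∷ []) hyp-holds
  go Y = entails [] hyp (goal Y) refl (+ suc c ∷ + r ∷ []) hyp-holds

-- A down hole has exactly one negative coordinate, here that of `d`. The third coordinate 1 + j - i
-- is then nonnegative, and it is the one required to be even.
hole-false : ∀ d {j i} → Hole (toTile (d , false , j , i)) → i ℕ.≤ suc j × HasParity false (1ℤ ℤ.+ + j ℤ.- + i)
hole-false d {j} {i} h = let i≤ , par = go d h in ℤP.drop‿+≤+ i≤ , par
  where
  goal : Form 2
  goal = var 1F ⊑ con 1ℤ ⊕ var 0F ⊓ parity false (con 1ℤ ⊕ var 0F ⊖ var 1F)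
  hyp : Dir → Form 2
  hyp d = nonneg (var 0F) ⊓ nonneg (var 1F) ⊓ holeF (atT d (con -1ℤ ⊖ var 0F) (var 1F) false)
  go : ∀ d → Hole (toTile (d , false , j , i)) → ⟦ goal ⟧ (+ j ∷ + i ∷ [])
  go W h = entails [] (hyp W) goal refl (+ j ∷ + i ∷ []) (ℤ.+≤+ z≤n , ℤ.+≤+ z≤n , h)
  go X h = entails [] (hyp X) goal refl (+ j ∷ + i ∷ []) (ℤ.+≤+ z≤n , ℤ.+≤+ z≤n , h)
  go Y h = entails [] (hyp Y) goal refl (+ j ∷ + i ∷ []) (ℤ.+≤+ z≤n , ℤ.+≤+ z≤n , h)

-- An up hole has two negative coordinates. Since `next d` is nonnegative, the third one, 2 + j - i,
-- is negative; it precedes `d` cyclically and so is the even one.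
hole-true : ∀ d {j i} → Hole (toTile (d , true , j , i)) → 3 ℕ.+ j ℕ.≤ i × HasParity false (+ i ℤ.- + j)
hole-true d {j} {i} h = let i≤ , par = go d h in ℤP.drop‿+≤+ i≤ , par
  where
  goal : Form 2
  goal = con (+ 3) ⊕ var 0F ⊑ var 1F ⊓ parity false (var 1F ⊖ var 0F)
  hyp : Dir → Form 2
  hyp d = nonneg (var 0F) ⊓ nonneg (var 1F) ⊓ holeF (atT d (con -1ℤ ⊖ var 0F) (var 1F) true)
  go : ∀ d → Hole (toTile (d , true , j , i)) → ⟦ goal ⟧ (+ j ∷ + i ∷ [])
  go W h = entails [] (hyp W) goal refl (+ j ∷ + i ∷ []) (ℤ.+≤+ z≤n , ℤ.+≤+ z≤n , h)
  go X h = entails [] (hyp X) goal refl (+ j ∷ + i ∷ []) (ℤ.+≤+ z≤n , ℤ.+≤+ z≤n , h)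
  go Y h = entails [] (hyp Y) goal refl (+ j ∷ + i ∷ []) (ℤ.+≤+ z≤n , ℤ.+≤+ z≤n , h)

oddℕ-of : ∀ {b} c → HasParity b (+ c) → oddℕ c ≡ b
oddℕ-of c p = parity-unique (parity-ℕ c) p

hole-holeCode : ∀ m d b j i → j ℕ.< m → i ℕ.< 2 ℕ.+ m → Hole (toTile (d , b , j , i)) →
                Σ (ℕ × ℕ) λ (c , r) → (d , b , j , i) ≡ holeCode (d , c , r) × c ℕ.+ r ℕ.< m
hole-holeCode m d false j i j<m i<m h with hole-false d {j} {i} h
... | i≤1+j , par with ℕP.m≤n⇒m<n∨m≡n i≤1+j
...   | inj₂ refl = (0 , j) , refl , j<m
...   | inj₁ (s≤s i≤j) with ℕP.m≤n⇒∃[o]m+o≡n i≤j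
-- For i = j the third coordinate would be 1, which is odd.
...     | zero , refl = case entails [] (parity false (con 1ℤ ⊕ (var 0F ⊕ con 0ℤ) ⊖ var 0F)) ff refl (+ i ∷ []) par of λ ()
...     | suc c , refl = (suc c , i) , eq , subst (ℕ._< m) (ℕP.+-comm i (suc c)) j<m
  where
  odd-c : oddℕ (suc c) ≡ true
  odd-c = oddℕ-of (suc c)
    (entails [] (parity false (con 1ℤ ⊕ (var 0F ⊕ var 1F) ⊖ var 0F)) (parity true (var 1F)) refl (+ i ∷ + suc c ∷ []) par)
  eq : (d , false , i ℕ.+ suc c , i) ≡ holeCode (d , suc c , i)
  eq rewrite odd-c = cong (λ j → d , false , j , i) (ℕP.+-comm i (suc c))
hole-holeCode m d true j i j<m i<m h with hole-true d {j} {i} h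
... | 3+j≤i , par with ℕP.m≤n⇒∃[o]m+o≡n 3+j≤i
...   | o , refl = (suc o , j) , eq ,
  subst (ℕ._< m) (cong suc (ℕP.+-comm j o)) (ℕ.s<s⁻¹ (ℕ.s<s⁻¹ i<m))
  where
  even-c : oddℕ (suc o) ≡ false
  even-c = oddℕ-of (suc o)
    (entails [] (parity false (con (+ 3) ⊕ var 0F ⊕ var 1F ⊖ var 0F)) (parity false (con 1ℤ ⊕ var 1F)) refl (+ j ∷ + o ∷ []) par)
  eq : (d , true , j , 3 ℕ.+ j ℕ.+ o) ≡ holeCode (d , suc o , j)
  eq rewrite even-c = cong (λ i → d , true , j , 3 ℕ.+ i) (ℕP.+-comm j o)

holeCode-bounds : ∀ m d c r → c ℕ.+ r ℕ.< m → holeCode (d , c , r) ∈ codes m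
holeCode-bounds m d zero r r<m = ∈-codes d false r<m (s≤s (ℕP.m≤n⇒m≤1+n r<m))
holeCode-bounds m d (suc c) r cr<m with oddℕ (suc c)
... | true  = ∈-codes d false cr<m (ℕP.<-≤-trans (ℕP.≤-<-trans (ℕP.m≤n+m r (suc c)) cr<m) (ℕP.m≤n+m m 2))
... | false = ∈-codes d true (ℕP.≤-<-trans (ℕP.m≤n+m r (suc c)) cr<m) (s≤s (s≤s cr<m))

holeTiles : ℕ → List Tile
holeTiles m = filter hole? (hexagon m)

holeIndices : ℕ → List (Dir × ℕ × ℕ)
holeIndices m = cartesianProduct dirs (triangle m)

length-holeTiles : ∀ m → length (holeTiles m) ≡ 3 ℕ.* length (triangle m)
length-holeTiles m = trans (trans
  (ℕP.≤-antisym (length-mono-⊆ (Uniq.filter⁺ hole? (unique-hexagon m)) to)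
                (length-mono-⊆ (Uniq.map⁺ (holeCode-injective ∘ toTile-injective)
                  (Uniq.cartesianProduct⁺ unique-dirs (unique-triangle m))) from))
  (length-map (toTile ∘ holeCode) (holeIndices m)))
  (length-cartesianProduct dirs (triangle m))
  where
  to : ∀ {t} → t ∈ holeTiles m → t ∈ map (toTile ∘ holeCode) (holeIndices m)
  to t∈ with ∈-filter⁻ hole? {xs = hexagon m} t∈
  ... | t∈hex , hole with ∈-++⁻ centre t∈hex
  ...   | inj₁ t∈centre = ⊥-elim (centre-notHole t∈centre hole)
  ...   | inj₂ t∈map with ∈-map⁻ toTile t∈map
  ...     | (d , b , j , i) , c∈ , refl with ∈-codes⁻ c∈
  ...       | j<m , i<m with hole-holeCode m d b j i j<m i<m hole
  ...         | (c , r) , eq , cr<m =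
    subst (λ c → toTile c ∈ map (toTile ∘ holeCode) (holeIndices m)) (sym eq)
      (∈-map⁺ (toTile ∘ holeCode) (∈-cartesianProduct⁺ (∈-dirs d) (∈-triangle m {c} {r} cr<m)))
  from : ∀ {t} → t ∈ map (toTile ∘ holeCode) (holeIndices m) → t ∈ holeTiles m
  from t∈ with ∈-map⁻ (toTile ∘ holeCode) t∈
  ... | (d , c , r) , x∈ , refl = ∈-filter⁺ hole?
    (∈-++⁺ʳ centre (∈-map⁺ toTile (holeCode-bounds m d c r
      (∈-triangle⁻ m (proj₂ (∈-cartesianProduct⁻ dirs (triangle m) x∈))))))
    (holeCode-hole (d , c , r))

-- The complement and the boundary

stepOf : Bool → ℤ
stepOf true  = -1ℤ
stepOf false = 1ℤ

coord-nbr : ∀ d t → coord d (nbr d t) ≡ coord d t ℤ.+ stepOf (isUp t)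
coord-nbr X (x , y , true)  = refl
coord-nbr Y (x , y , true)  = refl
coord-nbr W (x , y , true)  = lem x y
  where lem : ∀ x y → 0ℤ ℤ.- x ℤ.- y ≡ 1ℤ ℤ.- x ℤ.- y ℤ.+ -1ℤ
        lem = solve-∀
coord-nbr X (x , y , false) = refl
coord-nbr Y (x , y , false) = refl
coord-nbr W (x , y , false) = lem x y
  where lem : ∀ x y → 1ℤ ℤ.- x ℤ.- y ≡ 0ℤ ℤ.- x ℤ.- y ℤ.+ 1ℤ
        lem = solve-∀

shift-x : ∀ x y → 0ℤ ℤ.- (x ℤ.- 1ℤ) ℤ.- y ≡ 1ℤ ℤ.- x ℤ.- y
shift-x = solve-∀

shift-y : ∀ x y → 0ℤ ℤ.- x ℤ.- (y ℤ.- 1ℤ) ≡ 1ℤ ℤ.- x ℤ.- y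
shift-y = solve-∀

unshift-x : ∀ x y → 1ℤ ℤ.- (x ℤ.+ 1ℤ) ℤ.- y ≡ 0ℤ ℤ.- x ℤ.- y
unshift-x = solve-∀

unshift-y : ∀ x y → 1ℤ ℤ.- x ℤ.- (y ℤ.+ 1ℤ) ≡ 0ℤ ℤ.- x ℤ.- y
unshift-y = solve-∀

coord-nbr-≢ : ∀ d e → d ≢ e → ∀ t → coord d (nbr e t) ≡ coord d t
coord-nbr-≢ W W d≢e t = ⊥-elim (d≢e refl)
coord-nbr-≢ X X d≢e t = ⊥-elim (d≢e refl)
coord-nbr-≢ Y Y d≢e t = ⊥-elim (d≢e refl)
coord-nbr-≢ W X _ (x , y , true)  = shift-x x y
coord-nbr-≢ W Y _ (x , y , true)  = shift-y x y
coord-nbr-≢ W X _ (x , y , false) = unshift-x x y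
coord-nbr-≢ W Y _ (x , y , false) = unshift-y x y
coord-nbr-≢ X W _ (x , y , true)  = refl
coord-nbr-≢ X W _ (x , y , false) = refl
coord-nbr-≢ X Y _ (x , y , true)  = refl
coord-nbr-≢ X Y _ (x , y , false) = refl
coord-nbr-≢ Y W _ (x , y , true)  = refl
coord-nbr-≢ Y W _ (x , y , false) = refl
coord-nbr-≢ Y X _ (x , y , true)  = refl
coord-nbr-≢ Y X _ (x , y , false) = refl

≢next : ∀ d → d ≢ next d
≢next W ()
≢next X ()
≢next Y ()

isUp-nbr : ∀ d t → isUp (nbr d t) ≡ not (isUp t)
isUp-nbr W (x , y , true)  = refl
isUp-nbr X (x , y , true)  = refl
isUp-nbr Y (x , y , true)  = refl
isUp-nbr W (x , y , false) = refl
isUp-nbr X (x , y , false) = refl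
isUp-nbr Y (x , y , false) = refl

height : Dir → Bool → Tile → ℤ
height d false t = coord d t
height d true  t = ℤ.- coord d t

height-nbr : ∀ d b t → isUp t ≡ b → height d b (nbr d t) ≡ height d b t ℤ.+ 1ℤ
height-nbr d true  t@(_ , _ , true)  refl = trans (cong ℤ.-_ (coord-nbr d t)) (ℤP.neg-distrib-+ (coord d t) -1ℤ)
height-nbr d false t@(_ , _ , false) refl = coord-nbr d t

height-nbr-≢ : ∀ d e b → d ≢ e → ∀ t → height d b (nbr e t) ≡ height d b t
height-nbr-≢ d e true  d≢e t = cong ℤ.-_ (coord-nbr-≢ d e d≢e t)
height-nbr-≢ d e false d≢e t = coord-nbr-≢ d e d≢e t

-- A half-plane of tiles. The complement of the hexagon is a union of six of them, so unboundedness
-- has to be shown for half-planes only.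
Above : Dir → Bool → ℤ → Tile → Set
Above d b c t = c ℤ.≤ height d b t

-- Only a tile of orientation `b` can rise across its `d`-edge; a sidestep in direction `next d`
-- keeps the height and flips the orientation. No tile on the way is lower than the start, so the
-- path stays in the half-plane.
climb : ∀ d b {c} t → Above d b c t → Σ Tile λ u → Path (Above d b c) t u × height d b u ≡ height d b t ℤ.+ 1ℤ
climb d b {c} t c≤ = go (isUp t Bool.≟ b)
  where
  raise : ∀ {u v} → height d b v ≡ height d b u ℤ.+ 1ℤ → Above d b c u → Above d b c v
  raise {u} eq p = ℤP.≤-trans p (subst (height d b u ℤ.≤_) (sym eq) (ℤP.i≤i+j (height d b u) 1ℤ))
  level : ∀ {u v} → height d b v ≡ height d b u → Above d b c u → Above d b c v
  level eq p = subst (c ℤ.≤_) (sym eq) p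
  flip : isUp t ≢ b → isUp (nbr (next d) t) ≡ b
  flip t≢b = trans (isUp-nbr (next d) t) (not-≢ (isUp t) b t≢b)
    where
    not-≢ : ∀ a b → a ≢ b → not a ≡ b
    not-≢ true  true  p = ⊥-elim (p refl)
    not-≢ true  false p = refl
    not-≢ false true  p = refl
    not-≢ false false p = ⊥-elim (p refl)
  go : Dec (isUp t ≡ b) → Σ Tile λ u → Path (Above d b c) t u × height d b u ≡ height d b t ℤ.+ 1ℤ
  go (yes eq) =
    let up = height-nbr d b t eq
        across = height-nbr-≢ d (next d) b (≢next d) (nbr d t)
        p = raise up c≤
    in nbr (next d) (nbr d t)
     , step c≤ (nbr-adj d t) (step p (nbr-adj (next d) (nbr d t)) (here (level across p)))
     , trans across up
  go (no t≢b) =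
    let across = height-nbr-≢ d (next d) b (≢next d) t
        up = height-nbr d b (nbr (next d) t) (flip t≢b)
        p = level across c≤
    in nbr d (nbr (next d) t)
     , step c≤ (nbr-adj (next d) t) (step p (nbr-adj d (nbr (next d) t)) (here (raise up p)))
     , trans up (cong (ℤ._+ 1ℤ) across)

climb* : ∀ d b {c} n t → Above d b c t → Σ Tile λ u → Path (Above d b c) t u × height d b u ≡ height d b t ℤ.+ + n
climb* d b zero    t p = t , here p , sym (ℤP.+-identityʳ _)
climb* d b (suc n) t p =
  let u , path , eq    = climb d b t p
      v , path′ , eq′ = climb* d b n u (path-end path)
  in v , path-++ path path′ , trans eq′ (trans (cong (ℤ._+ + n) eq) (ℤP.+-assoc (height d b t) 1ℤ (+ n)))

i≤∣i∣ : ∀ i → i ℤ.≤ + ∣ i ∣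
i≤∣i∣ (+ n)    = ℤP.≤-refl
i≤∣i∣ -[1+ n ] = ℤ.-≤+

bounded : ∀ (μ : Tile → ℤ) L → Σ ℤ λ B → ∀ {u} → u ∈ L → μ u ℤ.≤ B
bounded μ []      = 0ℤ , λ ()
bounded μ (t ∷ L) = let B , μ≤B = bounded μ L in μ t ℤ.⊔ B , λ where
  (here refl) → ℤP.i≤i⊔j (μ t) B
  (there u∈)  → ℤP.≤-trans (μ≤B u∈) (ℤP.i≤j⊔i (μ t) B)

-- Heights on a finite list are bounded, while climbing reaches any height without leaving the
-- half-plane.
escape : ∀ d b {c} t → Above d b c t → ∀ L → ¬ (∀ u → Path (Above d b c) t u → u ∈ L)
escape d b t p L all∈L =
  let B , μ≤B = bounded (height d b) L
      n = ∣ B ℤ.- height d b t ∣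
      u , path , eq = climb* d b (suc n) t p
  in ℤP.<-irrefl refl (ℤP.<-≤-trans (beyond B (height d b t)) (subst (ℤ._≤ B) eq (μ≤B (all∈L u path))))
  where
  beyond : ∀ B z → B ℤ.< z ℤ.+ + suc ∣ B ℤ.- z ∣
  beyond B z = ℤP.suc[i]≤j⇒i<j (subst₂ ℤ._≤_ (lem B z) (lem′ z (+ ∣ B ℤ.- z ∣))
                 (ℤP.+-monoʳ-≤ (1ℤ ℤ.+ z) (i≤∣i∣ (B ℤ.- z))))
    where
    lem : ∀ B z → 1ℤ ℤ.+ z ℤ.+ (B ℤ.- z) ≡ 1ℤ ℤ.+ B
    lem = solve-∀
    lem′ : ∀ z n → 1ℤ ℤ.+ z ℤ.+ n ≡ z ℤ.+ (1ℤ ℤ.+ n)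
    lem′ = solve-∀

-- The two thresholds differ because the range [1 - k, k] is not symmetric: a coordinate leaves it
-- upwards at k + 1 and downwards at -k.
limit : Bool → ℤ → ℤ
limit true  k = k
limit false k = k ℤ.+ 1ℤ

above⇒outside : ∀ {k} d b t → Above d b (limit b k) t → ¬ Inside k t
above⇒outside {k} d false t p ins =
  entails [] (var 0F ⊕ con 1ℤ ⊑ var 1F ⊓ var 1F ⊑ var 0F) ff refl (k ∷ coord d t ∷ []) (p , proj₂ (inside-coord t ins d))
above⇒outside {k} d true  t p ins =
  entails [] (var 0F ⊑ -1ℤ ⊛ var 1F ⊓ con 1ℤ ⊖ var 0F ⊑ var 1F) ff refl (k ∷ coord d t ∷ [])
    (subst (k ℤ.≤_) (sym (ℤP.-1*i≡-i (coord d t))) p , proj₁ (inside-coord t ins d))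

outside⇒above : ∀ {k} t → Outside k t → Σ Dir λ d → Σ Bool λ b → Above d b (limit b k) t
outside⇒above {k} = λ where
    (x , y , true)  p → choose (someDir-Σ p)
    (x , y , false) p → choose (someDir-Σ p)
  where
  below : ∀ z → z ℤ.+ 1ℤ ℤ.≤ 1ℤ ℤ.- k → k ℤ.≤ ℤ.- z
  below z p = subst (k ℤ.≤_) (ℤP.-1*i≡-i z)
    (entails [] (var 0F ⊕ con 1ℤ ⊑ con 1ℤ ⊖ var 1F) (var 1F ⊑ -1ℤ ⊛ var 0F) refl (z ∷ k ∷ []) p)
  choose : ∀ {t} → Σ Dir (λ d → coord d t ℤ.+ 1ℤ ℤ.≤ 1ℤ ℤ.- k ⊎ k ℤ.+ 1ℤ ℤ.≤ coord d t) →
           Σ Dir λ d → Σ Bool λ b → Above d b (limit b k) t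
  choose {t} (d , inj₁ p) = d , true , below (coord d t) p
  choose     (d , inj₂ p) = d , false , p

outside-¬InHole : ∀ {k} A → (∀ {t} → t ∈ tiles A → Inside k t) → ∀ {t} → ¬ Inside k t → ¬ InHole A t
outside-¬InHole A A⊆ {t} ¬ins (_ , L , reach⊆L) =
  let d , b , p = outside⇒above t (¬inside⇒outside t ¬ins)
  in escape d b t p L λ u path → reach⊆L u (path-map (λ {v} q v∈ → above⇒outside d b v q (A⊆ v∈)) path)

-- The spiral and its holes

module _ (m : ℕ) where

  private
    k : ℤ
    k = + suc m

  reach-origin : ∀ {t} → Cell k t → Path (Cell k) t origin
  reach-origin {t} c = path-to-origin ∣ rank t ∣ t c (i≤∣i∣ (rank t))

  inside-path : ∀ t → Inside k t → Path (Inside k) t origin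
  inside-path t ins with hole? t
  ... | no ¬h = path-map proj₁ (reach-origin (ins , ¬hole⇒notHole t ¬h))
  ... | yes h = step ins (nbr-adj W t) (path-map proj₁
    (reach-origin (hole-nbr-inside W t (ins , h) , hole-nbr-notHole W t h)))

  filled : Polyiamond
  filled .tiles     = hexagon m
  filled .distinct  = unique-hexagon m
  filled .nonempty  = λ ()
  filled .connected a b a∈ b∈ = path-map inside⇒∈
    (path-++ (inside-path a (∈⇒inside a∈)) (path-reverse (inside-path b (∈⇒inside b∈))))

  spiralTiles : List Tile
  spiralTiles = filter (¬? ∘ hole?) (hexagon m)

  ∈-spiral⁺ : ∀ {t} → Cell k t → t ∈ spiralTiles
  ∈-spiral⁺ {t} (ins , nh) = ∈-filter⁺ (¬? ∘ hole?) (inside⇒∈ ins) (notHole⇒¬hole t nh)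

  ∈-spiral⁻ : ∀ {t} → t ∈ spiralTiles → Cell k t
  ∈-spiral⁻ {t} t∈ = let t∈hex , ¬h = ∈-filter⁻ (¬? ∘ hole?) {xs = hexagon m} t∈ in
    ∈⇒inside t∈hex , ¬hole⇒notHole t ¬h

  spiral : Polyiamond
  spiral .tiles     = spiralTiles
  spiral .distinct  = Uniq.filter⁺ (¬? ∘ hole?) (unique-hexagon m)
  -- The head of `hexagon m` is the closed tile `origin`, on which `hole?` evaluates, so the
  -- filtered list reduces to a cons.
  spiral .nonempty  = λ ()
  spiral .connected a b a∈ b∈ = path-map ∈-spiral⁺
    (path-++ (reach-origin (∈-spiral⁻ a∈)) (path-reverse (reach-origin (∈-spiral⁻ b∈))))

  spiral-tree : DualTree spiral
  spiral-tree = Forest.no-cycle (Cell k) ParentOf rank parent-functional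
    (λ {t} c p → parent-decreasing {k} {t} c p) (λ {t} {u} → parent-oriented {k} {t} {u}) {spiral} ∈-spiral⁻

  holeList : List (List Tile)
  holeList = map (_∷ []) (holeTiles m)

  holeTile-alone : ∀ {t} → t ∈ holeTiles m → ∀ u → ComplPath spiral t u → u ≡ t
  holeTile-alone t∈ u (here _) = refl
  holeTile-alone {t} t∈ u (step _ a r) with adj⇒nbr t a | ∈-filter⁻ hole? {xs = hexagon m} t∈
  ... | d , refl | t∈hex , h = ⊥-elim (path-start r
    (∈-spiral⁺ (hole-nbr-inside d t (∈⇒inside t∈hex , h) , hole-nbr-notHole d t h)))

  holeTile-∉ : ∀ {t} → t ∈ holeTiles m → t ∉ spiralTiles
  holeTile-∉ {t} t∈ t∈spiral =
    notHole⇒¬hole t (proj₂ (∈-spiral⁻ t∈spiral)) (proj₂ (∈-filter⁻ hole? {xs = hexagon m} t∈))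

  holeTile-inHole : ∀ {t} → t ∈ holeTiles m → InHole spiral t
  holeTile-inHole {t} t∈ = holeTile-∉ t∈ , t ∷ [] , λ u p → here (holeTile-alone t∈ u p)

  holeTile-isHole : ∀ {t} → t ∈ holeTiles m → IsHole spiral (t ∷ [])
  holeTile-isHole {t} t∈ = t , holeTile-inHole t∈ , [] ∷ [] ,
    λ u → mk⇔ (λ { (here refl) → here (holeTile-∉ t∈) }) (λ p → here (holeTile-alone t∈ u p))

  inHole⇒holeTile : ∀ {t} → InHole spiral t → t ∈ holeTiles m
  inHole⇒holeTile {t} h@(t∉ , _) with inside? k t
  ... | no ¬ins = ⊥-elim (outside-¬InHole spiral (proj₁ ∘ ∈-spiral⁻) ¬ins h)
  ... | yes ins with hole? t
  ...   | yes hole = ∈-filter⁺ hole? (inside⇒∈ ins) hole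
  ...   | no ¬hole = ⊥-elim (t∉ (∈-spiral⁺ (ins , ¬hole⇒notHole t ¬hole)))

  spiral-holes : HoleList spiral holeList
  spiral-holes = AllP.map⁺ (All.tabulate holeTile-isHole)
               , disjoint (Uniq.filter⁺ hole? (unique-hexagon m))
               , λ t h → AnyP.map⁺ (Any.map (λ { refl → here refl }) (inHole⇒holeTile h))
    where
    disjoint : ∀ {ts} → Unique ts → AllPairs Disjoint (map (_∷ []) ts)
    disjoint []        = []
    disjoint (t≢ ∷ us) = AllP.map⁺ (All.map (λ { t≢u s (here refl) (here refl) → t≢u refl }) t≢) ∷ disjoint us

  holeList-area : All (λ H → length H ≡ 1) holeList
  holeList-area = AllP.map⁺ (All.tabulate λ _ → refl)

-- Boundary edges and the outer perimeter

notIn⁻ : ∀ A {t} → T (notIn A t) → t ∉ tiles A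
notIn⁻ A {t} p with t ∈?A A
... | no t∉ = t∉

notIn⁺ : ∀ A {t} → t ∉ tiles A → T (notIn A t)
notIn⁺ A {t} t∉ with t ∈?A A
... | yes t∈ = t∉ t∈
... | no  _  = tt

outerNeighbours : Polyiamond → Tile → List Tile
outerNeighbours A a = filter (λ b → T? (notIn A b)) (neighbours a)

edgesAt : Polyiamond → Tile → List (Tile × Tile)
edgesAt A a = map (a ,_) (outerNeighbours A a)

boundary : Polyiamond → List (Tile × Tile)
boundary A = concatMap (edgesAt A) (tiles A)

length-boundary : ∀ A → length (boundary A) ≡ perimeter A
length-boundary A = go (tiles A)
  where
  go : ∀ ts → length (concatMap (edgesAt A) ts) ≡ sum (map (length ∘ outerNeighbours A) ts)
  go []       = refl
  go (t ∷ ts) = trans (length-++ (edgesAt A t)) (cong₂ ℕ._+_ (length-map (t ,_) (outerNeighbours A t)) (go ts))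

∈-boundary⁺ : ∀ A {a b} → a ∈ tiles A → Adj a b → b ∉ tiles A → (a , b) ∈ boundary A
∈-boundary⁺ A {a} a∈ ab b∉ = ∈-concatMap⁺ (edgesAt A) (Any.map (λ { refl →
  ∈-map⁺ (a ,_) (∈-filter⁺ (λ b → T? (notIn A b)) ab (notIn⁺ A b∉)) }) a∈)

∈-boundary⁻ : ∀ A {e} → e ∈ boundary A → proj₁ e ∈ tiles A × Adj (proj₁ e) (proj₂ e) × proj₂ e ∉ tiles A
∈-boundary⁻ A e∈ with find (∈-concatMap⁻ (edgesAt A) {xs = tiles A} e∈)
... | a , a∈ , e∈a with ∈-map⁻ (a ,_) e∈a
...   | b , b∈ , refl = let ab , p = ∈-filter⁻ (λ b → T? (notIn A b)) {xs = neighbours a} b∈ in a∈ , ab , notIn⁻ A p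

x≢x-1 : ∀ x → x ≢ x ℤ.- 1ℤ
x≢x-1 x eq = entails [] (var 0F ⊑ var 0F ⊖ con 1ℤ) ff refl (x ∷ []) (ℤP.≤-reflexive eq)

x≢x+1 : ∀ x → x ≢ x ℤ.+ 1ℤ
x≢x+1 x eq = entails [] (var 0F ⊕ con 1ℤ ⊑ var 0F) ff refl (x ∷ []) (ℤP.≤-reflexive (sym eq))

unique-neighbours : ∀ t → Unique (neighbours t)
unique-neighbours (x , y , true)  =
  ((λ eq → x≢x-1 x (cong proj₁ eq)) ∷ (λ eq → x≢x-1 y (cong (proj₁ ∘ proj₂) eq)) ∷ []) ∷
  ((λ eq → x≢x-1 x (sym (cong proj₁ eq))) ∷ []) ∷ [] ∷ []
unique-neighbours (x , y , false) =
  ((λ eq → x≢x+1 x (cong proj₁ eq)) ∷ (λ eq → x≢x+1 y (cong (proj₁ ∘ proj₂) eq)) ∷ []) ∷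
  ((λ eq → x≢x+1 x (sym (cong proj₁ eq))) ∷ []) ∷ [] ∷ []

unique-boundary : ∀ A → Unique (boundary A)
unique-boundary A = go (distinct A)
  where
  go : ∀ {ts} → Unique ts → Unique (concatMap (edgesAt A) ts)
  go []                      = []
  go {t ∷ ts} (t≢ ∷ unique) = Uniq.++⁺
    (Uniq.map⁺ (cong proj₂) (Uniq.filter⁺ (λ b → T? (notIn A b)) (unique-neighbours t))) (go unique)
    λ (e∈t , e∈ts) → apart e∈t (find (∈-concatMap⁻ (edgesAt A) {xs = ts} e∈ts))
    where
    apart : ∀ {e} → e ∈ edgesAt A t → ¬ Σ Tile λ u → u ∈ ts × e ∈ edgesAt A u
    apart e∈t (u , u∈ , e∈u) with ∈-map⁻ (t ,_) e∈t | ∈-map⁻ (u ,_) e∈u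
    ... | _ , _ , refl | _ , _ , refl = All.lookup t≢ u∈ refl

-- Filling the holes does not change the outer edges: a hole has all its neighbours inside the
-- hexagon, so the inner tile of a boundary edge of the hexagon belongs to the spiral.
spiral-outerPerimeter : ∀ m → HasOuterPerimeter (spiral m) (perimeter (filled m))
spiral-outerPerimeter m = boundary (filled m) , unique-boundary (filled m)
  , (λ e → mk⇔ (to e) (from e)) , length-boundary (filled m)
  where
  to : ∀ e → e ∈ boundary (filled m) → OuterBoundaryEdge (spiral m) e
  to (a , b) e∈ =
    let a∈ , ab , b∉ = ∈-boundary⁻ (filled m) e∈
        a-inside = ∈⇒inside a∈
        b-outside = b∉ ∘ inside⇒∈
        a-notHole = ¬hole⇒notHole a λ h → b-outside (adj-elim {Inside (+ suc m)} {a}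
          (λ d → hole-nbr-inside d a (a-inside , h)) ab)
    in ∈-spiral⁺ m (a-inside , a-notHole) , ab , b-outside ∘ proj₁ ∘ ∈-spiral⁻ m ,
       outside-¬InHole (spiral m) (proj₁ ∘ ∈-spiral⁻ m) b-outside
  from : ∀ e → OuterBoundaryEdge (spiral m) e → e ∈ boundary (filled m)
  from (a , b) (a∈ , ab , b∉ , ¬h) = ∈-boundary⁺ (filled m) (inside⇒∈ (proj₁ (∈-spiral⁻ m a∈))) ab b∉hex
    where
    b∉hex : b ∉ hexagon m
    b∉hex b∈ with hole? b
    ... | yes h = ¬h (holeTile-inHole m (∈-filter⁺ hole? b∈ h))
    ... | no ¬h = b∉ (∈-spiral⁺ m (∈⇒inside b∈ , ¬hole⇒notHole b ¬h))

-- The hexagon has, for each coordinate, a side with up tiles and a side with down tiles.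
sideTile : ℕ → Dir × (ℕ ⊎ ℕ) → Tile
sideTile m (d , inj₁ i) = at d (ℤ.- + m) (+ i) true
sideTile m (d , inj₂ j) = at d (+ suc m) (-1ℤ ℤ.- + j) false

sideEdge : ℕ → Dir × (ℕ ⊎ ℕ) → Tile × Tile
sideEdge m x = sideTile m x , nbr (proj₁ x) (sideTile m x)

sides : ℕ → List (Dir × (ℕ ⊎ ℕ))
sides m = cartesianProduct dirs (map inj₁ (upTo (2 ℕ.+ m)) ++ map inj₂ (upTo m))

length-sides : ∀ m → length (sides m) ≡ 6 ℕ.* suc m
length-sides m = begin
  length (sides m)
    ≡⟨ length-cartesianProduct dirs (ups ++ downs) ⟩
  3 ℕ.* length (ups ++ downs)
    ≡⟨ cong (3 ℕ.*_) (length-++ ups) ⟩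
  3 ℕ.* (length ups ℕ.+ length downs)
    ≡⟨ cong (3 ℕ.*_) (cong₂ ℕ._+_ (trans (length-map inj₁ (upTo (2 ℕ.+ m))) (length-upTo (2 ℕ.+ m)))
                                  (trans (length-map inj₂ (upTo m)) (length-upTo m))) ⟩
  3 ℕ.* (2 ℕ.+ m ℕ.+ m)
    ≡⟨ lem m ⟩
  6 ℕ.* suc m ∎
  where
  open ≡-Reasoning
  ups downs : List (ℕ ⊎ ℕ)
  ups   = map inj₁ (upTo (2 ℕ.+ m))
  downs = map inj₂ (upTo m)
  lem : ∀ m → 3 ℕ.* (2 ℕ.+ m ℕ.+ m) ≡ 6 ℕ.* suc m
  lem = ℕSolver.solve-∀

SidePosition : Bool → ℤ → ℤ → ℤ → Set
SidePosition true  k p q = (p ℤ.≤ 1ℤ ℤ.- k × 1ℤ ℤ.- k ℤ.≤ p) × 0ℤ ℤ.≤ q × q ℤ.≤ k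
SidePosition false k p q = (p ℤ.≤ k × k ℤ.≤ p) × 1ℤ ℤ.- k ℤ.≤ q × q ℤ.≤ -1ℤ

sideF : Dir → TileTerm (3 ℕ.+ n) → Form (3 ℕ.+ n)
sideF d T@(⟨ _ , _ , true ⟩)  =
  coordT d T ≈T (con 1ℤ ⊖ var 2F) ⊓ nonneg (coordT (next d) T) ⊓ coordT (next d) T ⊑ var 2F
sideF d T@(⟨ _ , _ , false ⟩) =
  coordT d T ≈T var 2F ⊓ con 1ℤ ⊖ var 2F ⊑ coordT (next d) T ⊓ negative (coordT (next d) T)

side-position : ∀ {k} d t → Inside k t × Outside k (nbr d t) →
                SidePosition (isUp t) k (coord d t) (coord (next d) t)
side-position {k} = λ where
    W (x , y , true)  → lia W true refl x y (k ∷ [])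
    W (x , y , false) → lia W false refl x y (k ∷ [])
    X (x , y , true)  → lia X true refl x y (k ∷ [])
    X (x , y , false) → lia X false refl x y (k ∷ [])
    Y (x , y , true)  → lia Y true refl x y (k ∷ [])
    Y (x , y , false) → lia Y false refl x y (k ∷ [])
  where lia = entailsOn {1} (λ d T → insideF (var 2F) T ⊓ neg (insideF (var 2F) (nbrT d T))) sideF

1-suc : ∀ m → 1ℤ ℤ.- + suc m ≡ ℤ.- + m
1-suc zero    = refl
1-suc (suc m) = refl

sideTile-complete : ∀ m d a up → isUp a ≡ up → SidePosition up (+ suc m) (coord d a) (coord (next d) a) →
                    Σ (ℕ ⊎ ℕ) λ x → a ≡ sideTile m (d , x) × (d , x) ∈ sides m
sideTile-complete m d a true up ((p≤ , ≤p) , 0≤q , q≤k) with nonneg-form 0≤q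
... | i , q≡ = inj₁ i
  , trans (sym (at-coord d a)) (trans (cong (at d _ _) up)
      (cong₂ (λ p q → at d p q true) (trans (ℤP.≤-antisym p≤ ≤p) (1-suc m)) q≡))
  , ∈-cartesianProduct⁺ (∈-dirs d) (∈-++⁺ˡ (∈-map⁺ inj₁
      (∈-upTo⁺ (s≤s (ℤP.drop‿+≤+ (subst (ℤ._≤ + suc m) q≡ q≤k))))))
sideTile-complete m d a false up ((p≤ , ≤p) , ≤q , q≤-1) with negative-form q≤-1
... | j , q≡ = inj₂ j
  , trans (sym (at-coord d a)) (trans (cong (at d _ _) up)
      (cong₂ (λ p q → at d p q false) (ℤP.≤-antisym p≤ ≤p) q≡))
  , ∈-cartesianProduct⁺ (∈-dirs d) (∈-++⁺ʳ (map inj₁ (upTo (2 ℕ.+ m))) (∈-map⁺ inj₂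
      (∈-upTo⁺ (code-bound m j (subst (1ℤ ℤ.- + suc m ℤ.≤_) q≡ ≤q)))))

boundary⊆sides : ∀ m {e} → e ∈ boundary (filled m) → e ∈ map (sideEdge m) (sides m)
boundary⊆sides m {a , b} e∈ =
  let a∈ , ab , b∉ = ∈-boundary⁻ (filled m) e∈
      d , b≡ = adj⇒nbr a ab
      b-outside = ¬inside⇒outside (nbr d a) (subst (_∉ hexagon m) b≡ b∉ ∘ inside⇒∈)
      x , a≡ , x∈ = sideTile-complete m d a (isUp a) refl (side-position d a (∈⇒inside a∈ , b-outside))
  in subst (_∈ map (sideEdge m) (sides m)) (cong₂ _,_ (sym a≡) (trans (cong (nbr d) (sym a≡)) (sym b≡)))
       (∈-map⁺ (sideEdge m) x∈)

-- An upper bound is enough, because the isoperimetric inequality supplies the other direction. So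
-- the listed side edges only have to cover the boundary.
perimeter-filled : ∀ m → perimeter (filled m) ℕ.≤ 6 ℕ.* suc m
perimeter-filled m = begin
  perimeter (filled m)                   ≡⟨ length-boundary (filled m) ⟨
  length (boundary (filled m))           ≤⟨ length-mono-⊆ (unique-boundary (filled m)) (boundary⊆sides m) ⟩
  length (map (sideEdge m) (sides m))    ≡⟨ length-map (sideEdge m) (sides m) ⟩
  length (sides m)                       ≡⟨ length-sides m ⟩
  6 ℕ.* suc m                            ∎
  where open ℕP.≤-Reasoning

-- The isoperimetric inequality

minimum : ∀ (μ : Tile → ℤ) t ts → Σ Tile λ u → u ∈ t ∷ ts × (∀ {v} → v ∈ t ∷ ts → μ u ℤ.≤ μ v)
minimum μ t [] = t , here refl , λ { (here refl) → ℤP.≤-refl }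
minimum μ t (s ∷ ss) with minimum μ s ss
... | u , u∈ , min with ℤP.≤-total (μ t) (μ u)
...   | inj₁ t≤u = t , here refl , λ { (here refl) → ℤP.≤-refl ; (there v∈) → ℤP.≤-trans t≤u (min v∈) }
...   | inj₂ u≤t = u , there u∈ , λ { (here refl) → u≤t ; (there v∈) → min v∈ }

adj-coord : ∀ d t {u} → Adj t u → coord d u ℤ.≤ coord d t ℤ.+ 1ℤ
adj-coord d t a with adj⇒nbr t a
... | e , refl = go d e t
  where
  same : ∀ {i j} → i ≡ j → i ℤ.≤ j ℤ.+ 1ℤ
  same {i} refl = ℤP.i≤i+j i 1ℤ
  own : ∀ d t → coord d (nbr d t) ℤ.≤ coord d t ℤ.+ 1ℤ
  own d t = subst (ℤ._≤ coord d t ℤ.+ 1ℤ) (sym (coord-nbr d t)) (ℤP.+-monoʳ-≤ (coord d t) (step≤1 (isUp t)))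
    where
    step≤1 : ∀ b → stepOf b ℤ.≤ 1ℤ
    step≤1 true  = ℤ.-≤+
    step≤1 false = ℤP.≤-refl
  go : ∀ d e t → coord d (nbr e t) ℤ.≤ coord d t ℤ.+ 1ℤ
  go W W t = own W t
  go X X t = own X t
  go Y Y t = own Y t
  go W X t = same (coord-nbr-≢ W X (λ ()) t)
  go W Y t = same (coord-nbr-≢ W Y (λ ()) t)
  go X W t = same (coord-nbr-≢ X W (λ ()) t)
  go X Y t = same (coord-nbr-≢ X Y (λ ()) t)
  go Y W t = same (coord-nbr-≢ Y W (λ ()) t)
  go Y X t = same (coord-nbr-≢ Y X (λ ()) t)

-- A step changes a coordinate by at most one, so a path cannot jump over a value.
intermediate-value : ∀ d {P a b v} → Path P a b → coord d a ℤ.≤ v → v ℤ.≤ coord d b → Σ Tile λ u → P u × coord d u ≡ v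
intermediate-value d {a = a} (here p) a≤v v≤b = a , p , ℤP.≤-antisym a≤v v≤b
intermediate-value d {a = a} {v = v} (step {b = b} p e r) a≤v v≤c with coord d a ℤP.≟ v
... | yes eq = a , p , eq
... | no  ≢v = intermediate-value d r
  (ℤP.≤-trans (adj-coord d a e) (subst (ℤ._≤ v) (ℤP.+-comm 1ℤ (coord d a)) (ℤP.i<j⇒suc[i]≤j (ℤP.≤∧≢⇒< a≤v ≢v)))) v≤c

≤⇒+ : ∀ {i j} → i ℤ.≤ j → Σ ℕ λ n → j ≡ i ℤ.+ + n
≤⇒+ {i} {j} i≤j with nonneg-form (ℤP.i≤j⇒0≤j-i i≤j)
... | n , eq = n , trans (lem i j) (cong (ℤ._+_ i) eq)
  where
  lem : ∀ i j → j ≡ i ℤ.+ (j ℤ.- i)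
  lem = solve-∀

-- The number of strips met is `suc width`. Connectedness enters the isoperimetric inequality
-- through `attained`: no strip in the range is skipped.
record Span (A : Polyiamond) (d : Dir) : Set where
  field
    low      : ℤ
    width    : ℕ
    lower    : ∀ {t} → t ∈ tiles A → low ℤ.≤ coord d t
    upper    : ∀ {t} → t ∈ tiles A → coord d t ℤ.≤ low ℤ.+ + width
    attained : ∀ {i} → i ℕ.≤ width → Σ Tile λ t → t ∈ tiles A × coord d t ≡ low ℤ.+ + i

span : ∀ A d → Span A d
span A d = fromList (tiles A) refl
  where
  fromList : ∀ ts → tiles A ≡ ts → Span A d
  fromList []       eq = ⊥-elim (nonempty A eq)
  fromList (t ∷ ts) eq with minimum (coord d) t ts | minimum (ℤ.-_ ∘ coord d) t ts
  ... | a , a∈ , min | b , b∈ , max = record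
    { low = coord d a ; width = proj₁ a≤b ; lower = min ∘ subst (_ ∈_) eq
    ; upper = λ {u} u∈ → subst (coord d u ℤ.≤_) (proj₂ a≤b) (ℤP.neg-cancel-≤ (max (subst (u ∈_) eq u∈)))
    ; attained = λ {i} i≤ → intermediate-value d (connected A a b (subst (a ∈_) (sym eq) a∈) (subst (b ∈_) (sym eq) b∈))
        (ℤP.i≤i+j (coord d a) (+ i)) (subst (coord d a ℤ.+ + i ℤ.≤_) (sym (proj₂ a≤b)) (ℤP.+-monoʳ-≤ (coord d a) (ℤ.+≤+ i≤))) }
    where
    a≤b : Σ ℕ λ n → coord d b ≡ coord d a ℤ.+ + n
    a≤b = ≤⇒+ (min b∈)

-- Within the strip on which the third coordinate is constant, onward e f passes to the next tile
-- in the direction of increasing e and decreasing f.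
onward : Dir → Dir → Tile → Tile
onward e f t = if isUp t then nbr f t else nbr e t

coord-onward : ∀ d e f → d ≢ e → d ≢ f → ∀ t → coord d (onward e f t) ≡ coord d t
coord-onward d e f d≢e d≢f t@(_ , _ , true)  = coord-nbr-≢ d f d≢f t
coord-onward d e f d≢e d≢f t@(_ , _ , false) = coord-nbr-≢ d e d≢e t

slope : Dir → Dir → Tile → ℤ
slope e f t = coord e t ℤ.- coord f t

slope-onward : ∀ e f → e ≢ f → ∀ t → slope e f (onward e f t) ≡ slope e f t ℤ.+ 1ℤ
slope-onward e f e≢f t@(_ , _ , true) =
  trans (cong₂ ℤ._-_ (coord-nbr-≢ e f e≢f t) (coord-nbr f t)) (lem (coord e t) (coord f t))
  where
  lem : ∀ a b → a ℤ.- (b ℤ.+ -1ℤ) ≡ a ℤ.- b ℤ.+ 1ℤ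
  lem = solve-∀
slope-onward e f e≢f t@(_ , _ , false) =
  trans (cong₂ ℤ._-_ (coord-nbr e t) (coord-nbr-≢ f e (e≢f ∘ sym) t)) (lem (coord e t) (coord f t))
  where
  lem : ∀ a b → a ℤ.+ 1ℤ ℤ.- b ≡ a ℤ.- b ℤ.+ 1ℤ
  lem = solve-∀

module _ (A : Polyiamond) where

  -- Every move onward stays in the strip and raises the slope by one. Since the slope is bounded on
  -- the polyiamond, the walk must leave it.
  strip-end : ∀ d e f → d ≢ e → d ≢ f → e ≢ f → ∀ {t} → t ∈ tiles A →
              Σ Tile λ u → u ∈ tiles A × coord d u ≡ coord d t × onward e f u ∉ tiles A
  strip-end d e f d≢e d≢f e≢f {t} t∈ = go ∣ top ℤ.- slope e f t ∣ t t∈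
    (subst (ℤ._≤ slope e f t ℤ.+ + ∣ top ℤ.- slope e f t ∣) (lem (slope e f t) top)
      (ℤP.+-monoʳ-≤ (slope e f t) (i≤∣i∣ (top ℤ.- slope e f t))))
    where
    top : ℤ
    top = proj₁ (bounded (slope e f) (tiles A))
    lem : ∀ i j → i ℤ.+ (j ℤ.- i) ≡ j
    lem = solve-∀
    go : ∀ n t → t ∈ tiles A → top ℤ.≤ slope e f t ℤ.+ + n →
         Σ Tile λ u → u ∈ tiles A × coord d u ≡ coord d t × onward e f u ∉ tiles A
    go n t t∈ top≤ with onward e f t ∈?A A
    ... | no ∉A = t , t∈ , refl , ∉A
    go zero t t∈ top≤ | yes ∈A = ⊥-elim (ℤP.<-irrefl refl (ℤP.<-≤-trans (ℤP.suc[i]≤j⇒i<j {slope e f t} ℤP.≤-refl)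
      (ℤP.≤-trans (ℤP.≤-reflexive (trans (ℤP.+-comm 1ℤ (slope e f t)) (sym (slope-onward e f e≢f t))))
        (ℤP.≤-trans (proj₂ (bounded (slope e f) (tiles A)) ∈A) (subst (top ℤ.≤_) (ℤP.+-identityʳ _) top≤)))))
    go (suc n) t t∈ top≤ | yes ∈A with go n (onward e f t) ∈A
      (subst (top ℤ.≤_) (trans (sym (ℤP.+-assoc (slope e f t) 1ℤ (+ n))) (cong (ℤ._+ + n) (sym (slope-onward e f e≢f t)))) top≤)
    ... | u , u∈ , eq , u∉ = u , u∈ , trans eq (coord-onward d e f d≢e d≢f t) , u∉

  exits : Dir → Dir → List Tile → List Tile
  exits e f = filter (λ t → T? (notIn A (onward e f t)))

  exits-≥ : ∀ d e f → d ≢ e → d ≢ f → e ≢ f → suc (Span.width (span A d)) ℕ.≤ length (exits e f (tiles A))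
  exits-≥ d e f d≢e d≢f e≢f = begin
    suc width                                         ≡⟨ length-upTo (suc width) ⟨
    length (upTo (suc width))                         ≡⟨ length-map value′ (upTo (suc width)) ⟨
    length (map value′ (upTo (suc width)))            
      ≤⟨ length-mono-⊆ (Uniq.map⁺ value′-injective (Uniq.upTo⁺ (suc width))) covered ⟩
    length (map (coord d) (exits e f (tiles A)))      ≡⟨ length-map (coord d) (exits e f (tiles A)) ⟩
    length (exits e f (tiles A))                      ∎
    where
    open ℕP.≤-Reasoning
    open Span (span A d)
    value′ : ℕ → ℤ
    value′ i = low ℤ.+ + i
    value′-injective : ∀ {i j} → value′ i ≡ value′ j → i ≡ j
    value′-injective {i} {j} eq = ℤP.+-injective (trans (sym (lem low (+ i))) (trans (cong (ℤ._- low) eq) (lem low (+ j))))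
      where
      lem : ∀ a b → a ℤ.+ b ℤ.- a ≡ b
      lem = solve-∀
    covered : ∀ {v} → v ∈ map value′ (upTo (suc width)) → v ∈ map (coord d) (exits e f (tiles A))
    covered v∈ with ∈-map⁻ value′ v∈
    ... | i , i∈ , refl with attained (ℕP.≤-pred (∈-upTo⁻ i∈))
    ...   | t , t∈ , eq with strip-end d e f d≢e d≢f e≢f t∈
    ...     | u , u∈ , eq′ , u∉ = subst (_∈ map (coord d) (exits e f (tiles A))) (trans eq′ eq)
      (∈-map⁺ (coord d) (∈-filter⁺ (λ t → T? (notIn A (onward e f t))) u∈ (notIn⁺ A u∉)))

  out : Tile → ℕ
  out t = if notIn A t then 1 else 0

  length-filter-∷ : ∀ (g : Tile → Tile) t ts →
    length (filter (λ t → T? (notIn A (g t))) (t ∷ ts)) ≡ out (g t) ℕ.+ length (filter (λ t → T? (notIn A (g t))) ts)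
  length-filter-∷ g t ts with notIn A (g t)
  ... | true  = refl
  ... | false = refl

  length-outerNeighbours : ∀ t → length (outerNeighbours A t) ≡ out (nbr W t) ℕ.+ (out (nbr X t) ℕ.+ out (nbr Y t))
  length-outerNeighbours t = trans (cong (length ∘ filter (λ b → T? (notIn A b))) (neighbours≡ t))
    (three (nbr W t) (nbr X t) (nbr Y t))
    where
    neighbours≡ : ∀ t → neighbours t ≡ nbr W t ∷ nbr X t ∷ nbr Y t ∷ []
    neighbours≡ (_ , _ , true)  = refl
    neighbours≡ (_ , _ , false) = refl
    three : ∀ a b c → length (filter (λ b → T? (notIn A b)) (a ∷ b ∷ c ∷ [])) ≡ out a ℕ.+ (out b ℕ.+ out c)
    three a b c = trans (length-filter-∷ (λ t → t) a (b ∷ c ∷ [])) (cong (out a ℕ.+_)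
      (trans (length-filter-∷ (λ t → t) b (c ∷ [])) (cong (out b ℕ.+_)
        (trans (length-filter-∷ (λ t → t) c []) (ℕP.+-identityʳ _)))))

  -- The six ordered pairs of directions are the three families of strips, each traversed in both
  -- senses.
  exitSum : List Tile → ℕ
  exitSum ts = length (exits X Y ts) ℕ.+ length (exits Y X ts) ℕ.+ (length (exits Y W ts) ℕ.+ length (exits W Y ts))
               ℕ.+ (length (exits W X ts) ℕ.+ length (exits X W ts))

  -- Each of the three neighbours of a tile lies onward in two of the six directions.
  exitSum-perimeter : ∀ ts → exitSum ts ≡ 2 ℕ.* sum (map (length ∘ outerNeighbours A) ts)
  exitSum-perimeter []       = refl
  exitSum-perimeter (t ∷ ts) = begin
    exitSum (t ∷ ts)
      ≡⟨ cong₂ ℕ._+_ (cong₂ ℕ._+_ (cong₂ ℕ._+_ (unfold X Y) (unfold Y X)) (cong₂ ℕ._+_ (unfold Y W) (unfold W Y)))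
           (cong₂ ℕ._+_ (unfold W X) (unfold X W)) ⟩
    _ ≡⟨ regroup (o X Y) (o Y X) (o Y W) (o W Y) (o W X) (o X W) _ _ _ _ _ _ ⟩
    (o X Y ℕ.+ o Y X ℕ.+ (o Y W ℕ.+ o W Y) ℕ.+ (o W X ℕ.+ o X W)) ℕ.+ exitSum ts
      ≡⟨ cong₂ ℕ._+_ (local t) (exitSum-perimeter ts) ⟩
    2 ℕ.* length (outerNeighbours A t) ℕ.+ 2 ℕ.* sum (map (length ∘ outerNeighbours A) ts)
      ≡⟨ ℕP.*-distribˡ-+ 2 (length (outerNeighbours A t)) _ ⟨
    2 ℕ.* sum (map (length ∘ outerNeighbours A) (t ∷ ts)) ∎
    where
    open ≡-Reasoning
    o : Dir → Dir → ℕ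
    o e f = out (onward e f t)
    unfold : ∀ e f → length (exits e f (t ∷ ts)) ≡ o e f ℕ.+ length (exits e f ts)
    unfold e f = length-filter-∷ (onward e f) t ts
    regroup : ∀ a b c d e f a′ b′ c′ d′ e′ f′ →
      (a ℕ.+ a′ ℕ.+ (b ℕ.+ b′)) ℕ.+ (c ℕ.+ c′ ℕ.+ (d ℕ.+ d′)) ℕ.+ (e ℕ.+ e′ ℕ.+ (f ℕ.+ f′))
      ≡ (a ℕ.+ b ℕ.+ (c ℕ.+ d) ℕ.+ (e ℕ.+ f)) ℕ.+ (a′ ℕ.+ b′ ℕ.+ (c′ ℕ.+ d′) ℕ.+ (e′ ℕ.+ f′))
    regroup = ℕSolver.solve-∀
    local : ∀ t → out (onward X Y t) ℕ.+ out (onward Y X t) ℕ.+ (out (onward Y W t) ℕ.+ out (onward W Y t))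
                  ℕ.+ (out (onward W X t) ℕ.+ out (onward X W t)) ≡ 2 ℕ.* length (outerNeighbours A t)
    local t@(_ , _ , true) rewrite length-outerNeighbours t = lem (out (nbr W t)) (out (nbr X t)) (out (nbr Y t))
      where
      lem : ∀ w x y → y ℕ.+ x ℕ.+ (w ℕ.+ y) ℕ.+ (x ℕ.+ w) ≡ 2 ℕ.* (w ℕ.+ (x ℕ.+ y))
      lem = ℕSolver.solve-∀
    local t@(_ , _ , false) rewrite length-outerNeighbours t = lem (out (nbr W t)) (out (nbr X t)) (out (nbr Y t))
      where
      lem : ∀ w x y → x ℕ.+ y ℕ.+ (y ℕ.+ w) ℕ.+ (w ℕ.+ x) ≡ 2 ℕ.* (w ℕ.+ (x ℕ.+ y))
      lem = ℕSolver.solve-∀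

  width : Dir → ℕ
  width d = Span.width (span A d)

  widths-≤-perimeter : suc (width W) ℕ.+ suc (width X) ℕ.+ suc (width Y) ℕ.≤ perimeter A
  widths-≤-perimeter = ℕP.*-cancelˡ-≤ 2 (begin
    2 ℕ.* (suc (width W) ℕ.+ suc (width X) ℕ.+ suc (width Y))
      ≡⟨ lem (suc (width W)) (suc (width X)) (suc (width Y)) ⟩
    suc (width W) ℕ.+ suc (width W) ℕ.+ (suc (width X) ℕ.+ suc (width X)) ℕ.+ (suc (width Y) ℕ.+ suc (width Y))
      ≤⟨ ℕP.+-mono-≤ (ℕP.+-mono-≤ (ℕP.+-mono-≤ (exits-≥ W X Y (λ ()) (λ ()) (λ ())) (exits-≥ W Y X (λ ()) (λ ()) (λ ())))
                                  (ℕP.+-mono-≤ (exits-≥ X Y W (λ ()) (λ ()) (λ ())) (exits-≥ X W Y (λ ()) (λ ()) (λ ()))))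
                     (ℕP.+-mono-≤ (exits-≥ Y W X (λ ()) (λ ()) (λ ())) (exits-≥ Y X W (λ ()) (λ ()) (λ ()))) ⟩
    exitSum (tiles A)
      ≡⟨ exitSum-perimeter (tiles A) ⟩
    2 ℕ.* perimeter A ∎)
    where
    open ℕP.≤-Reasoning
    lem : ∀ a b c → 2 ℕ.* (a ℕ.+ b ℕ.+ c) ≡ a ℕ.+ a ℕ.+ (b ℕ.+ b) ℕ.+ (c ℕ.+ c)
    lem = ℕSolver.solve-∀

-- Bounding the area by strip lengths

stair : ℕ → ℕ → List (ℕ × ℕ)
stair a i = map (i ,_) (upTo (suc (i ℕ.+ i ℕ.+ (a ℕ.+ a))))

-- Positions in `s` strips whose lengths form the arithmetic progression 2a + 1, 2a + 3, ....
staircase : ℕ → ℕ → List (ℕ × ℕ)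
staircase a zero    = []
staircase a (suc s) = stair a s ++ staircase a s

∈-staircase : ∀ a {s i j} → i ℕ.< s → j ℕ.< suc (i ℕ.+ i ℕ.+ (a ℕ.+ a)) → (i , j) ∈ staircase a s
∈-staircase a {suc s} {i} i≤s j< with ℕP.m≤n⇒m<n∨m≡n (ℕP.≤-pred i≤s)
... | inj₁ i<s  = ∈-++⁺ʳ (stair a s) (∈-staircase a i<s j<)
... | inj₂ refl = ∈-++⁺ˡ (∈-map⁺ (i ,_) (∈-upTo⁺ j<))

length-staircase : ∀ a s → length (staircase a s) ≡ s ℕ.* (a ℕ.+ a ℕ.+ s)
length-staircase a zero    = refl
length-staircase a (suc s) = trans (length-++ (stair a s))
  (trans (cong₂ ℕ._+_ (trans (length-map (s ,_) (upTo (suc (s ℕ.+ s ℕ.+ (a ℕ.+ a)))))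
                          (length-upTo (suc (s ℕ.+ s ℕ.+ (a ℕ.+ a))))) (length-staircase a s)) (lem a s))
  where
  lem : ∀ a s → suc (s ℕ.+ s ℕ.+ (a ℕ.+ a)) ℕ.+ s ℕ.* (a ℕ.+ a ℕ.+ s) ≡ suc s ℕ.* (a ℕ.+ a ℕ.+ suc s)
  lem = ℕSolver.solve-∀

strip-position : Tile → ℤ × ℤ
strip-position t = coord W t , slope X Y t

-- The sum x + y is 1 - w or -w according to the orientation and has the parity of x - y. Hence the
-- position determines the orientation, and with it x and y.
strip-position-injective : ∀ {t u} → strip-position t ≡ strip-position u → t ≡ u
strip-position-injective {x , y , b} {x′ , y′ , b′} eq = go b b′ (cong proj₁ eq) (cong proj₂ eq)
  where
  U : Bool → TileTerm 4
  U b = ⟨ var 2F , var 3F , b ⟩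
  ρ : Vec ℤ 4
  ρ = x ∷ y ∷ x′ ∷ y′ ∷ []
  hyp : Bool → Bool → Form 4
  hyp b b′ = coordT W (generic b) ≈T coordT W (U b′) ⊓ (var 0F ⊖ var 1F) ≈T (var 2F ⊖ var 3F)
  goal : Form 4
  goal = var 0F ≈T var 2F ⊓ var 1F ≈T var 3F
  equal : ∀ {i j} → i ≡ j → i ℤ.≤ j × j ℤ.≤ i
  equal refl = ℤP.≤-refl , ℤP.≤-refl
  tile≡ : ∀ b → ⟦ goal ⟧ ρ → (x , y , b) ≡ (x′ , y′ , b)
  tile≡ b ((p , q) , r , s) = cong₂ (λ x y → x , y , b) (ℤP.≤-antisym p q) (ℤP.≤-antisym r s)
  go : ∀ b b′ → coord W (x , y , b) ≡ coord W (x′ , y′ , b′) → x ℤ.- y ≡ x′ ℤ.- y′ → (x , y , b) ≡ (x′ , y′ , b′)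
  go true  true  p q = tile≡ true (entails [] (hyp true true) goal refl ρ (equal p , equal q))
  go false false p q = tile≡ false (entails [] (hyp false false) goal refl ρ (equal p , equal q))
  go true  false p q = ⊥-elim (entails [] (hyp true false) ff refl ρ (equal p , equal q))
  go false true  p q = ⊥-elim (entails [] (hyp false true) ff refl ρ (equal p , equal q))

module _ {x₁ y₁ w₀ : ℤ} where

  private
    v-x₁ v-y₁ v-w₀ : Term 5
    v-x₁ = var 2F
    v-y₁ = var 3F
    v-w₀ = var 4F
    offset : Bool → Term 5
    offset b = var 0F ⊖ var 1F ⊕ coordT W (generic b) ⊕ (v-y₁ ⊕ v-y₁)
    limit′ : Bool → Term 5
    limit′ b = let i = coordT W (generic b) ⊖ v-w₀; β = v-x₁ ⊕ v-y₁ ⊕ v-w₀ in con 1ℤ ⊕ (i ⊕ i ⊕ (β ⊕ β))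

  -- With b the coordinate sum, the offset is 2(y₁ - y) + b. It also equals 2(x + w + y₁) - b,
  -- whence the bound from x₁ in the next lemma.
  lower-offset-nonneg : ∀ t → coord Y t ℤ.≤ y₁ → 0ℤ ℤ.≤ slope X Y t ℤ.+ coord W t ℤ.+ (y₁ ℤ.+ y₁)
  lower-offset-nonneg (x , y , true)  = entails [] (var 1F ⊑ v-y₁) (nonneg (offset true)) refl (x ∷ y ∷ x₁ ∷ y₁ ∷ w₀ ∷ [])
  lower-offset-nonneg (x , y , false) = entails [] (var 1F ⊑ v-y₁) (nonneg (offset false)) refl (x ∷ y ∷ x₁ ∷ y₁ ∷ w₀ ∷ [])

  lower-offset-bound : ∀ t → coord X t ℤ.≤ x₁ → let i = coord W t ℤ.- w₀; β = x₁ ℤ.+ y₁ ℤ.+ w₀ in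
    1ℤ ℤ.+ (slope X Y t ℤ.+ coord W t ℤ.+ (y₁ ℤ.+ y₁)) ℤ.≤ 1ℤ ℤ.+ (i ℤ.+ i ℤ.+ (β ℤ.+ β))
  lower-offset-bound (x , y , true)  =
    entails [] (var 0F ⊑ v-x₁) (con 1ℤ ⊕ offset true ⊑ limit′ true) refl (x ∷ y ∷ x₁ ∷ y₁ ∷ w₀ ∷ [])
  lower-offset-bound (x , y , false) =
    entails [] (var 0F ⊑ v-x₁) (con 1ℤ ⊕ offset false ⊑ limit′ false) refl (x ∷ y ∷ x₁ ∷ y₁ ∷ w₀ ∷ [])

module _ {x₀ y₀ w₁ : ℤ} where

  private
    v-x₀ v-y₀ v-w₁ : Term 5
    v-x₀ = var 2F
    v-y₀ = var 3F
    v-w₁ = var 4F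
    offset : Bool → Term 5
    offset b = var 0F ⊖ var 1F ⊖ (v-x₀ ⊕ v-x₀ ⊖ con 1ℤ ⊕ coordT W (generic b))
    limit′ : Bool → Term 5
    limit′ b = let i = v-w₁ ⊖ coordT W (generic b); α = con 1ℤ ⊖ (v-x₀ ⊕ v-y₀ ⊕ v-w₁) in con 1ℤ ⊕ (i ⊕ i ⊕ (α ⊕ α))

  -- Here the offset is 2(x - x₀) + 1 - b, where b is the coordinate sum; the summand 1 keeps it
  -- nonnegative for up tiles. It also equals b + 1 - 2(w + y + x₀), which the next lemma bounds by
  -- means of y₀.
  upper-offset-nonneg : ∀ t → x₀ ℤ.≤ coord X t → 0ℤ ℤ.≤ slope X Y t ℤ.- (x₀ ℤ.+ x₀ ℤ.- 1ℤ ℤ.+ coord W t)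
  upper-offset-nonneg (x , y , true)  = entails [] (v-x₀ ⊑ var 0F) (nonneg (offset true)) refl (x ∷ y ∷ x₀ ∷ y₀ ∷ w₁ ∷ [])
  upper-offset-nonneg (x , y , false) = entails [] (v-x₀ ⊑ var 0F) (nonneg (offset false)) refl (x ∷ y ∷ x₀ ∷ y₀ ∷ w₁ ∷ [])

  upper-offset-bound : ∀ t → y₀ ℤ.≤ coord Y t → let i = w₁ ℤ.- coord W t; α = 1ℤ ℤ.- (x₀ ℤ.+ y₀ ℤ.+ w₁) in
    1ℤ ℤ.+ (slope X Y t ℤ.- (x₀ ℤ.+ x₀ ℤ.- 1ℤ ℤ.+ coord W t)) ℤ.≤ 1ℤ ℤ.+ (i ℤ.+ i ℤ.+ (α ℤ.+ α))
  upper-offset-bound (x , y , true)  =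
    entails [] (v-y₀ ⊑ var 1F) (con 1ℤ ⊕ offset true ⊑ limit′ true) refl (x ∷ y ∷ x₀ ∷ y₀ ∷ w₁ ∷ [])
  upper-offset-bound (x , y , false) =
    entails [] (v-y₀ ⊑ var 1F) (con 1ℤ ⊕ offset false ⊑ limit′ false) refl (x ∷ y ∷ x₀ ∷ y₀ ∷ w₁ ∷ [])

coord-sum-≥0 : ∀ t {x₁ y₁} → coord X t ℤ.≤ x₁ × coord Y t ℤ.≤ y₁ → 0ℤ ℤ.≤ x₁ ℤ.+ y₁ ℤ.+ coord W t
coord-sum-≥0 (x , y , true)  {x₁} {y₁} = entails [] (var 0F ⊑ var 2F ⊓ var 1F ⊑ var 3F)
  (nonneg (var 2F ⊕ var 3F ⊕ coordT W (generic true))) refl (x ∷ y ∷ x₁ ∷ y₁ ∷ [])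
coord-sum-≥0 (x , y , false) {x₁} {y₁} = entails [] (var 0F ⊑ var 2F ⊓ var 1F ⊑ var 3F)
  (nonneg (var 2F ⊕ var 3F ⊕ coordT W (generic false))) refl (x ∷ y ∷ x₁ ∷ y₁ ∷ [])

coord-sum-≤1 : ∀ t {x₀ y₀} → x₀ ℤ.≤ coord X t × y₀ ℤ.≤ coord Y t → 0ℤ ℤ.≤ 1ℤ ℤ.- (x₀ ℤ.+ y₀ ℤ.+ coord W t)
coord-sum-≤1 (x , y , true)  {x₀} {y₀} = entails [] (var 2F ⊑ var 0F ⊓ var 3F ⊑ var 1F)
  (nonneg (con 1ℤ ⊖ (var 2F ⊕ var 3F ⊕ coordT W (generic true)))) refl (x ∷ y ∷ x₀ ∷ y₀ ∷ [])
coord-sum-≤1 (x , y , false) {x₀} {y₀} = entails [] (var 2F ⊑ var 0F ⊓ var 3F ⊑ var 1F)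
  (nonneg (con 1ℤ ⊖ (var 2F ⊕ var 3F ⊕ coordT W (generic false)))) refl (x ∷ y ∷ x₀ ∷ y₀ ∷ [])

module _ (A : Polyiamond) where

  private
    module SX = Span (span A X)
    module SY = Span (span A Y)
    module SW = Span (span A W)
    x₀ y₀ w₀ x₁ y₁ w₁ : ℤ
    x₀ = SX.low
    y₀ = SY.low
    w₀ = SW.low
    x₁ = x₀ ℤ.+ + SX.width
    y₁ = y₀ ℤ.+ + SY.width
    w₁ = w₀ ℤ.+ + SW.width

    -- A tile of the lowest w-strip has coordinate sum at least 0, so the upper bounds on x and y
    -- make this quantity nonnegative. By symmetry `alpha` uses the highest strip and the coordinate
    -- sum at most 1.
    beta : Σ ℕ λ β → x₁ ℤ.+ y₁ ℤ.+ w₀ ≡ + β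
    beta with SW.attained {0} z≤n
    ... | t , t∈ , eq = nonneg-form (subst (λ w → 0ℤ ℤ.≤ x₁ ℤ.+ y₁ ℤ.+ w) (trans eq (ℤP.+-identityʳ w₀))
      (coord-sum-≥0 t (SX.upper t∈ , SY.upper t∈)))

    alpha : Σ ℕ λ α → 1ℤ ℤ.- (x₀ ℤ.+ y₀ ℤ.+ w₁) ≡ + α
    alpha with SW.attained ℕP.≤-refl
    ... | t , t∈ , eq = nonneg-form (subst (λ w → 0ℤ ℤ.≤ 1ℤ ℤ.- (x₀ ℤ.+ y₀ ℤ.+ w)) eq
      (coord-sum-≤1 t (SX.lower t∈ , SY.lower t∈)))

  β α : ℕ
  β = proj₁ beta
  α = proj₁ alpha

  -- For strip counts a, b, c in the directions X, Y, W this reads α + β = a + b - c. So α + β + 2c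
  -- is a + b + c, the lower bound for the perimeter.
  α+β : α ℕ.+ β ℕ.+ width A W ≡ suc (width A X ℕ.+ width A Y)
  α+β = ℤP.+-injective (trans (cong₂ (λ a b → a ℤ.+ b ℤ.+ + width A W) (sym (proj₂ alpha)) (sym (proj₂ beta)))
    (lem x₀ y₀ w₀ (+ width A X) (+ width A Y) (+ width A W)))
    where
    lem : ∀ x y w a b c → 1ℤ ℤ.- (x ℤ.+ y ℤ.+ (w ℤ.+ c)) ℤ.+ (x ℤ.+ a ℤ.+ (y ℤ.+ b) ℤ.+ w) ℤ.+ c ≡ 1ℤ ℤ.+ (a ℤ.+ b)
    lem = solve-∀

  lowerStrip upperStrip : ℕ × ℕ → ℤ × ℤ
  lowerStrip (i , j) = let w = w₀ ℤ.+ + i in w , + j ℤ.- w ℤ.- (y₁ ℤ.+ y₁)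
  upperStrip (i , j) = let w = w₁ ℤ.- + i in w , + j ℤ.+ (x₀ ℤ.+ x₀ ℤ.- 1ℤ ℤ.+ w)

  lower-covered : ∀ {s i t} → t ∈ tiles A → i ℕ.< s → coord W t ≡ w₀ ℤ.+ + i →
                  strip-position t ∈ map lowerStrip (staircase β s)
  lower-covered {s} {i} {t} t∈ i<s w≡ with nonneg-form (lower-offset-nonneg {x₁} {y₁} {w₀} t (SY.upper t∈))
  ... | j , j≡ = subst (_∈ map lowerStrip (staircase β s)) (sym position≡)
    (∈-map⁺ lowerStrip (∈-staircase β i<s (ℤP.drop‿+≤+ (subst₂ ℤ._≤_ (cong (ℤ._+_ 1ℤ) j≡)
      (cong₂ (λ i β → 1ℤ ℤ.+ (i ℤ.+ i ℤ.+ (β ℤ.+ β))) (trans (cong (ℤ._- w₀) w≡) (lem w₀ (+ i))) (proj₂ beta))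
      (lower-offset-bound {x₁} {y₁} {w₀} t (SX.upper t∈))))))
    where
    lem : ∀ a b → a ℤ.+ b ℤ.- a ≡ b
    lem = solve-∀
    lem′ : ∀ q w y → q ≡ q ℤ.+ w ℤ.+ y ℤ.- w ℤ.- y
    lem′ = solve-∀
    position≡ : strip-position t ≡ lowerStrip (i , j)
    position≡ = cong₂ _,_ w≡ (trans (lem′ (slope X Y t) (coord W t) (y₁ ℤ.+ y₁))
      (cong₂ (λ j w → j ℤ.- w ℤ.- (y₁ ℤ.+ y₁)) j≡ w≡))

  upper-covered : ∀ {s i t} → t ∈ tiles A → i ℕ.< s → coord W t ≡ w₁ ℤ.- + i →
                  strip-position t ∈ map upperStrip (staircase α s)
  upper-covered {s} {i} {t} t∈ i<s w≡ with nonneg-form (upper-offset-nonneg {x₀} {y₀} {w₁} t (SX.lower t∈))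
  ... | j , j≡ = subst (_∈ map upperStrip (staircase α s)) (sym position≡)
    (∈-map⁺ upperStrip (∈-staircase α i<s (ℤP.drop‿+≤+ (subst₂ ℤ._≤_ (cong (ℤ._+_ 1ℤ) j≡)
      (cong₂ (λ i α → 1ℤ ℤ.+ (i ℤ.+ i ℤ.+ (α ℤ.+ α))) (trans (cong (ℤ._-_ w₁) w≡) (lem w₁ (+ i))) (proj₂ alpha))
      (upper-offset-bound {x₀} {y₀} {w₁} t (SY.lower t∈))))))
    where
    lem : ∀ a b → a ℤ.- (a ℤ.- b) ≡ b
    lem = solve-∀
    lem′ : ∀ q z → q ≡ q ℤ.- z ℤ.+ z
    lem′ = solve-∀
    position≡ : strip-position t ≡ upperStrip (i , j)
    position≡ = cong₂ _,_ w≡ (trans (lem′ (slope X Y t) (x₀ ℤ.+ x₀ ℤ.- 1ℤ ℤ.+ coord W t))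
      (cong₂ (λ j w → j ℤ.+ (x₀ ℤ.+ x₀ ℤ.- 1ℤ ℤ.+ w)) j≡ w≡))

  covered : ∀ s s′ → s ℕ.+ s′ ≡ suc (width A W) → ∀ {t} → t ∈ tiles A →
            strip-position t ∈ map lowerStrip (staircase β s) ++ map upperStrip (staircase α s′)
  covered s s′ s+s′ {t} t∈ with ≤⇒+ (SW.lower t∈)
  ... | i , w≡ with ℕP.<-≤-connex i s
  ...   | inj₁ i<s = ∈-++⁺ˡ (lower-covered t∈ i<s w≡)
  ...   | inj₂ s≤i with ℕP.m≤n⇒∃[o]m+o≡n i≤width
    where
    i≤width : i ℕ.≤ width A W
    i≤width = ℤP.drop‿+≤+ (subst₂ ℤ._≤_ (lem w₀ (+ i)) (lem w₀ (+ width A W))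
      (ℤP.+-monoˡ-≤ (ℤ.- w₀) (subst (ℤ._≤ w₁) w≡ (SW.upper t∈))))
      where
      lem : ∀ a b → a ℤ.+ b ℤ.- a ≡ b
      lem = solve-∀
  ...     | o , i+o = ∈-++⁺ʳ (map lowerStrip (staircase β s)) (upper-covered t∈ o<s′
      (trans w≡ (trans (lem w₀ (+ i) (+ o)) (cong (λ n → w₀ ℤ.+ + n ℤ.- + o) i+o))))
    where
    lem : ∀ w i o → w ℤ.+ i ≡ w ℤ.+ (i ℤ.+ o) ℤ.- o
    lem = solve-∀
    o<s′ : o ℕ.< s′
    o<s′ = ℕP.+-cancelˡ-≤ s (suc o) s′ (begin
      s ℕ.+ suc o      ≤⟨ ℕP.+-monoˡ-≤ (suc o) s≤i ⟩
      i ℕ.+ suc o      ≡⟨ ℕP.+-suc i o ⟩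
      suc (i ℕ.+ o)    ≡⟨ cong suc i+o ⟩
      suc (width A W)  ≡⟨ s+s′ ⟨
      s ℕ.+ s′         ∎)
      where open ℕP.≤-Reasoning

  -- The i-th w-strip from one end of the range has at most 2i + 2β + 1 tiles because of the bounds
  -- x₁ and y₁, the i-th from the other end at most 2i + 2α + 1 because of x₀ and y₀.
  area-bound : ∀ s s′ → s ℕ.+ s′ ≡ suc (width A W) →
               size A ℕ.≤ s ℕ.* (β ℕ.+ β ℕ.+ s) ℕ.+ s′ ℕ.* (α ℕ.+ α ℕ.+ s′)
  area-bound s s′ s+s′ = begin
    size A
      ≡⟨ length-map strip-position (tiles A) ⟨
    length (map strip-position (tiles A))
      ≤⟨ length-mono-⊆ (Uniq.map⁺ strip-position-injective (distinct A)) (λ p∈ → case ∈-map⁻ strip-position p∈ of λ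
           { (t , t∈ , refl) → covered s s′ s+s′ t∈ }) ⟩
    length (map lowerStrip (staircase β s) ++ map upperStrip (staircase α s′))
      ≡⟨ length-++ (map lowerStrip (staircase β s)) ⟩
    length (map lowerStrip (staircase β s)) ℕ.+ length (map upperStrip (staircase α s′))
      ≡⟨ cong₂ ℕ._+_ (trans (length-map lowerStrip (staircase β s)) (length-staircase β s))
                     (trans (length-map upperStrip (staircase α s′)) (length-staircase α s′)) ⟩
    s ℕ.* (β ℕ.+ β ℕ.+ s) ℕ.+ s′ ℕ.* (α ℕ.+ α ℕ.+ s′) ∎
    where open ℕP.≤-Reasoning

2ab≤a²+b² : ∀ a b → 2 ℕ.* (a ℕ.* b) ℕ.≤ a ℕ.* a ℕ.+ b ℕ.* b
2ab≤a²+b² a b with ℕP.≤-total a b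
... | inj₁ a≤b with ℕP.m≤n⇒∃[o]m+o≡n a≤b
...   | o , refl = subst (2 ℕ.* (a ℕ.* (a ℕ.+ o)) ℕ.≤_) (lem a o) (ℕP.m≤m+n _ (o ℕ.* o))
  where
  lem : ∀ a o → 2 ℕ.* (a ℕ.* (a ℕ.+ o)) ℕ.+ o ℕ.* o ≡ a ℕ.* a ℕ.+ (a ℕ.+ o) ℕ.* (a ℕ.+ o)
  lem = ℕSolver.solve-∀
2ab≤a²+b² a b | inj₂ b≤a with ℕP.m≤n⇒∃[o]m+o≡n b≤a
...   | o , refl = subst (2 ℕ.* ((b ℕ.+ o) ℕ.* b) ℕ.≤_) (lem b o) (ℕP.m≤m+n _ (o ℕ.* o))
  where
  lem : ∀ b o → 2 ℕ.* ((b ℕ.+ o) ℕ.* b) ℕ.+ o ℕ.* o ≡ (b ℕ.+ o) ℕ.* (b ℕ.+ o) ℕ.+ b ℕ.* b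
  lem = ℕSolver.solve-∀

halve : ∀ n → Σ ℕ λ h → n ≡ h ℕ.+ h ⊎ n ≡ suc (h ℕ.+ h)
halve zero = 0 , inj₁ refl
halve (suc n) with halve n
... | h , inj₁ refl = h , inj₂ refl
... | h , inj₂ refl = suc h , inj₁ (cong suc (sym (ℕP.+-suc h h)))

-- The w-strips are divided between the two progressions as evenly as possible. With D = α + β this
-- gives 6n ≤ 6cD + 3c², plus 3 if c is odd, and (D + 2c)² exceeds 6cD + 3c² by (D - c)².
isoperimetric : ∀ A → 6 ℕ.* size A ℕ.≤ perimeter A ℕ.* perimeter A ℕ.+ 3
isoperimetric A = go (halve (suc (width A W)))
  where
  open ℕP.≤-Reasoning
  N c a b D p : ℕ
  N = size A
  c = suc (width A W)
  a = α A
  b = β A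
  D = a ℕ.+ b
  p = perimeter A
  p≥ : D ℕ.+ (c ℕ.+ c) ℕ.≤ p
  p≥ = begin
    D ℕ.+ (c ℕ.+ c)                                  ≡⟨ lem₁ D (width A W) ⟩
    D ℕ.+ width A W ℕ.+ (2 ℕ.+ width A W)            ≡⟨ cong (ℕ._+ (2 ℕ.+ width A W)) (α+β A) ⟩
    suc (width A X ℕ.+ width A Y) ℕ.+ (2 ℕ.+ width A W) ≡⟨ lem₂ (width A X) (width A Y) (width A W) ⟩
    suc (width A W) ℕ.+ suc (width A X) ℕ.+ suc (width A Y) ≤⟨ widths-≤-perimeter A ⟩
    p ∎
    where
    lem₁ : ∀ D w → D ℕ.+ (suc w ℕ.+ suc w) ≡ D ℕ.+ w ℕ.+ (2 ℕ.+ w)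
    lem₁ = ℕSolver.solve-∀
    lem₂ : ∀ x y w → suc (x ℕ.+ y) ℕ.+ (2 ℕ.+ w) ≡ suc w ℕ.+ suc x ℕ.+ suc y
    lem₂ = ℕSolver.solve-∀
  finish : ∀ {q} → 6 ℕ.* N ℕ.≤ q ℕ.* q ℕ.+ 3 → q ≡ D ℕ.+ (c ℕ.+ c) → 6 ℕ.* N ℕ.≤ p ℕ.* p ℕ.+ 3
  finish {q} ≤q refl = ℕP.≤-trans ≤q (ℕP.+-monoˡ-≤ 3 (ℕP.*-mono-≤ p≥ p≥))
  go : Σ ℕ (λ h → c ≡ h ℕ.+ h ⊎ c ≡ suc (h ℕ.+ h)) → 6 ℕ.* N ℕ.≤ p ℕ.* p ℕ.+ 3
  go (h , inj₁ c≡) = finish {D ℕ.+ (h ℕ.+ h ℕ.+ (h ℕ.+ h))} (begin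
    6 ℕ.* N
      ≤⟨ ℕP.*-monoʳ-≤ 6 (area-bound A h h (sym c≡)) ⟩
    6 ℕ.* (h ℕ.* (b ℕ.+ b ℕ.+ h) ℕ.+ h ℕ.* (a ℕ.+ a ℕ.+ h))
      ≡⟨ lem₁ a b h ⟩
    2 ℕ.* (D ℕ.* (h ℕ.+ h)) ℕ.+ (8 ℕ.* (D ℕ.* h) ℕ.+ 12 ℕ.* (h ℕ.* h))
      ≤⟨ ℕP.+-monoˡ-≤ _ (2ab≤a²+b² D (h ℕ.+ h)) ⟩
    D ℕ.* D ℕ.+ (h ℕ.+ h) ℕ.* (h ℕ.+ h) ℕ.+ (8 ℕ.* (D ℕ.* h) ℕ.+ 12 ℕ.* (h ℕ.* h))
      ≡⟨ lem₂ D h ⟩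
    (D ℕ.+ (h ℕ.+ h ℕ.+ (h ℕ.+ h))) ℕ.* (D ℕ.+ (h ℕ.+ h ℕ.+ (h ℕ.+ h)))
      ≤⟨ ℕP.m≤m+n _ 3 ⟩
    (D ℕ.+ (h ℕ.+ h ℕ.+ (h ℕ.+ h))) ℕ.* (D ℕ.+ (h ℕ.+ h ℕ.+ (h ℕ.+ h))) ℕ.+ 3 ∎)
    (cong (λ c → D ℕ.+ (c ℕ.+ c)) (sym c≡))
    where
    lem₁ : ∀ a b h → 6 ℕ.* (h ℕ.* (b ℕ.+ b ℕ.+ h) ℕ.+ h ℕ.* (a ℕ.+ a ℕ.+ h)) ≡
                     2 ℕ.* ((a ℕ.+ b) ℕ.* (h ℕ.+ h)) ℕ.+ (8 ℕ.* ((a ℕ.+ b) ℕ.* h) ℕ.+ 12 ℕ.* (h ℕ.* h))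
    lem₁ = ℕSolver.solve-∀
    lem₂ : ∀ D h → D ℕ.* D ℕ.+ (h ℕ.+ h) ℕ.* (h ℕ.+ h) ℕ.+ (8 ℕ.* (D ℕ.* h) ℕ.+ 12 ℕ.* (h ℕ.* h)) ≡
                   (D ℕ.+ (h ℕ.+ h ℕ.+ (h ℕ.+ h))) ℕ.* (D ℕ.+ (h ℕ.+ h ℕ.+ (h ℕ.+ h)))
    lem₂ = ℕSolver.solve-∀
  go (h , inj₂ c≡) = finish {D ℕ.+ (suc (h ℕ.+ h) ℕ.+ suc (h ℕ.+ h))} (begin
    6 ℕ.* N
      ≡⟨ lem₀ N ⟩
    3 ℕ.* (N ℕ.+ N)
      -- For odd c neither division is even. Adding the bounds for both unequal divisions restores
      -- the symmetry in α and β, so that only their sum matters; the imbalance costs the summand 3.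
      ≤⟨ ℕP.*-monoʳ-≤ 3 (ℕP.+-mono-≤ (area-bound A h (suc h) (trans (ℕP.+-suc h h) (sym c≡))) (area-bound A (suc h) h (sym c≡))) ⟩
    3 ℕ.* (h ℕ.* (b ℕ.+ b ℕ.+ h) ℕ.+ suc h ℕ.* (a ℕ.+ a ℕ.+ suc h) ℕ.+ (suc h ℕ.* (b ℕ.+ b ℕ.+ suc h) ℕ.+ h ℕ.* (a ℕ.+ a ℕ.+ h)))
      ≡⟨ lem₁ a b h ⟩
    2 ℕ.* (D ℕ.* suc (h ℕ.+ h)) ℕ.+ (4 ℕ.* (D ℕ.* suc (h ℕ.+ h)) ℕ.+ 3 ℕ.* (suc (h ℕ.+ h) ℕ.* suc (h ℕ.+ h)) ℕ.+ 3)
      ≤⟨ ℕP.+-monoˡ-≤ _ (2ab≤a²+b² D (suc (h ℕ.+ h))) ⟩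
    D ℕ.* D ℕ.+ suc (h ℕ.+ h) ℕ.* suc (h ℕ.+ h) ℕ.+ (4 ℕ.* (D ℕ.* suc (h ℕ.+ h)) ℕ.+ 3 ℕ.* (suc (h ℕ.+ h) ℕ.* suc (h ℕ.+ h)) ℕ.+ 3)
      ≡⟨ lem₂ D (suc (h ℕ.+ h)) ⟩
    (D ℕ.+ (suc (h ℕ.+ h) ℕ.+ suc (h ℕ.+ h))) ℕ.* (D ℕ.+ (suc (h ℕ.+ h) ℕ.+ suc (h ℕ.+ h))) ℕ.+ 3 ∎)
    (cong (λ c → D ℕ.+ (c ℕ.+ c)) (sym c≡))
    where
    lem₀ : ∀ N → 6 ℕ.* N ≡ 3 ℕ.* (N ℕ.+ N)
    lem₀ = ℕSolver.solve-∀
    lem₁ : ∀ a b h →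
       3 ℕ.* (h ℕ.* (b ℕ.+ b ℕ.+ h) ℕ.+ suc h ℕ.* (a ℕ.+ a ℕ.+ suc h) ℕ.+ (suc h ℕ.* (b ℕ.+ b ℕ.+ suc h) ℕ.+ h ℕ.* (a ℕ.+ a ℕ.+ h)))
       ≡ 2 ℕ.* ((a ℕ.+ b) ℕ.* suc (h ℕ.+ h)) ℕ.+
         (4 ℕ.* ((a ℕ.+ b) ℕ.* suc (h ℕ.+ h)) ℕ.+ 3 ℕ.* (suc (h ℕ.+ h) ℕ.* suc (h ℕ.+ h)) ℕ.+ 3)
    lem₁ = ℕSolver.solve-∀
    lem₂ : ∀ D c → D ℕ.* D ℕ.+ c ℕ.* c ℕ.+ (4 ℕ.* (D ℕ.* c) ℕ.+ 3 ℕ.* (c ℕ.* c) ℕ.+ 3) ≡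
                   (D ℕ.+ (c ℕ.+ c)) ℕ.* (D ℕ.+ (c ℕ.+ c)) ℕ.+ 3
    lem₂ = ℕSolver.solve-∀

-- The numbers of tiles and holes, and minimality

module _ (m : ℕ) where

  private
    k τ : ℕ
    k = suc m
    τ = length (triangle m)

  hk≡ : hk k ≡ 3 ℕ.* τ
  hk≡ = trans (cong (ℕ._/ 2) numerator) (m*n/n≡m (3 ℕ.* τ) 2)
    where
    lem : ∀ m → 3 ℕ.* suc m ℕ.* suc m ≡ 3 ℕ.* (m ℕ.* suc m) ℕ.+ 3 ℕ.* suc m
    lem = ℕSolver.solve-∀
    lem′ : ∀ τ → 3 ℕ.* (2 ℕ.* τ) ≡ 3 ℕ.* τ ℕ.* 2
    lem′ = ℕSolver.solve-∀
    numerator : 3 ℕ.* k ℕ.* k ℕ.∸ 3 ℕ.* k ≡ 3 ℕ.* τ ℕ.* 2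
    numerator = trans (cong (ℕ._∸ 3 ℕ.* k) (lem m)) (trans (ℕP.m+n∸n≡m (3 ℕ.* (m ℕ.* suc m)) (3 ℕ.* k))
      (trans (cong (3 ℕ.*_) (sym (length-triangle m))) (lem′ τ)))

  size+holes : size (spiral m) ℕ.+ 3 ℕ.* τ ≡ 4 ℕ.+ 3 ℕ.* (2 ℕ.* (m ℕ.* (2 ℕ.+ m)))
  size+holes = trans (ℕP.+-comm (size (spiral m)) (3 ℕ.* τ))
    (trans (cong (ℕ._+ size (spiral m)) (sym (length-holeTiles m)))
      (trans (length-filter-¬ hole? (hexagon m)) (length-hexagon m)))

  nk≡ : nk k ≡ size (spiral m)
  nk≡ = trans (cong (λ n → n ℕ./ 2 ℕ.∸ 2) numerator)
    (trans (cong (ℕ._∸ 2) (m*n/n≡m (size (spiral m) ℕ.+ 2) 2)) (ℕP.m+n∸n≡m (size (spiral m)) 2))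
    where
    numerator : 9 ℕ.* k ℕ.* k ℕ.+ 3 ℕ.* k ≡ (size (spiral m) ℕ.+ 2) ℕ.* 2
    -- Adding twice the number of holes to both sides brings in the known area of the hexagon and
    -- avoids subtraction.
    numerator = ℕP.+-cancelʳ-≡ (3 ℕ.* (2 ℕ.* τ)) _ _ (begin
      9 ℕ.* k ℕ.* k ℕ.+ 3 ℕ.* k ℕ.+ 3 ℕ.* (2 ℕ.* τ)
        ≡⟨ cong (λ x → 9 ℕ.* k ℕ.* k ℕ.+ 3 ℕ.* k ℕ.+ 3 ℕ.* x) (length-triangle m) ⟩
      9 ℕ.* k ℕ.* k ℕ.+ 3 ℕ.* k ℕ.+ 3 ℕ.* (m ℕ.* k)
        ≡⟨ lem m ⟩
      2 ℕ.* (4 ℕ.+ 3 ℕ.* (2 ℕ.* (m ℕ.* (2 ℕ.+ m)))) ℕ.+ 4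
        ≡⟨ cong (λ n → 2 ℕ.* n ℕ.+ 4) (sym size+holes) ⟩
      2 ℕ.* (size (spiral m) ℕ.+ 3 ℕ.* τ) ℕ.+ 4
        ≡⟨ lem′ (size (spiral m)) τ ⟩
      (size (spiral m) ℕ.+ 2) ℕ.* 2 ℕ.+ 3 ℕ.* (2 ℕ.* τ) ∎)
      where
      open ≡-Reasoning
      lem : ∀ m → 9 ℕ.* suc m ℕ.* suc m ℕ.+ 3 ℕ.* suc m ℕ.+ 3 ℕ.* (m ℕ.* suc m)
                  ≡ 2 ℕ.* (4 ℕ.+ 3 ℕ.* (2 ℕ.* (m ℕ.* (2 ℕ.+ m)))) ℕ.+ 4
      lem = ℕSolver.solve-∀
      lem′ : ∀ s τ → 2 ℕ.* (s ℕ.+ 3 ℕ.* τ) ℕ.+ 4 ≡ (s ℕ.+ 2) ℕ.* 2 ℕ.+ 3 ℕ.* (2 ℕ.* τ)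
      lem′ = ℕSolver.solve-∀

  nk+hk≡ : nk k ℕ.+ hk k ≡ size (filled m)
  nk+hk≡ = trans (cong₂ ℕ._+_ nk≡ hk≡) (trans size+holes (sym (length-hexagon m)))

-- Here k = m + 2. A perimeter below 6k is at most 6k - 1 = 11 + 6m, and 6n = 36k² - 12 exceeds (6k
-- - 1)² + 3 by 12k - 16 = 8 + 12m.
perimeter-lower : ∀ m A → size A ≡ size (filled (suc m)) → 6 ℕ.* suc (suc m) ℕ.≤ perimeter A
perimeter-lower m A eq with ℕP.≤-<-connex (6 ℕ.* suc (suc m)) (perimeter A)
... | inj₁ ≤p = ≤p
... | inj₂ p< = ⊥-elim (ℕP.<-irrefl refl (begin-strict
  6 ℕ.* size A                                  ≤⟨ isoperimetric A ⟩
  perimeter A ℕ.* perimeter A ℕ.+ 3             ≤⟨ ℕP.+-monoˡ-≤ 3 (ℕP.*-mono-≤ p≤ p≤) ⟩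
  (11 ℕ.+ 6 ℕ.* m) ℕ.* (11 ℕ.+ 6 ℕ.* m) ℕ.+ 3  <⟨ ℕP.m<m+n _ {8 ℕ.+ 12 ℕ.* m} (s≤s z≤n) ⟩
  (11 ℕ.+ 6 ℕ.* m) ℕ.* (11 ℕ.+ 6 ℕ.* m) ℕ.+ 3 ℕ.+ (8 ℕ.+ 12 ℕ.* m) ≡⟨ lem′ m ⟩
  6 ℕ.* (4 ℕ.+ 3 ℕ.* (2 ℕ.* (suc m ℕ.* (2 ℕ.+ suc m)))) ≡⟨ cong (6 ℕ.*_) (trans eq (length-hexagon (suc m))) ⟨
  6 ℕ.* size A ∎))
  where
  open ℕP.≤-Reasoning
  lem : ∀ m → 6 ℕ.* suc (suc m) ≡ suc (11 ℕ.+ 6 ℕ.* m)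
  lem = ℕSolver.solve-∀
  lem′ : ∀ m → (11 ℕ.+ 6 ℕ.* m) ℕ.* (11 ℕ.+ 6 ℕ.* m) ℕ.+ 3 ℕ.+ (8 ℕ.+ 12 ℕ.* m)
             ≡ 6 ℕ.* (4 ℕ.+ 3 ℕ.* (2 ℕ.* (suc m ℕ.* (2 ℕ.+ suc m))))
  lem′ = ℕSolver.solve-∀
  p≤ : perimeter A ℕ.≤ 11 ℕ.+ 6 ℕ.* m
  p≤ = ℕP.≤-pred (subst (perimeter A ℕ.<_) (lem m) p<)

theorem2 : ∀ (k : ℕ) → 1 < k →
    Σ Polyiamond λ A → Σ (List (List Tile)) λ Hs → Σ ℕ λ p →
    size A ≡ nk k × HoleList A Hs × length Hs ≡ hk k
    × DualTree A
    × HasOuterPerimeter A p × IsPmin (nk k + hk k) p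
    × All (λ H → length H ≡ 1) Hs
theorem2 (suc (suc m)) _ =
  spiral m′ , holeList m′ , perimeter (filled m′) ,
  sym (nk≡ m′) , spiral-holes m′ ,
  trans (length-map (_∷ []) (holeTiles m′)) (trans (length-holeTiles m′) (sym (hk≡ m′))) ,
  spiral-tree m′ , spiral-outerPerimeter m′ ,
  ((filled m′ , sym (nk+hk≡ m′) , refl) ,
   λ B eq → ℕP.≤-trans (perimeter-filled m′) (perimeter-lower m B (trans eq (nk+hk≡ m′)))) ,
  holeList-area m′
  where
  m′ : ℕ
  m′ = suc m
theorem2 (suc zero) (s≤s ())
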